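{- Let $n \ge 3$ be an integer and let $M$ be a planar integral point set of cardinality $n$ in semi-general position whose characteristic is not of the form $4k+3$ with $k \in \mathbb{N}_0$ (equivalently, since the characteristic is squarefree, it is of the form $4k+1$ or $4k+2$). Then $$\operatorname{diam} M \ge \left( \frac{25\,n}{36} \right)^{5/4}.$$
   Context: $\mathbb{N}_0=\{0,1,2,\dots\}$. A planar integral point set is a set $M\subset\mathbb{R}^2$ of points, not all on one straight line, such that the Euclidean distance between any two points of $M$ is an integer (such a set is finite). It is in semi-general position if no three of its points are collinear. Its diameter is $\operatorname{diam} M=\max_{A,B\in M}|AB|$. Two numbers are commensurable if their ratio is rational. The characteristic $\operatorname{char} M$ of a planar integral point set $M$ is the (uniquely determined) squarefree positive integer $q$ such that the area of every triangle with vertices in $M$ is commensurable with $\sqrt{q}$, i.e. is a rational multiple of $\sqrt q$; a positive integer is squarefree if its only perfect square divisor is $1$. -}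

module Defs where

open import Algebra.Bundles using (RawRing)
open import Data.Bool.Base using (if_then_else_)
open import Data.Fin.Base using (Fin)
open import Data.Integer.Base as ℤ using (ℤ; +_; +[1+_])
import Data.Integer.Properties as ℤ
open import Data.Integer.Solver using () renaming (module +-*-Solver to ℤS)
open import Data.Nat.Base as ℕ using (ℕ; zero; suc; NonZero)
open import Data.Nat.Divisibility using (_∣_)
import Data.Nat.Properties as ℕ
open import Data.Product using (∃-syntax; _×_; _,_; proj₁; proj₂)
open import Data.Product.Relation.Binary.Pointwise.NonDependent using (Pointwise)
open import Data.Rational.Base as ℚ using (ℚ; mkℚ; 0ℚ; 1ℚ; ½; ∣_∣; Positive; positive; nonNegative)
import Data.Rational.Properties as ℚ
open import Data.Rational.Solver using (module +-*-Solver)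
import Data.Rational.Unnormalised.Base as ℚᵘ
import Data.Rational.Unnormalised.Properties as ℚᵘ
open import Data.Sum.Base using (inj₁; inj₂)
open import Data.Vec.Functional using (foldr; _∷_; [])
open import Function.Definitions using (Injective)
open import Level using (0ℓ)
open import Relation.Binary.PropositionalEquality
  using (_≡_; _≢_; refl; sym; trans; cong; cong₂; subst)
open import Relation.Nullary.Decidable.Core using (does; yes; no)
open import Relation.Unary using (Pred; Decidable)
open import Relation.Nullary.Negation.Core using (¬_; contradiction)

open import Algebra.Definitions.RawSemiring ℚ.+-*-rawSemiring using ()
  renaming (_^_ to _^ℚ_)

module Estimates where
  open import Data.Rational.Base using (_+_; _*_; _-_; -_; _≤_; _<_; _⊔_; _/_)
  open ℚ.≤-Reasoning
  open +-*-Solver using (solve; _:=_; _:+_; _:*_; _:-_; :-_; con)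

  ∣-∣≤ : ∀ {p q ε} → p ≤ q + ε → q ≤ p + ε → ∣ p - q ∣ ≤ ε
  ∣-∣≤ {p} {q} {ε} p≤ q≤ with ℚ.∣p∣≡p∨∣p∣≡-p (p - q)
  ... | inj₁ eq = begin
    ∣ p - q ∣    ≡⟨ eq ⟩
    p - q        ≤⟨ ℚ.+-monoˡ-≤ (- q) p≤ ⟩
    q + ε - q    ≡⟨ solve 2 (λ q ε → q :+ ε :- q := ε) refl q ε ⟩
    ε            ∎
  ... | inj₂ eq = begin
    ∣ p - q ∣    ≡⟨ eq ⟩
    - (p - q)    ≡⟨ solve 2 (λ p q → :- (p :- q) := q :- p) refl p q ⟩
    q - p        ≤⟨ ℚ.+-monoˡ-≤ (- p) q≤ ⟩
    p + ε - p    ≡⟨ solve 2 (λ p ε → p :+ ε :- p := ε) refl p ε ⟩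
    ε            ∎

  p≤∣p∣ : ∀ p → p ≤ ∣ p ∣
  p≤∣p∣ p with ℚ.≤-total 0ℚ p
  ... | inj₁ 0≤p = ℚ.≤-reflexive (sym (ℚ.0≤p⇒∣p∣≡p 0≤p))
  ... | inj₂ p≤0 = ℚ.≤-trans p≤0 (ℚ.0≤∣p∣ p)

  ∣-∣-sym : ∀ p q → ∣ p - q ∣ ≡ ∣ q - p ∣
  ∣-∣-sym p q = trans (sym (ℚ.∣-p∣≡∣p∣ (p - q)))
    (cong ∣_∣ (solve 2 (λ p q → :- (p :- q) := q :- p) refl p q))

  ∣-∣≤⁻¹ : ∀ {p q ε} → ∣ p - q ∣ ≤ ε → p ≤ q + ε
  ∣-∣≤⁻¹ {p} {q} {ε} h = begin
    p            ≡⟨ solve 2 (λ p q → p := q :+ (p :- q)) refl p q ⟩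
    q + (p - q)  ≤⟨ ℚ.+-monoʳ-≤ q (ℚ.≤-trans (p≤∣p∣ (p - q)) h) ⟩
    q + ε        ∎

  ∣-∣≤⁻¹′ : ∀ {p q ε} → ∣ p - q ∣ ≤ ε → q ≤ p + ε
  ∣-∣≤⁻¹′ {p} {q} {ε} h = ∣-∣≤⁻¹ (subst (_≤ ε) (∣-∣-sym p q) h)

  ½+½ : ∀ ε → ½ * ε + ½ * ε ≡ ε
  ½+½ ε = solve 1 (λ ε → con ½ :* ε :+ con ½ :* ε := ε) refl ε

  *-pos : ∀ {p q} → 0ℚ < p → 0ℚ < q → 0ℚ < p * q
  *-pos {p} {q} 0<p 0<q = ℚ.positive⁻¹ (p * q)
    {{ℚ.pos*pos⇒pos p {{positive 0<p}} q {{positive 0<q}}}}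

  ½-pos : ∀ {ε} → 0ℚ < ε → 0ℚ < ½ * ε
  ½-pos = *-pos (ℚ.positive⁻¹ ½)

  *-mono-≤ : ∀ {p q r s} → 0ℚ ≤ q → 0ℚ ≤ r → p ≤ q → r ≤ s → p * r ≤ q * s
  *-mono-≤ {p} {q} {r} {s} 0≤q 0≤r p≤q r≤s = begin
    p * r  ≤⟨ ℚ.*-monoʳ-≤-nonNeg r {{nonNegative 0≤r}} p≤q ⟩
    q * r  ≤⟨ ℚ.*-monoˡ-≤-nonNeg q {{nonNegative 0≤q}} r≤s ⟩
    q * s  ∎

  *-nonNeg : ∀ {p q} → 0ℚ ≤ p → 0ℚ ≤ q → 0ℚ ≤ p * q
  *-nonNeg {p} {q} 0≤p 0≤q = subst (_≤ p * q) (ℚ.*-zeroʳ p)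
    (ℚ.*-monoˡ-≤-nonNeg p {{nonNegative 0≤p}} 0≤q)

  +-nonNeg : ∀ {p q} → 0ℚ ≤ p → 0ℚ ≤ q → 0ℚ ≤ p + q
  +-nonNeg = ℚ.+-mono-≤

  p≤p+q : ∀ {p q} → 0ℚ ≤ q → p ≤ p + q
  p≤p+q {p} {q} 0≤q = subst (_≤ p + q) (ℚ.+-identityʳ p) (ℚ.+-monoʳ-≤ p 0≤q)

  p≤q+p : ∀ {p q} → 0ℚ ≤ q → p ≤ q + p
  p≤q+p {p} {q} 0≤q = subst (_≤ q + p) (ℚ.+-identityˡ p) (ℚ.+-monoˡ-≤ p 0≤q)

  ⊔-≤+ : ∀ {p q r s ε} → p ≤ r + ε → q ≤ s + ε → p ⊔ q ≤ (r ⊔ s) + ε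
  ⊔-≤+ {p} {q} {r} {s} {ε} p≤ q≤ = ℚ.⊔-lub
    (ℚ.≤-trans p≤ (ℚ.+-monoˡ-≤ ε (ℚ.p≤p⊔q r s)))
    (ℚ.≤-trans q≤ (ℚ.+-monoˡ-≤ ε (ℚ.p≤q⊔p r s)))

  -- Archimedean property: n ↦ 1/(n+1) is eventually below every ε > 0.
  mesh : ℕ → ℚ
  mesh n = + 1 / suc n

  0<mesh : ∀ n → 0ℚ < mesh n
  0<mesh n = ℚ.positive⁻¹ (mesh n) {{ℚ.normalize-pos 1 (suc n)}}

  mesh≤ : ∀ ε → 0ℚ < ε → ∀ n → ℚ.↧ₙ ε ℕ.≤ n → mesh n ≤ ε
  mesh≤ ε 0<ε n ↧≤n with positive 0<ε
  mesh≤ ε@(mkℚ +[1+ a ] d _) 0<ε n ↧≤n | _ = ℚ.toℚᵘ-cancel-≤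
    (ℚᵘ.≤-respˡ-≃ (ℚᵘ.≃-sym (ℚ.toℚᵘ-fromℚᵘ (ℚᵘ.mkℚᵘ (+ 1) n)))
      (ℚᵘ.*≤* (ℤ.+≤+ (begin′ ↧≤n))))
    where
    begin′ : suc d ℕ.≤ n → 1 ℕ.* suc d ℕ.≤ suc a ℕ.* suc n
    begin′ h = ℕ.*-mono-≤ (ℕ.s≤s (ℕ.z≤n {a})) (ℕ.m≤n⇒m≤1+n h)

  ^-nonNeg : ∀ {p} → 0ℚ ≤ p → ∀ k → 0ℚ ≤ p ^ℚ k
  ^-nonNeg 0≤p zero    = ℚ.nonNegative⁻¹ 1ℚ
  ^-nonNeg 0≤p (suc k) = *-nonNeg 0≤p (^-nonNeg 0≤p k)

  ^-pos : ∀ {p} → 0ℚ < p → ∀ k → 0ℚ < p ^ℚ k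
  ^-pos 0<p zero    = ℚ.positive⁻¹ 1ℚ
  ^-pos 0<p (suc k) = *-pos 0<p (^-pos 0<p k)

  ^-monoˡ-≤ : ∀ {p q} → 0ℚ ≤ p → p ≤ q → ∀ k → p ^ℚ k ≤ q ^ℚ k
  ^-monoˡ-≤ 0≤p p≤q zero    = ℚ.≤-refl
  ^-monoˡ-≤ 0≤p p≤q (suc k) =
    *-mono-≤ (ℚ.≤-trans 0≤p p≤q) (^-nonNeg 0≤p k) p≤q (^-monoˡ-≤ 0≤p p≤q k)

  ^-cancelˡ-< : ∀ {p q} → 0ℚ ≤ q → ∀ k → p ^ℚ k < q ^ℚ k → p < q
  ^-cancelˡ-< {p} {q} 0≤q k h with p ℚ.<? q
  ... | yes p<q = p<q
  ... | no  p≮q = contradiction h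
    (λ h → ℚ.<-irrefl refl (ℚ.<-≤-trans h (^-monoˡ-≤ 0≤q (ℚ.≮⇒≥ p≮q) k)))

  ^-superadditive : ∀ {p q} → 0ℚ ≤ p → 0ℚ ≤ q → ∀ k .{{_ : NonZero k}} →
                    p ^ℚ k + q ^ℚ k ≤ (p + q) ^ℚ k
  ^-superadditive {p} {q} 0≤p 0≤q (suc k) = begin
    p * p ^ℚ k + q * q ^ℚ k
      ≤⟨ ℚ.+-mono-≤
           (ℚ.*-monoˡ-≤-nonNeg p {{nonNegative 0≤p}} (^-monoˡ-≤ 0≤p (p≤p+q 0≤q) k))
           (ℚ.*-monoˡ-≤-nonNeg q {{nonNegative 0≤q}} (^-monoˡ-≤ 0≤q (p≤q+p 0≤p) k)) ⟩
    p * (p + q) ^ℚ k + q * (p + q) ^ℚ k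
      ≡⟨ ℚ.*-distribʳ-+ ((p + q) ^ℚ k) p q ⟨
    (p + q) * (p + q) ^ℚ k ∎

  p≤p^k : ∀ {p} → 1ℚ ≤ p → ∀ k .{{_ : NonZero k}} → p ≤ p ^ℚ k
  p≤p^k {p} 1≤p (suc k) = begin
    p             ≡⟨ ℚ.*-identityʳ p ⟨
    p * 1ℚ        ≤⟨ ℚ.*-monoˡ-≤-nonNeg p {{nonNegative 0≤p}} (1≤^ k) ⟩
    p * p ^ℚ k    ∎
    where
    0≤p : 0ℚ ≤ p
    0≤p = ℚ.≤-trans (ℚ.nonNegative⁻¹ 1ℚ) 1≤p
    1≤^ : ∀ k → 1ℚ ≤ p ^ℚ k
    1≤^ zero    = ℚ.≤-refl
    1≤^ (suc k) = *-mono-≤ 0≤p (ℚ.nonNegative⁻¹ 1ℚ) 1≤p (1≤^ k)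


largest : {P : Pred ℕ 0ℓ} → Decidable P → ℕ → ℕ
largest P? zero    = zero
largest P? (suc b) = if does (P? (suc b)) then suc b else largest P? b

largest-holds : ∀ {P : Pred ℕ 0ℓ} (P? : Decidable P) → P 0 → ∀ b → P (largest P? b)
largest-holds P? P0 zero = P0
largest-holds P? P0 (suc b) with P? (suc b)
... | yes h = h
... | no  _ = largest-holds P? P0 b

largest-max : ∀ {P : Pred ℕ 0ℓ} (P? : Decidable P) → ∀ b → ¬ P (suc b) → ¬ P (suc (largest P? b))
largest-max P? zero    ¬P = ¬P
largest-max P? (suc b) ¬P with P? (suc b)
... | yes _  = ¬P
... | no ¬Pb = largest-max P? b ¬Pb

-- rootℚ k n a is, for a ≥ 0, the largest multiple of 1/(n+1) whose k-th power
-- is at most a, found by searching downwards from |numerator a| + 1.  It is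
-- opaque because unfolding the search makes conversion checking explode; the
-- lemmas rootℚ^k≤ and <[rootℚ+mesh]^k below characterise it.

rootBound : ℕ → ℚ → ℕ
rootBound n a = suc n ℕ.* suc ℤ.∣ ℚ.↥ a ∣

opaque
  rootℚ : (k n : ℕ) → ℚ → ℚ
  rootℚ k n a = + largest (λ m → (+ m ℚ./ suc n) ^ℚ k ℚ.≤? a) (rootBound n a) ℚ./ suc n

module RootEstimates where
  open import Data.Rational.Base using (_+_; _*_; _-_; -_; _≤_; _<_; _⊔_; _/_)
  open Estimates
  open ℚ.≤-Reasoning

  /-suc : ∀ m n → + suc m / suc n ≡ + m / suc n + mesh n
  /-suc m n = ℚ.toℚᵘ-injective (ℚᵘ.≃-trans (ℚ.toℚᵘ-fromℚᵘ (ℚᵘ.mkℚᵘ (+ suc m) n))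
    (ℚᵘ.≃-trans sum (ℚᵘ.≃-trans
      (ℚᵘ.≃-sym (ℚᵘ.+-cong (ℚ.toℚᵘ-fromℚᵘ (ℚᵘ.mkℚᵘ (+ m) n)) (ℚ.toℚᵘ-fromℚᵘ (ℚᵘ.mkℚᵘ (+ 1) n))))
      (ℚᵘ.≃-sym (ℚ.toℚᵘ-homo-+ (+ m / suc n) (mesh n))))))
    where
    sum : ℚᵘ.mkℚᵘ (+ suc m) n ℚᵘ.≃ ℚᵘ.mkℚᵘ (+ m) n ℚᵘ.+ ℚᵘ.mkℚᵘ (+ 1) n
    sum = ℚᵘ.*≡* (ℤS.solve 2 (λ m d → (ℤS.con (+ 1) ℤS.:+ m) ℤS.:* (d ℤS.:* d)
      ℤS.:= (m ℤS.:* d ℤS.:+ ℤS.con (+ 1) ℤS.:* d) ℤS.:* d) refl (+ m) (+ suc n))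

  /-cancel : ∀ n c → + (suc n ℕ.* c) / suc n ≡ + c / 1
  /-cancel n c = ℚ.fromℚᵘ-cong {ℚᵘ.mkℚᵘ (+ (suc n ℕ.* c)) n} {ℚᵘ.mkℚᵘ (+ c) 0}
    (ℚᵘ.*≡* (trans (ℤ.*-identityʳ (+ (suc n ℕ.* c)))
      (trans (cong +_ (ℕ.*-comm (suc n) c)) (ℤ.pos-* c (suc n)))))

  /-nonNeg : ∀ m n → 0ℚ ≤ + m / suc n
  /-nonNeg m n = ℚ.nonNegative⁻¹ (+ m / suc n) {{ℚ.normalize-nonNeg m (suc n)}}

  1≤suc/1 : ∀ c → 1ℚ ≤ + suc c / 1
  1≤suc/1 c = subst (1ℚ ≤_) (sym (/-suc c 0)) (p≤q+p (/-nonNeg c 0))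

  <numerator : ∀ a → a < + suc ℤ.∣ ℚ.↥ a ∣ / 1
  <numerator a@(mkℚ x d _) = ℚ.toℚᵘ-cancel-<
    (ℚᵘ.<-respʳ-≃ (ℚᵘ.≃-sym (ℚ.toℚᵘ-fromℚᵘ (ℚᵘ.mkℚᵘ (+ suc ℤ.∣ x ∣) 0)))
      (ℚᵘ.*<* (subst (ℤ._< + (suc ℤ.∣ x ∣ ℕ.* suc d)) (sym (ℤ.*-identityʳ x))
        (ℤ.≤-<-trans (i≤∣i∣ x) (ℤ.+<+ (ℕ.m≤m*n (suc ℤ.∣ x ∣) (suc d)))))))
    where
    i≤∣i∣ : ∀ i → i ℤ.≤ + ℤ.∣ i ∣
    i≤∣i∣ (+ _)        = ℤ.≤-refl
    i≤∣i∣ ℤ.-[1+ _ ]   = ℤ.-≤+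

  0^k≤ : ∀ k .{{_ : NonZero k}} n {a} → 0ℚ ≤ a → (+ 0 / suc n) ^ℚ k ≤ a
  0^k≤ (suc k) n {a} = subst (_≤ a) (sym (trans
    (cong (_* ((+ 0 / suc n) ^ℚ k)) (ℚ.0/n≡0 (suc n)))
    (ℚ.*-zeroˡ ((+ 0 / suc n) ^ℚ k))))

  <bound^k : ∀ k .{{_ : NonZero k}} n a → a < (+ suc (rootBound n a) / suc n) ^ℚ k
  <bound^k k n a = begin-strict
    a                                     <⟨ <numerator a ⟩
    c                                     ≤⟨ p≤p^k (1≤suc/1 ℤ.∣ ℚ.↥ a ∣) k ⟩
    c ^ℚ k                                ≤⟨ ^-monoˡ-≤ (/-nonNeg (suc ℤ.∣ ℚ.↥ a ∣) 0) c≤ k ⟩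
    (+ suc (rootBound n a) / suc n) ^ℚ k  ∎
    where
    c = + suc ℤ.∣ ℚ.↥ a ∣ / 1
    c≤ : c ≤ + suc (rootBound n a) / suc n
    c≤ = begin
      c                                   ≡⟨ /-cancel n (suc ℤ.∣ ℚ.↥ a ∣) ⟨
      + rootBound n a / suc n             ≤⟨ p≤p+q (ℚ.<⇒≤ (0<mesh n)) ⟩
      + rootBound n a / suc n + mesh n    ≡⟨ /-suc (rootBound n a) n ⟨
      + suc (rootBound n a) / suc n       ∎

  opaque
    unfolding rootℚ

    0≤rootℚ : ∀ k n a → 0ℚ ≤ rootℚ k n a
    0≤rootℚ k n a = /-nonNeg (largest (λ m → (+ m / suc n) ^ℚ k ℚ.≤? a) (rootBound n a)) n

    rootℚ^k≤ : ∀ k .{{_ : NonZero k}} n a → 0ℚ ≤ a → rootℚ k n a ^ℚ k ≤ a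
    rootℚ^k≤ k n a 0≤a =
      largest-holds {λ m → (+ m / suc n) ^ℚ k ≤ a} (λ m → (+ m / suc n) ^ℚ k ℚ.≤? a)
        (0^k≤ k n 0≤a) (rootBound n a)

    <[rootℚ+mesh]^k : ∀ k .{{_ : NonZero k}} n a → a < (rootℚ k n a + mesh n) ^ℚ k
    <[rootℚ+mesh]^k k n a = let m = largest (λ m → (+ m / suc n) ^ℚ k ℚ.≤? a) (rootBound n a) in
      subst (λ r → a < r ^ℚ k) (/-suc m n) (ℚ.≰⇒>
        (largest-max {λ m → (+ m / suc n) ^ℚ k ≤ a} (λ m → (+ m / suc n) ^ℚ k ℚ.≤? a)
          (rootBound n a) (λ ≤a → ℚ.<-irrefl refl (ℚ.<-≤-trans (<bound^k k n a) ≤a))))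

  rootℚ-≤ : ∀ k .{{_ : NonZero k}} m n {a b ε} → 0ℚ ≤ a → 0ℚ ≤ ε → a ≤ b + ε ^ℚ k →
            rootℚ k m a ≤ rootℚ k n b + (mesh n + ε)
  rootℚ-≤ k m n {a} {b} {ε} 0≤a 0≤ε a≤ = ℚ.<⇒≤ (^-cancelˡ-< 0≤r k (begin-strict
    rootℚ k m a ^ℚ k                        ≤⟨ rootℚ^k≤ k m a 0≤a ⟩
    a                                       ≤⟨ a≤ ⟩
    b + ε ^ℚ k                              <⟨ ℚ.+-monoˡ-< (ε ^ℚ k) (<[rootℚ+mesh]^k k n b) ⟩
    (rootℚ k n b + mesh n) ^ℚ k + ε ^ℚ k    ≤⟨ ^-superadditive 0≤s 0≤ε k ⟩
    (rootℚ k n b + mesh n + ε) ^ℚ k         ≡⟨ cong (_^ℚ k) (ℚ.+-assoc (rootℚ k n b) (mesh n) ε) ⟩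
    (rootℚ k n b + (mesh n + ε)) ^ℚ k       ∎))
    where
    0≤s : 0ℚ ≤ rootℚ k n b + mesh n
    0≤s = +-nonNeg (0≤rootℚ k n b) (ℚ.<⇒≤ (0<mesh n))
    0≤r : 0ℚ ≤ rootℚ k n b + (mesh n + ε)
    0≤r = +-nonNeg (0≤rootℚ k n b) (+-nonNeg (ℚ.<⇒≤ (0<mesh n)) 0≤ε)

-- Real numbers: Cauchy sequences of rationals, identified up to _≈_

IsCauchy : (ℕ → ℚ) → Set
IsCauchy x = ∀ ε → 0ℚ ℚ.< ε → ∃[ N ] ∀ m n → N ℕ.≤ m → N ℕ.≤ n → ∣ x m ℚ.- x n ∣ ℚ.≤ ε

record ℝ : Set where
  constructor mkℝ
  field
    seq    : ℕ → ℚ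
    cauchy : IsCauchy seq

open ℝ public

infix 4 _≈_ _≤_

record _≈_ (x y : ℝ) : Set where
  constructor mk≈
  field
    eventually-near : ∀ ε → 0ℚ ℚ.< ε →
      ∃[ N ] ∀ n → N ℕ.≤ n → ∣ seq x n ℚ.- seq y n ∣ ℚ.≤ ε

record _≤_ (x y : ℝ) : Set where
  constructor mk≤
  field
    eventually-below : ∀ ε → 0ℚ ℚ.< ε →
      ∃[ N ] ∀ n → N ℕ.≤ n → seq x n ℚ.≤ seq y n ℚ.+ ε

open _≈_ public
open _≤_ public

module CauchyEstimates where
  open import Data.Rational.Base using (_+_; _*_; _-_; -_; _⊔_)
  open Estimates
  open RootEstimates
  open ℚ.≤-Reasoning
  open +-*-Solver using (solve; _:=_; _:+_; _:*_; _:-_; :-_)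

  opaque
    const-cauchy : ∀ q → IsCauchy (λ _ → q)
    const-cauchy q ε 0<ε = 0 , λ _ _ _ _ → ∣-∣≤ {q} {q} (p≤p+q (ℚ.<⇒≤ 0<ε)) (p≤p+q (ℚ.<⇒≤ 0<ε))

  opaque
    +-cauchy : ∀ {x y} → IsCauchy x → IsCauchy y → IsCauchy (λ n → x n + y n)
    +-cauchy {x} {y} cx cy ε 0<ε =
      let X = cx (½ * ε) (½-pos 0<ε)
          Y = cy (½ * ε) (½-pos 0<ε)
      in proj₁ X ℕ.⊔ proj₁ Y , λ m n ≤m ≤n → begin
      ∣ (x m + y m) - (x n + y n) ∣
        ≡⟨ cong ∣_∣ (solve 4 (λ a b c d → (a :+ b) :- (c :+ d) := (a :- c) :+ (b :- d))
             refl (x m) (y m) (x n) (y n)) ⟩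
      ∣ (x m - x n) + (y m - y n) ∣
        ≤⟨ ℚ.∣p+q∣≤∣p∣+∣q∣ (x m - x n) (y m - y n) ⟩
      ∣ x m - x n ∣ + ∣ y m - y n ∣
        ≤⟨ ℚ.+-mono-≤
             (proj₂ X m n (ℕ.m⊔n≤o⇒m≤o _ _ ≤m) (ℕ.m⊔n≤o⇒m≤o _ _ ≤n))
             (proj₂ Y m n (ℕ.m⊔n≤o⇒n≤o _ _ ≤m) (ℕ.m⊔n≤o⇒n≤o _ _ ≤n)) ⟩
      ½ * ε + ½ * ε
        ≡⟨ ½+½ ε ⟩
      ε ∎

  opaque
    neg-cauchy : ∀ {x} → IsCauchy x → IsCauchy (λ n → - x n)
    neg-cauchy {x} cx ε 0<ε = proj₁ (cx ε 0<ε) , λ m n ≤m ≤n → begin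
      ∣ - x m - - x n ∣  ≡⟨ cong ∣_∣ (solve 2 (λ a b → :- a :- :- b := b :- a) refl (x m) (x n)) ⟩
      ∣ x n - x m ∣      ≤⟨ proj₂ (cx ε 0<ε) n m ≤n ≤m ⟩
      ε                  ∎

  opaque
    ⊔-cauchy : ∀ {x y} → IsCauchy x → IsCauchy y → IsCauchy (λ n → x n ⊔ y n)
    ⊔-cauchy {x} {y} cx cy ε 0<ε =
      let X = cx ε 0<ε
          Y = cy ε 0<ε
      in proj₁ X ℕ.⊔ proj₁ Y , λ m n ≤m ≤n →
      let dx = proj₂ X m n (ℕ.m⊔n≤o⇒m≤o _ _ ≤m) (ℕ.m⊔n≤o⇒m≤o _ _ ≤n)
          dy = proj₂ Y m n (ℕ.m⊔n≤o⇒n≤o _ _ ≤m) (ℕ.m⊔n≤o⇒n≤o _ _ ≤n)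
      in ∣-∣≤ {x m ⊔ y m} {x n ⊔ y n}
           (⊔-≤+ {x m} {y m} {x n} {y n} (∣-∣≤⁻¹ {x m} dx) (∣-∣≤⁻¹ {y m} dy))
           (⊔-≤+ {x n} {y n} {x m} {y m} (∣-∣≤⁻¹′ {x m} dx) (∣-∣≤⁻¹′ {y m} dy))

  EventuallyBounded : (ℕ → ℚ) → Set
  EventuallyBounded x = ∃[ B ] (0ℚ ℚ.≤ B) × ∃[ N ] ∀ n → N ℕ.≤ n → ∣ x n ∣ ℚ.≤ B

  bounded : ∀ {x} → IsCauchy x → EventuallyBounded x
  bounded {x} cx with cx 1ℚ (ℚ.positive⁻¹ 1ℚ)
  ... | N , near = ∣ x N ∣ + 1ℚ , +-nonNeg (ℚ.0≤∣p∣ (x N)) (ℚ.nonNegative⁻¹ 1ℚ) , N , λ n ≤n → begin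
    ∣ x n ∣                  ≡⟨ cong ∣_∣ (solve 2 (λ a b → a := b :+ (a :- b)) refl (x n) (x N)) ⟩
    ∣ x N + (x n - x N) ∣    ≤⟨ ℚ.∣p+q∣≤∣p∣+∣q∣ (x N) (x n - x N) ⟩
    ∣ x N ∣ + ∣ x n - x N ∣  ≤⟨ ℚ.+-monoʳ-≤ ∣ x N ∣ (near n N ≤n ℕ.≤-refl) ⟩
    ∣ x N ∣ + 1ℚ             ∎

  -- a radius within which multiplication by something bounded by B stays within ε
  shrink : ∀ B ε → 0ℚ ℚ.≤ B → 0ℚ ℚ.< ε → ∃[ δ ] (0ℚ ℚ.< δ) × (B * δ ℚ.≤ ε)
  shrink B ε 0≤B 0<ε = δ , *-pos (ℚ.positive⁻¹ (ℚ.1/ C) {{ℚ.1/pos⇒pos C}}) 0<ε , (begin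
    B * δ                  ≤⟨ ℚ.*-monoʳ-≤-nonNeg δ {{nonNegative 0≤δ}} (p≤p+q {B} (ℚ.nonNegative⁻¹ 1ℚ)) ⟩
    C * ((ℚ.1/ C) * ε)     ≡⟨ ℚ.*-assoc C (ℚ.1/ C) ε ⟨
    C * (ℚ.1/ C) * ε       ≡⟨ cong (_* ε) (ℚ.*-inverseʳ C) ⟩
    1ℚ * ε                 ≡⟨ ℚ.*-identityˡ ε ⟩
    ε                      ∎)
    where
    C = B + 1ℚ
    instance
      C-pos : Positive C
      C-pos = ℚ.nonNeg+pos⇒pos B {{nonNegative 0≤B}} 1ℚ
      C-nonZero : ℚ.NonZero C
      C-nonZero = ℚ.pos⇒nonZero C
    δ = (ℚ.1/ C) * ε
    0≤δ : 0ℚ ℚ.≤ δ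
    0≤δ = ℚ.<⇒≤ (*-pos (ℚ.positive⁻¹ (ℚ.1/ C) {{ℚ.1/pos⇒pos C}}) 0<ε)

  *-close : ∀ {A B α β ε p q r s} → 0ℚ ℚ.≤ A → 0ℚ ℚ.≤ B →
            A * α ℚ.≤ ½ * ε → B * β ℚ.≤ ½ * ε →
            ∣ p ∣ ℚ.≤ A → ∣ s ∣ ℚ.≤ B → ∣ q - s ∣ ℚ.≤ α → ∣ p - r ∣ ℚ.≤ β →
            ∣ p * q - r * s ∣ ℚ.≤ ε
  *-close {A} {B} {α} {β} {ε} {p} {q} {r} {s} 0≤A 0≤B Aα≤ Bβ≤ p≤ s≤ dq dp = begin
    ∣ p * q - r * s ∣
      ≡⟨ cong ∣_∣ (solve 4 (λ p q r s → p :* q :- r :* s := p :* (q :- s) :+ s :* (p :- r))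
           refl p q r s) ⟩
    ∣ p * (q - s) + s * (p - r) ∣
      ≤⟨ ℚ.∣p+q∣≤∣p∣+∣q∣ (p * (q - s)) (s * (p - r)) ⟩
    ∣ p * (q - s) ∣ + ∣ s * (p - r) ∣
      ≡⟨ cong₂ _+_ (ℚ.∣p*q∣≡∣p∣*∣q∣ p (q - s)) (ℚ.∣p*q∣≡∣p∣*∣q∣ s (p - r)) ⟩
    ∣ p ∣ * ∣ q - s ∣ + ∣ s ∣ * ∣ p - r ∣
      ≤⟨ ℚ.+-mono-≤ (*-mono-≤ 0≤A (ℚ.0≤∣p∣ (q - s)) p≤ dq) (*-mono-≤ 0≤B (ℚ.0≤∣p∣ (p - r)) s≤ dp) ⟩
    A * α + B * β
      ≤⟨ ℚ.+-mono-≤ Aα≤ Bβ≤ ⟩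
    ½ * ε + ½ * ε
      ≡⟨ ½+½ ε ⟩
    ε ∎

  opaque
    *-cauchy : ∀ {x y} → IsCauchy x → IsCauchy y → IsCauchy (λ n → x n * y n)
    *-cauchy {x} {y} cx cy ε 0<ε =
      let A , 0≤A , M , x≤ = bounded cx
          B , 0≤B , N , y≤ = bounded cy
          α , 0<α , Aα≤    = shrink A (½ * ε) 0≤A (½-pos 0<ε)
          β , 0<β , Bβ≤    = shrink B (½ * ε) 0≤B (½-pos 0<ε)
          K , dx           = cx β 0<β
          L , dy           = cy α 0<α
      in (M ℕ.⊔ N) ℕ.⊔ (K ℕ.⊔ L) , λ m n ≤m ≤n →
        let m₁ = ℕ.m⊔n≤o⇒m≤o (M ℕ.⊔ N) (K ℕ.⊔ L) ≤m
            m₂ = ℕ.m⊔n≤o⇒n≤o (M ℕ.⊔ N) (K ℕ.⊔ L) ≤m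
            n₁ = ℕ.m⊔n≤o⇒m≤o (M ℕ.⊔ N) (K ℕ.⊔ L) ≤n
            n₂ = ℕ.m⊔n≤o⇒n≤o (M ℕ.⊔ N) (K ℕ.⊔ L) ≤n
        in *-close {A} {B} {α} {β} {ε} {x m} {y m} {x n} {y n} 0≤A 0≤B Aα≤ Bβ≤
             (x≤ m (ℕ.m⊔n≤o⇒m≤o M N m₁)) (y≤ n (ℕ.m⊔n≤o⇒n≤o M N n₁))
             (dy m n (ℕ.m⊔n≤o⇒n≤o K L m₂) (ℕ.m⊔n≤o⇒n≤o K L n₂))
             (dx m n (ℕ.m⊔n≤o⇒m≤o K L m₂) (ℕ.m⊔n≤o⇒m≤o K L n₂))

  root-close : ∀ k .{{_ : NonZero k}} m n {a b η} → 0ℚ ℚ.≤ a → 0ℚ ℚ.< η →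
               a ℚ.≤ b + η ^ℚ k → ℚ.↧ₙ η ℕ.≤ n → rootℚ k m a ℚ.≤ rootℚ k n b + (η + η)
  root-close k m n {a} {b} {η} 0≤a 0<η a≤ ≤n = ℚ.≤-trans
    (rootℚ-≤ k m n 0≤a (ℚ.<⇒≤ 0<η) a≤)
    (ℚ.+-monoʳ-≤ (rootℚ k n b) (ℚ.+-monoˡ-≤ η (mesh≤ η 0<η n ≤n)))

  root-modulus : ∀ k .{{_ : NonZero k}} {x} → IsCauchy x → (∀ n → 0ℚ ℚ.≤ x n) → ∀ η → 0ℚ ℚ.< η →
                 ∃[ N ] ∀ m n → N ℕ.≤ m → N ℕ.≤ n →
                 ∣ rootℚ k m (x m) - rootℚ k n (x n) ∣ ℚ.≤ η + η
  root-modulus k {x} cx 0≤x η 0<η =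
    let K , dx = cx (η ^ℚ k) (^-pos 0<η k)
    in K ℕ.⊔ ℚ.↧ₙ η , λ m n ≤m ≤n →
      let d = dx m n (ℕ.m⊔n≤o⇒m≤o K (ℚ.↧ₙ η) ≤m) (ℕ.m⊔n≤o⇒m≤o K (ℚ.↧ₙ η) ≤n)
      in ∣-∣≤ {rootℚ k m (x m)} {rootℚ k n (x n)} {η + η}
           (root-close k m n (0≤x m) 0<η (∣-∣≤⁻¹ {x m} d) (ℕ.m⊔n≤o⇒n≤o K (ℚ.↧ₙ η) ≤n))
           (root-close k n m (0≤x n) 0<η (∣-∣≤⁻¹′ {x m} d) (ℕ.m⊔n≤o⇒n≤o K (ℚ.↧ₙ η) ≤m))

  opaque
    root-cauchy : ∀ k .{{_ : NonZero k}} {x} → IsCauchy x →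
                  IsCauchy (λ n → rootℚ k n (x n ⊔ 0ℚ))
    root-cauchy k {x} cx ε 0<ε =
      let N , close = root-modulus k (⊔-cauchy {x} {λ _ → 0ℚ} cx (const-cauchy 0ℚ)) (λ n → ℚ.p≤q⊔p (x n) 0ℚ)
                        (½ * ε) (½-pos 0<ε)
      in N , λ m n ≤m ≤n → ℚ.≤-trans (close m n ≤m ≤n) (ℚ.≤-reflexive (½+½ ε))

  -- (r + h)ᵏ exceeds rᵏ by at most h times a constant, for r ≤ B and h ≤ 1.
  ^-lipschitz : ∀ B → 0ℚ ℚ.≤ B → ∀ k → ∃[ C ] (0ℚ ℚ.≤ C) × (∀ r h → 0ℚ ℚ.≤ r → r ℚ.≤ B →
                0ℚ ℚ.≤ h → h ℚ.≤ 1ℚ → (r + h) ^ℚ k ℚ.≤ r ^ℚ k + C * h)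
  ^-lipschitz B 0≤B zero = 0ℚ , ℚ.≤-refl , λ r h _ _ _ _ →
    ℚ.≤-reflexive (sym (trans (cong (λ t → 1ℚ + t) (ℚ.*-zeroˡ h)) (ℚ.+-identityʳ 1ℚ)))
  ^-lipschitz B 0≤B (suc k) =
    let C , 0≤C , bound = ^-lipschitz B 0≤B k
        0≤D = +-nonNeg 0≤B (ℚ.nonNegative⁻¹ 1ℚ)
    in B ^ℚ k + (B + 1ℚ) * C , +-nonNeg (^-nonNeg 0≤B k) (*-nonNeg 0≤D 0≤C) ,
    λ r h 0≤r r≤B 0≤h h≤1 →
      let 0≤r+h = +-nonNeg 0≤r 0≤h in begin
      (r + h) * (r + h) ^ℚ k
        ≤⟨ ℚ.*-monoˡ-≤-nonNeg (r + h) {{nonNegative 0≤r+h}} (bound r h 0≤r r≤B 0≤h h≤1) ⟩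
      (r + h) * (r ^ℚ k + C * h)
        ≡⟨ solve 4 (λ r h p C → (r :+ h) :* (p :+ C :* h) := r :* p :+ (p :+ (r :+ h) :* C) :* h)
             refl r h (r ^ℚ k) C ⟩
      r * r ^ℚ k + (r ^ℚ k + (r + h) * C) * h
        ≤⟨ ℚ.+-monoʳ-≤ (r * r ^ℚ k) (ℚ.*-monoʳ-≤-nonNeg h {{nonNegative 0≤h}}
             (ℚ.+-mono-≤ (^-monoˡ-≤ 0≤r r≤B k)
               (ℚ.*-monoʳ-≤-nonNeg C {{nonNegative 0≤C}} (ℚ.+-mono-≤ r≤B h≤1)))) ⟩
      r * r ^ℚ k + (B ^ℚ k + (B + 1ℚ) * C) * h ∎

  root^k-near : ∀ k .{{_ : NonZero k}} n {a B C η ε} → 0ℚ ℚ.≤ a → 0ℚ ℚ.≤ C →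
                (∀ r h → 0ℚ ℚ.≤ r → r ℚ.≤ B → 0ℚ ℚ.≤ h → h ℚ.≤ 1ℚ →
                  (r + h) ^ℚ k ℚ.≤ r ^ℚ k + C * h) →
                rootℚ k n a ℚ.≤ B → C * η ℚ.≤ ε → mesh n ℚ.≤ η → mesh n ℚ.≤ 1ℚ →
                ∣ rootℚ k n a ^ℚ k - a ∣ ℚ.≤ ε
  root^k-near k n {a} {B} {C} {η} {ε} 0≤a 0≤C bound r≤B Cη≤ε h≤η h≤1 =
    ∣-∣≤ {rootℚ k n a ^ℚ k} {a}
      (ℚ.≤-trans (rootℚ^k≤ k n a 0≤a) (p≤p+q 0≤ε))
      (begin
        a                                  ≤⟨ ℚ.<⇒≤ (<[rootℚ+mesh]^k k n a) ⟩
        (rootℚ k n a + mesh n) ^ℚ k        ≤⟨ bound _ _ (0≤rootℚ k n a) r≤B 0≤h h≤1 ⟩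
        rootℚ k n a ^ℚ k + C * mesh n      ≤⟨ ℚ.+-monoʳ-≤ (rootℚ k n a ^ℚ k) Ch≤ε ⟩
        rootℚ k n a ^ℚ k + ε               ∎)
    where
    0≤h : 0ℚ ℚ.≤ mesh n
    0≤h = ℚ.<⇒≤ (0<mesh n)
    Ch≤ε : C * mesh n ℚ.≤ ε
    Ch≤ε = ℚ.≤-trans (ℚ.*-monoˡ-≤-nonNeg C {{nonNegative 0≤C}} h≤η) Cη≤ε
    0≤ε : 0ℚ ℚ.≤ ε
    0≤ε = ℚ.≤-trans (*-nonNeg 0≤C 0≤h) Ch≤ε

  root^k-close : ∀ k .{{_ : NonZero k}} {x} → IsCauchy x → ∀ ε → 0ℚ ℚ.< ε →
                 ∃[ N ] ∀ n → N ℕ.≤ n → ∣ rootℚ k n (x n ⊔ 0ℚ) ^ℚ k - (x n ⊔ 0ℚ) ∣ ℚ.≤ ε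
  root^k-close k {x} cx ε 0<ε =
    let B , 0≤B , N , r≤   = bounded (root-cauchy k {x} cx)
        C , 0≤C , bound    = ^-lipschitz B 0≤B k
        η , 0<η , Cη≤ε     = shrink C ε 0≤C 0<ε
    in N ℕ.⊔ (ℚ.↧ₙ η ℕ.⊔ 1) , λ n ≤n →
      let ≤n′ = ℕ.m⊔n≤o⇒n≤o N (ℚ.↧ₙ η ℕ.⊔ 1) ≤n
      in root^k-near k n {x n ⊔ 0ℚ} {B} {C} {η} {ε} (ℚ.p≤q⊔p (x n) 0ℚ) 0≤C bound
           (ℚ.≤-trans (p≤∣p∣ _) (r≤ n (ℕ.m⊔n≤o⇒m≤o N (ℚ.↧ₙ η ℕ.⊔ 1) ≤n)))
           Cη≤ε
           (mesh≤ η 0<η n (ℕ.m⊔n≤o⇒m≤o (ℚ.↧ₙ η) 1 ≤n′))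
           (mesh≤ 1ℚ (ℚ.positive⁻¹ 1ℚ) n (ℕ.m⊔n≤o⇒n≤o (ℚ.↧ₙ η) 1 ≤n′))

open CauchyEstimates

infix  8 -_
infixl 7 _*_
infixl 6 _+_ _-_ _⊔_

fromℚ : ℚ → ℝ
fromℚ q = mkℝ (λ _ → q) (const-cauchy q)

fromℤ : ℤ → ℝ
fromℤ z = fromℚ (z ℚ./ 1)

0ℝ 1ℝ : ℝ
0ℝ = fromℚ 0ℚ
1ℝ = fromℚ 1ℚ

_+_ _*_ _⊔_ : ℝ → ℝ → ℝ
x + y = mkℝ (λ n → seq x n ℚ.+ seq y n) (+-cauchy {seq x} {seq y} (cauchy x) (cauchy y))
x * y = mkℝ (λ n → seq x n ℚ.* seq y n) (*-cauchy {seq x} {seq y} (cauchy x) (cauchy y))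
x ⊔ y = mkℝ (λ n → seq x n ℚ.⊔ seq y n) (⊔-cauchy {seq x} {seq y} (cauchy x) (cauchy y))

-_ : ℝ → ℝ
- x = mkℝ (λ n → ℚ.- seq x n) (neg-cauchy {seq x} (cauchy x))

_-_ : ℝ → ℝ → ℝ
x - y = x + - y

abs : ℝ → ℝ
abs x = x ⊔ - x

+-*-rawRing : RawRing 0ℓ 0ℓ
+-*-rawRing = record
  { _≈_ = _≈_ ; _+_ = _+_ ; _*_ = _*_ ; -_ = -_ ; 0# = 0ℝ ; 1# = 1ℝ }

open import Algebra.Definitions.RawSemiring (RawRing.rawSemiring +-*-rawRing) public
  using (_^_)

-- The k-th root of the positive part of x, hence of x itself when 0 ≤ x.
root : (k : ℕ) .{{_ : NonZero k}} → ℝ → ℝ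
root k x = mkℝ (λ n → rootℚ k n (seq x n ℚ.⊔ 0ℚ)) (root-cauchy k {seq x} (cauchy x))

root-nonNeg : ∀ k .{{_ : NonZero k}} x → 0ℝ ≤ root k x
root-nonNeg k x = mk≤ λ ε 0<ε → 0 , λ n _ →
  Estimates.+-nonNeg (RootEstimates.0≤rootℚ k n (seq x n ℚ.⊔ 0ℚ)) (ℚ.<⇒≤ 0<ε)

seq-^ : ∀ x k n → seq (x ^ k) n ≡ seq x n ^ℚ k
seq-^ x zero    n = refl
seq-^ x (suc k) n = cong (seq x n ℚ.*_) (seq-^ x k n)

root-^ : ∀ k .{{_ : NonZero k}} x → root k x ^ k ≈ x ⊔ 0ℝ
root-^ k x = mk≈ λ ε 0<ε →
  let N , near = root^k-close k {seq x} (cauchy x) ε 0<ε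
  in N , λ n ≤n → subst (λ r → ∣ r ℚ.- (seq x n ℚ.⊔ 0ℚ) ∣ ℚ.≤ ε) (sym (seq-^ (root k x) k n)) (near n ≤n)

infix 9 √_

√_ : ℝ → ℝ
√ x = root 2 x

-- x to the power a/b, for 0 ≤ x.
_^[_/_] : ℝ → ℕ → (b : ℕ) .{{_ : NonZero b}} → ℝ
x ^[ a / b ] = root b (x ^ a)

Point : Set
Point = ℝ × ℝ

infix 4 _≈ₚ_ _∈ₗ_

_≈ₚ_ : Point → Point → Set
_≈ₚ_ = Pointwise _≈_ _≈_

dist : Point → Point → ℝ
dist (x₁ , y₁) (x₂ , y₂) = √ ((x₁ - x₂) ^ 2 + (y₁ - y₂) ^ 2)

triangleArea : Point → Point → Point → ℝ
triangleArea (x₁ , y₁) (x₂ , y₂) (x₃ , y₃) =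
  fromℚ ½ * abs ((x₂ - x₁) * (y₃ - y₁) - (x₃ - x₁) * (y₂ - y₁))

record Line : Set where
  field
    a b c         : ℝ
    nondegenerate : ¬ (a ≈ 0ℝ × b ≈ 0ℝ)

_∈ₗ_ : Point → Line → Set
(x , y) ∈ₗ ℓ = a * x + b * y + c ≈ 0ℝ
  where open Line ℓ

Collinear : ∀ {n} → (Fin n → Point) → Set
Collinear P = ∃[ ℓ ] ∀ i → P i ∈ₗ ℓ

-- A point set of cardinality n is given by an
-- enumeration M of its points without repetition.

record IsPlanarIntegralPointSet {n : ℕ} (M : Fin n → Point) : Set where
  field
    distinct     : Injective _≡_ _≈ₚ_ M
    notCollinear : ¬ Collinear M
    integral     : ∀ i j → ∃[ d ] dist (M i) (M j) ≈ fromℤ d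

IsInSemiGeneralPosition : {n : ℕ} → (Fin n → Point) → Set
IsInSemiGeneralPosition M =
  ∀ i j k → i ≢ j → j ≢ k → i ≢ k → ¬ Collinear (M i ∷ M j ∷ M k ∷ [])

-- Distances are nonnegative, so starting the maximum from 0 is harmless.
diam : {n : ℕ} → (Fin n → Point) → ℝ
diam M = foldr _⊔_ 0ℝ (λ i → foldr _⊔_ 0ℝ (λ j → dist (M i) (M j)))

Squarefree : ℕ → Set
Squarefree q = ∀ d → d ℕ.* d ∣ q → d ≡ 1

record IsCharacteristic {n : ℕ} (M : Fin n → Point) (q : ℕ) : Set where
  field
    q-positive    : 0 ℕ.< q
    q-squarefree  : Squarefree q
    commensurable : ∀ i j k → ∃[ r ] triangleArea (M i) (M j) (M k) ≈ fromℚ r * √ fromℤ (+ q)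

{-# OPTIONS --safe #-}

-- Let 16 S² = heron (a , b , c) for a triangle with area S and integral sides.  It is q times
-- a rational square, and it is 3 modulo 4 if the perimeter is odd; so for q ≢ 3 modulo 4 all
-- perimeters are even.  This has three consequences.
--
-- Being at even distance is an equivalence relation with at most two classes.  Hence among
-- 2 k − 1 points whose distances are divisible by g there are k points whose distances are
-- divisible by 2 g, which reduces few points (n ≤ 15 and 17 ≤ n ≤ 24) to a finite search for
-- 3, 4 and 5 points.
--
-- For an edge A B the number ||P A| − |P B|| has the parity of |A B|, so for |A B| ≤ 2 τ + 2
-- all but four points P lie on one of τ hyperbolas with foci A, B.  Since five points of which
-- no three are collinear lie on only one conic, two edges of length at most 2 τ + 2 give
-- n ≤ 4 τ² + 8.
--
-- Conversely, if n > 4 τ² + 8, then after removing one point all distances are at least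
-- s = 2 τ + 3.  As a + b − c ≥ 2 in every triangle, all heights are at least √(2 s − 1), so
-- any three of these points, projected to a line, spread over at least √(2 s − 1).  Taking
-- the points in the order of their projections gives d ≥ k √(4 τ + 5) for 2 k + 2 ≤ n, which
-- is about (n / 2) (4 n)^(1/4) and exceeds (25 n / 36)^(5/4).
--
-- All of this takes place in integral coordinates: the distances alone determine
-- x and y with N Δx² + Δy² = κ D².

module Submission where

open import Data.Bool.Base using (Bool; true; false; not; _∧_; _∨_; _xor_; T)
import Data.Bool.Properties as Bool
open import Data.Empty using (⊥)
open import Data.Fin.Base as Fin using (Fin)
import Data.Fin.Properties as Fin
open import Data.Integer.Base as ℤ using (ℤ; +_; -[1+_])
import Data.Integer.Properties as ℤ
open import Data.Integer.Solver using () renaming (module +-*-Solver to ℤS)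
open import Data.List.Base using (List; []; _∷_; length; filter; allFin)
open import Data.List.Membership.Propositional using (_∈_)
open import Data.List.Membership.Propositional.Properties using (∈-filter⁻)
open import Data.List.Properties using (filter-all; length-tabulate)
open import Data.List.Relation.Binary.Permutation.Propositional using (↭⇒↭ₛ; ↭-sym)
open import Data.List.Relation.Binary.Permutation.Propositional.Properties using (↭-length)
import Data.List.Relation.Binary.Permutation.Setoid.Properties as Permutation
open import Data.List.Relation.Unary.All as All using (All; []; _∷_)
import Data.List.Relation.Unary.All.Properties as All
open import Data.List.Relation.Unary.AllPairs using (AllPairs; []; _∷_)
open import Data.List.Relation.Unary.Any using (here; there)
open import Data.List.Relation.Unary.Linked using (Linked; _∷_)
open import Data.List.Relation.Unary.Unique.Propositional using (Unique)
import Data.List.Relation.Unary.Unique.Propositional.Properties as Unique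
import Data.List.Sort as Sort
open import Data.Nat.Base as ℕ using (ℕ; zero; suc; NonZero; ⌊_/2⌋; pred)
open import Data.Nat.Divisibility using (_∣_; divides; m%n≡0⇒n∣m; _∣0; 1∣_)
open import Data.Nat.DivMod using (_%_; _/_; [m+kn]%n≡m%n; %-distribˡ-*; m≡m%n+[m/n]*n; m/n*n≡m; m*n/n≡m)
open import Data.Nat.Induction using (<-wellFounded)
import Data.Nat.Properties as ℕ
open import Data.Nat.Solver using () renaming (module +-*-Solver to ℕS)
open import Data.Product using (∃-syntax; Σ-syntax; _×_; _,_; proj₁; proj₂)
open import Data.Rational.Base as ℚ using (ℚ; mkℚ; 0ℚ; 1ℚ; ½; ∣_∣)
import Data.Rational.Properties as ℚ
open import Data.Rational.Solver using () renaming (module +-*-Solver to ℚS)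
import Data.Rational.Unnormalised.Base as ℚᵘ
import Data.Rational.Unnormalised.Properties as ℚᵘ
open import Data.Sum.Base as Sum using (_⊎_; inj₁; inj₂)
import Data.Vec.Functional as Vector
open import Function.Base using (_∘_; id)
open import Induction.WellFounded using (Acc; acc)
import Relation.Binary.Construct.On as On
open import Relation.Binary.PropositionalEquality
  using (_≡_; _≢_; refl; sym; trans; cong; cong₂; subst; subst₂; setoid; resp₂; module ≡-Reasoning)
open import Relation.Nullary.Decidable using (_×-dec_; ¬?; decidable-stable; from-yes)
open import Relation.Nullary.Decidable.Core using (Dec; yes; no)
open import Relation.Nullary.Negation.Core using (¬_; contradiction)
open import Relation.Unary using (Decidable)

-- Rational identities for points of the plane

-- Order and equality of Cauchy reals are undecidable, whereas the proof sorts points by a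
-- projection, classifies them by differences of distances and cancels nonzero coefficients. Hence
-- the reals serve only to establish identities between integers. A polynomial identity in the
-- coordinates holds for the approximating rationals at every index; if both sides are composed of
-- squared distances, it descends to the integers, although the coordinates themselves may be
-- irrational. `IsDistanceMatrix` collects what descends: planarity becomes `IsPlanar`, semi-general
-- position becomes `heron ≢ 0`, and the characteristic becomes `heron ∼ q`. Even the triangle
-- inequality is recovered from the sign of `heron`.

ι : ℤ → ℚ
ι z = z ℚ./ 1

toℚᵘ-ι : ∀ z → ℚ.toℚᵘ (ι z) ℚᵘ.≃ ℚᵘ.mkℚᵘ z 0
toℚᵘ-ι z = ℚ.toℚᵘ-fromℚᵘ (ℚᵘ.mkℚᵘ z 0)

ι-+ : ∀ a b → ι a ℚ.+ ι b ≡ ι (a ℤ.+ b)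
ι-+ a b = ℚ.toℚᵘ-injective (begin
  ℚ.toℚᵘ (ι a ℚ.+ ι b)  ≈⟨ ℚ.toℚᵘ-homo-+ (ι a) (ι b) ⟩
  ℚ.toℚᵘ (ι a) ℚᵘ.+ ℚ.toℚᵘ (ι b)  ≈⟨ ℚᵘ.+-cong (toℚᵘ-ι a) (toℚᵘ-ι b) ⟩
  ℚᵘ.mkℚᵘ a 0 ℚᵘ.+ ℚᵘ.mkℚᵘ b 0  ≈⟨ ℚᵘ.*≡* (cong (ℤ._* + 1) (cong₂ ℤ._+_ (ℤ.*-identityʳ a) (ℤ.*-identityʳ b))) ⟩
  ℚᵘ.mkℚᵘ (a ℤ.+ b) 0  ≈⟨ ℚᵘ.≃-sym (toℚᵘ-ι (a ℤ.+ b)) ⟩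
  ℚ.toℚᵘ (ι (a ℤ.+ b))  ∎)
  where open ℚᵘ.≃-Reasoning

ι-* : ∀ a b → ι a ℚ.* ι b ≡ ι (a ℤ.* b)
ι-* a b = ℚ.toℚᵘ-injective (begin
  ℚ.toℚᵘ (ι a ℚ.* ι b)  ≈⟨ ℚ.toℚᵘ-homo-* (ι a) (ι b) ⟩
  ℚ.toℚᵘ (ι a) ℚᵘ.* ℚ.toℚᵘ (ι b)  ≈⟨ ℚᵘ.*-cong (toℚᵘ-ι a) (toℚᵘ-ι b) ⟩
  ℚᵘ.mkℚᵘ a 0 ℚᵘ.* ℚᵘ.mkℚᵘ b 0  ≈⟨ ℚᵘ.*≡* refl ⟩
  ℚᵘ.mkℚᵘ (a ℤ.* b) 0  ≈⟨ ℚᵘ.≃-sym (toℚᵘ-ι (a ℤ.* b)) ⟩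
  ℚ.toℚᵘ (ι (a ℤ.* b))  ∎)
  where open ℚᵘ.≃-Reasoning

ι-neg : ∀ a → ℚ.- ι a ≡ ι (ℤ.- a)
ι-neg a = ℚ.toℚᵘ-injective (begin
  ℚ.toℚᵘ (ℚ.- ι a)  ≈⟨ ℚ.toℚᵘ-homo‿- (ι a) ⟩
  ℚᵘ.- ℚ.toℚᵘ (ι a)  ≈⟨ ℚᵘ.-‿cong (toℚᵘ-ι a) ⟩
  ℚᵘ.- ℚᵘ.mkℚᵘ a 0  ≈⟨ ℚᵘ.*≡* refl ⟩
  ℚᵘ.mkℚᵘ (ℤ.- a) 0  ≈⟨ ℚᵘ.≃-sym (toℚᵘ-ι (ℤ.- a)) ⟩
  ℚ.toℚᵘ (ι (ℤ.- a))  ∎)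
  where open ℚᵘ.≃-Reasoning

ι-injective : ∀ {a b} → ι a ≡ ι b → a ≡ b
ι-injective {a} {b} eq with ℚᵘ.≃-trans (ℚᵘ.≃-sym (toℚᵘ-ι a)) (ℚᵘ.≃-trans (ℚᵘ.≃-reflexive (cong ℚ.toℚᵘ eq)) (toℚᵘ-ι b))
... | ℚᵘ.*≡* h = trans (sym (ℤ.*-identityʳ a)) (trans h (ℤ.*-identityʳ b))

ι-mono : ∀ {a b} → a ℤ.≤ b → ι a ℚ.≤ ι b
ι-mono {a} {b} a≤b = ℚ.toℚᵘ-cancel-≤ (ℚᵘ.≤-respˡ-≃ (ℚᵘ.≃-sym (toℚᵘ-ι a))
  (ℚᵘ.≤-respʳ-≃ (ℚᵘ.≃-sym (toℚᵘ-ι b))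
    (ℚᵘ.*≤* (subst₂ ℤ._≤_ (sym (ℤ.*-identityʳ a)) (sym (ℤ.*-identityʳ b)) a≤b))))

p^2≡p*p : ∀ p → p ℚ.* (p ℚ.* 1ℚ) ≡ p ℚ.* p
p^2≡p*p p = cong (p ℚ.*_) (ℚ.*-identityʳ p)

module _ where
  open import Data.Rational.Base using (_+_; _*_; _-_)
  open ℚS
  open ≡-Reasoning

  private
    2ℚ 4ℚ : ℚ
    2ℚ = ι (+ 2)
    4ℚ = ι (+ 4)

    sqdist : ℚ → ℚ → ℚ → ℚ → ℚ
    sqdist x₁ y₁ x₂ y₂ = (x₁ - x₂) * ((x₁ - x₂) * 1ℚ) + (y₁ - y₂) * ((y₁ - y₂) * 1ℚ)

  polarize : ∀ a₁ a₂ b₁ b₂ p₁ p₂ q₁ q₂ →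
    (sqdist a₁ a₂ b₁ b₂ + sqdist a₁ a₂ p₁ p₂ - sqdist b₁ b₂ p₁ p₂) -
      (sqdist a₁ a₂ b₁ b₂ + sqdist a₁ a₂ q₁ q₂ - sqdist b₁ b₂ q₁ q₂) ≡
    2ℚ * ((b₁ - a₁) * (p₁ - q₁) + (b₂ - a₂) * (p₂ - q₂))
  polarize = solve 8 (λ a₁ a₂ b₁ b₂ p₁ p₂ q₁ q₂ →
    let d = λ x₁ y₁ x₂ y₂ → (x₁ :- x₂) :* ((x₁ :- x₂) :* con 1ℚ) :+ (y₁ :- y₂) :* ((y₁ :- y₂) :* con 1ℚ)
    in (d a₁ a₂ b₁ b₂ :+ d a₁ a₂ p₁ p₂ :- d b₁ b₂ p₁ p₂) :- (d a₁ a₂ b₁ b₂ :+ d a₁ a₂ q₁ q₂ :- d b₁ b₂ q₁ q₂)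
       := con 2ℚ :* ((b₁ :- a₁) :* (p₁ :- q₁) :+ (b₂ :- a₂) :* (p₂ :- q₂))) refl

  polarize₀ : ∀ a₁ a₂ b₁ b₂ c₁ c₂ →
    sqdist a₁ a₂ b₁ b₂ + sqdist a₁ a₂ c₁ c₂ - sqdist b₁ b₂ c₁ c₂ ≡
    2ℚ * ((b₁ - a₁) * (c₁ - a₁) + (b₂ - a₂) * (c₂ - a₂))
  polarize₀ = solve 6 (λ a₁ a₂ b₁ b₂ p₁ p₂ →
    let d = λ x₁ y₁ x₂ y₂ → (x₁ :- x₂) :* ((x₁ :- x₂) :* con 1ℚ) :+ (y₁ :- y₂) :* ((y₁ :- y₂) :* con 1ℚ)
    in d a₁ a₂ b₁ b₂ :+ d a₁ a₂ p₁ p₂ :- d b₁ b₂ p₁ p₂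
       := con 2ℚ :* ((b₁ :- a₁) :* (p₁ :- a₁) :+ (b₂ :- a₂) :* (p₂ :- a₂))) refl

  lagrange : ∀ x y z w → 4ℚ * ((x * x + y * y) * (z * z + w * w)) - 2ℚ * (x * z + y * w) * (2ℚ * (x * z + y * w)) ≡
    2ℚ * (x * w - y * z) * (2ℚ * (x * w - y * z))
  lagrange = solve 4 (λ x y z w →
    con 4ℚ :* ((x :* x :+ y :* y) :* (z :* z :+ w :* w)) :- con 2ℚ :* (x :* z :+ y :* w) :* (con 2ℚ :* (x :* z :+ y :* w))
    := con 2ℚ :* (x :* w :- y :* z) :* (con 2ℚ :* (x :* w :- y :* z))) refl

  binet : ∀ x y z w s t →
    2ℚ * ((x * x + y * y) * (2ℚ * (z * s + w * t))) - 2ℚ * (x * s + y * t) * (2ℚ * (x * z + y * w)) ≡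
    2ℚ * (x * t - y * s) * (2ℚ * (x * w - y * z))
  binet = solve 6 (λ x y z w s t →
    con 2ℚ :* ((x :* x :+ y :* y) :* (con 2ℚ :* (z :* s :+ w :* t))) :- con 2ℚ :* (x :* s :+ y :* t) :* (con 2ℚ :* (x :* z :+ y :* w))
    := con 2ℚ :* (x :* t :- y :* s) :* (con 2ℚ :* (x :* w :- y :* z))) refl

  sqdist-sym : ∀ a₁ a₂ b₁ b₂ → sqdist a₁ a₂ b₁ b₂ ≡ (b₁ - a₁) * (b₁ - a₁) + (b₂ - a₂) * (b₂ - a₂)
  sqdist-sym = solve 4 (λ a₁ a₂ b₁ b₂ → (a₁ :- b₁) :* ((a₁ :- b₁) :* con 1ℚ) :+ (a₂ :- b₂) :* ((a₂ :- b₂) :* con 1ℚ)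
    := (b₁ :- a₁) :* (b₁ :- a₁) :+ (b₂ :- a₂) :* (b₂ :- a₂)) refl

  sqdist-* : ∀ p₁ p₂ q₁ q₂ → sqdist p₁ p₂ q₁ q₂ ≡ (p₁ - q₁) * (p₁ - q₁) + (p₂ - q₂) * (p₂ - q₂)
  sqdist-* p₁ p₂ q₁ q₂ = cong₂ _+_ (p^2≡p*p (p₁ - q₁)) (p^2≡p*p (p₂ - q₂))

  -- With `δ = p − q` both sides are `16 (u × v)² (u × δ)²`: Lagrange's identity turns each factor
  -- on the left into the square of a cross product, and the Binet-Cauchy identity evaluates `ΔZ`.
  -- Passing through these identities keeps the solver away from a polynomial of degree eight in ten
  -- variables.
  planarℚ : ∀ a₁ a₂ b₁ b₂ c₁ c₂ p₁ p₂ q₁ q₂ →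
    let U  = sqdist a₁ a₂ b₁ b₂
        C  = sqdist a₁ a₂ c₁ c₂
        V  = U + C - sqdist b₁ b₂ c₁ c₂
        N  = 4ℚ * (U * C) - V * V
        E  = λ x y → U + sqdist a₁ a₂ x y - sqdist b₁ b₂ x y
        W  = λ x y → C + sqdist a₁ a₂ x y - sqdist c₁ c₂ x y
        Z  = λ x y → 2ℚ * (U * W x y) - E x y * V
        ΔE = E p₁ p₂ - E q₁ q₂
        ΔZ = Z p₁ p₂ - Z q₁ q₂
    in (4ℚ * (U * sqdist p₁ p₂ q₁ q₂) - ΔE * ΔE) * N ≡ ΔZ * ΔZ
  planarℚ a₁ a₂ b₁ b₂ c₁ c₂ p₁ p₂ q₁ q₂ = begin
    (4ℚ * (U * D) - ΔE * ΔE) * (4ℚ * (U * C) - V * V)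
      ≡⟨ cong₂ _*_ (norm (sqdist-* p₁ p₂ q₁ q₂) (polarize a₁ a₂ b₁ b₂ p₁ p₂ q₁ q₂))
           (norm (sqdist-sym a₁ a₂ c₁ c₂) V≡) ⟩
    _ ≡⟨ cong₂ _*_ (lagrange u₁ u₂ (p₁ - q₁) (p₂ - q₂)) (lagrange u₁ u₂ v₁ v₂) ⟩
    2ℚ * (u₁ * (p₂ - q₂) - u₂ * (p₁ - q₁)) * (2ℚ * (u₁ * (p₂ - q₂) - u₂ * (p₁ - q₁))) *
      (2ℚ * (u₁ * v₂ - u₂ * v₁) * (2ℚ * (u₁ * v₂ - u₂ * v₁)))
      ≡⟨ solve 2 (λ s t → s :* s :* (t :* t) := s :* t :* (s :* t)) refl
           (2ℚ * (u₁ * (p₂ - q₂) - u₂ * (p₁ - q₁))) (2ℚ * (u₁ * v₂ - u₂ * v₁)) ⟩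
    _ ≡⟨ cong₂ _*_ ΔZ≡ ΔZ≡ ⟨
    ΔZ * ΔZ ∎
    where
    u₁ = b₁ - a₁
    u₂ = b₂ - a₂
    v₁ = c₁ - a₁
    v₂ = c₂ - a₂
    U = sqdist a₁ a₂ b₁ b₂
    C = sqdist a₁ a₂ c₁ c₂
    D = sqdist p₁ p₂ q₁ q₂
    V = U + C - sqdist b₁ b₂ c₁ c₂
    E W Z : ℚ → ℚ → ℚ
    E x y = U + sqdist a₁ a₂ x y - sqdist b₁ b₂ x y
    W x y = C + sqdist a₁ a₂ x y - sqdist c₁ c₂ x y
    Z x y = 2ℚ * (U * W x y) - E x y * V
    ΔE = E p₁ p₂ - E q₁ q₂
    ΔZ = Z p₁ p₂ - Z q₁ q₂
    U≡ = sqdist-sym a₁ a₂ b₁ b₂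
    V≡ = polarize₀ a₁ a₂ b₁ b₂ c₁ c₂
    norm : ∀ {D D′ e e′} → D ≡ D′ → e ≡ e′ → 4ℚ * (U * D) - e * e ≡ 4ℚ * ((u₁ * u₁ + u₂ * u₂) * D′) - e′ * e′
    norm refl refl = cong (λ t → 4ℚ * (t * _) - _) U≡
    ΔZ≡ : ΔZ ≡ 2ℚ * (u₁ * (p₂ - q₂) - u₂ * (p₁ - q₁)) * (2ℚ * (u₁ * v₂ - u₂ * v₁))
    ΔZ≡ = begin
      ΔZ
        ≡⟨ solve 6 (λ U V e e′ w w′ → (con 2ℚ :* (U :* w) :- e :* V) :- (con 2ℚ :* (U :* w′) :- e′ :* V)
             := con 2ℚ :* (U :* (w :- w′)) :- (e :- e′) :* V) refl U V (E p₁ p₂) (E q₁ q₂) (W p₁ p₂) (W q₁ q₂) ⟩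
      2ℚ * (U * (W p₁ p₂ - W q₁ q₂)) - ΔE * V
        ≡⟨ cong₂ _-_ (cong (2ℚ *_) (cong₂ _*_ U≡ (polarize a₁ a₂ c₁ c₂ p₁ p₂ q₁ q₂)))
             (cong₂ _*_ (polarize a₁ a₂ b₁ b₂ p₁ p₂ q₁ q₂) V≡) ⟩
      _ ≡⟨ binet u₁ u₂ v₁ v₂ (p₁ - q₁) (p₂ - q₂) ⟩
      2ℚ * (u₁ * (p₂ - q₂) - u₂ * (p₁ - q₁)) * (2ℚ * (u₁ * v₂ - u₂ * v₁)) ∎

-- Sixteen times the squared area of the triangle with sides a, b, c
heron : ℤ → ℤ → ℤ → ℤ
heron a b c = + 4 ℤ.* (a ℤ.* a ℤ.* (b ℤ.* b)) ℤ.- (a ℤ.* a ℤ.+ b ℤ.* b ℤ.- c ℤ.* c) ℤ.* (a ℤ.* a ℤ.+ b ℤ.* b ℤ.- c ℤ.* c)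

-- For points pᵢ of the plane with squared distances S, put u = b − a, v = c − a.
-- Then E i = 2 u·(pᵢ − a), N = 4 (u × v)² and Z i = 4 (u × v) (u × (pᵢ − a)).
module Frame {I : Set} (S : I → I → ℤ) (a b c : I) where
  open import Data.Integer.Base using (_+_; _*_; _-_)

  V N : ℤ
  V = S a b + S a c - S b c
  N = + 4 * (S a b * S a c) - V * V

  E W Z : I → ℤ
  E i = S a b + S a i - S b i
  W i = S a c + S a i - S c i
  Z i = + 2 * (S a b * W i) - E i * V

-- This form of planarity lets coordinates be read off: it amounts to `N (E i − E j)² + (Z i − Z j)²
-- = 4 S a b N S i j`. For `j = a` it becomes the Cayley-Menger relation of four points.
IsPlanar : {I : Set} → (I → I → ℤ) → Set
IsPlanar S = ∀ a b c i j → let open Frame S a b c in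
  (+ 4 ℤ.* (S a b ℤ.* S i j) ℤ.- (E i ℤ.- E j) ℤ.* (E i ℤ.- E j)) ℤ.* N ≡ (Z i ℤ.- Z j) ℤ.* (Z i ℤ.- Z j)

infix 4 _∼_

-- h is q times a rational square
record _∼_ (h : ℤ) (q : ℕ) : Set where
  constructor mk∼
  field
    w z : ℤ
    w≢0 : w ≢ + 0
    eq  : h ℤ.* (w ℤ.* w) ≡ + q ℤ.* (z ℤ.* z)

-- The integer data carried by a planar integral point set of characteristic q:
-- D i j is the distance from the i-th to the j-th point.
record IsDistanceMatrix {n : ℕ} (q : ℕ) (D : Fin n → Fin n → ℕ) : Set where
  field
    D-refl  : ∀ i → D i i ≡ 0
    D-sym   : ∀ i j → D i j ≡ D j i
    D-pos   : ∀ {i j} → i ≢ j → 0 ℕ.< D i j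
    planar  : IsPlanar (λ i j → + D i j ℤ.* + D i j)
    heron≢0 : ∀ {i j k} → i ≢ j → j ≢ k → i ≢ k → heron (+ D i j) (+ D i k) (+ D j k) ≢ + 0
    heron-commensurable : ∀ i j k → heron (+ D i j) (+ D i k) (+ D j k) ∼ q

-- The prime 2

odd : ℕ → Bool
odd zero    = false
odd (suc n) = not (odd n)

odd-+ : ∀ m n → odd (m ℕ.+ n) ≡ odd m xor odd n
odd-+ zero    n = refl
odd-+ (suc m) n rewrite odd-+ m n with odd m | odd n
... | true  | true  = refl
... | true  | false = refl
... | false | true  = refl
... | false | false = refl

half : ∀ n → (∃[ k ] n ≡ k ℕ.* 2 × odd n ≡ false) ⊎ (∃[ k ] n ≡ suc (k ℕ.* 2) × odd n ≡ true)
half zero = inj₁ (0 , refl , refl)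
half (suc n) with half n
... | inj₁ (k , eq , o) = inj₂ (k , cong suc eq , cong not o)
... | inj₂ (k , eq , o) = inj₁ (suc k , cong suc eq , cong not o)

even-square%4 : ∀ k → (k ℕ.* 2 ℕ.* (k ℕ.* 2)) % 4 ≡ 0
even-square%4 k = trans (cong (_% 4) (solve 1 (λ k → k :* con 2 :* (k :* con 2) := con 0 :+ k :* k :* con 4) refl k))
  ([m+kn]%n≡m%n 0 (k ℕ.* k) 4)
  where open ℕS

odd-square%4 : ∀ k → (suc (k ℕ.* 2) ℕ.* suc (k ℕ.* 2)) % 4 ≡ 1
odd-square%4 k = trans
  (cong (_% 4) (solve 1 (λ k → (con 1 :+ k :* con 2) :* (con 1 :+ k :* con 2) := con 1 :+ (k :* k :+ k) :* con 4) refl k))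
  ([m+kn]%n≡m%n 1 (k ℕ.* k ℕ.+ k) 4)
  where open ℕS

-- Squares are 0 or 1 modulo 4. If `w` or `z` is odd, comparing residues gives `3 ≡ 0`, `q ≡ 3` or
-- `q ≡ 0`; if both are even, both can be halved, and this descent ends because `w ≢ 0`.
p*w²≢q*z² : ∀ p q → p % 4 ≡ 3 → q % 4 ≢ 0 → q % 4 ≢ 3 →
            ∀ w z → w ≢ 0 → p ℕ.* (w ℕ.* w) ≢ q ℕ.* (z ℕ.* z)
p*w²≢q*z² p q p≡3 q≢0 q≢3 w = descend w (<-wellFounded w)
  where
  *%4 : ∀ a b {c} → b % 4 ≡ c → (a ℕ.* b) % 4 ≡ (a % 4 ℕ.* c) % 4
  *%4 a b b≡c = trans (%-distribˡ-* a b 4) (cong (λ t → (a % 4 ℕ.* t) % 4) b≡c)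

  0%4 : ∀ a → (a ℕ.* 0) % 4 ≡ 0
  0%4 a = cong (_% 4) (ℕ.*-zeroʳ a)

  q*1%4 : (q % 4 ℕ.* 1) % 4 ≡ q % 4
  q*1%4 = trans (sym (%-distribˡ-* q 1 4)) (cong (_% 4) (ℕ.*-identityʳ q))

  descend : ∀ w → Acc ℕ._<_ w → ∀ z → w ≢ 0 → p ℕ.* (w ℕ.* w) ≢ q ℕ.* (z ℕ.* z)
  descend w (acc rec) z w≢0 eq with half w | half z
  ... | inj₂ (k , refl , _) | inj₁ (l , refl , _) = contradiction (trans (sym p*%) (trans (cong (_% 4) eq)
      (trans (*%4 q (l ℕ.* 2 ℕ.* (l ℕ.* 2)) (even-square%4 l)) (0%4 (q % 4))))) λ ()
    where
    p*% : (p ℕ.* (suc (k ℕ.* 2) ℕ.* suc (k ℕ.* 2))) % 4 ≡ 3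
    p*% = trans (*%4 p _ (odd-square%4 k)) (cong (λ t → (t ℕ.* 1) % 4) p≡3)
  ... | inj₂ (k , refl , _) | inj₂ (l , refl , _) = q≢3 (trans (sym q*1%4)
      (trans (sym (*%4 q _ (odd-square%4 l))) (trans (cong (_% 4) (sym eq))
        (trans (*%4 p _ (odd-square%4 k)) (cong (λ t → (t ℕ.* 1) % 4) p≡3)))))
  ... | inj₁ (k , refl , _) | inj₂ (l , refl , _) = q≢0 (trans (sym q*1%4)
      (trans (sym (*%4 q _ (odd-square%4 l))) (trans (cong (_% 4) (sym eq))
        (trans (*%4 p _ (even-square%4 k)) (0%4 (p % 4))))))
  ... | inj₁ (zero , refl , _) | _ = w≢0 refl
  ... | inj₁ (suc k , refl , _) | inj₁ (l , refl , _) = descend (suc k) (rec (ℕ.s≤s (ℕ.s≤s (ℕ.m≤m*n k 2)))) l (λ ())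
      (ℕ.*-cancelʳ-≡ _ _ 4 (begin
        p ℕ.* (suc k ℕ.* suc k) ℕ.* 4  ≡⟨ solve 2 (λ p k → p :* (k :* k) :* con 4 := p :* (k :* con 2 :* (k :* con 2))) refl p (suc k) ⟩
        p ℕ.* (suc k ℕ.* 2 ℕ.* (suc k ℕ.* 2))  ≡⟨ eq ⟩
        q ℕ.* (l ℕ.* 2 ℕ.* (l ℕ.* 2))  ≡⟨ solve 2 (λ p k → p :* (k :* con 2 :* (k :* con 2)) := p :* (k :* k) :* con 4) refl q l ⟩
        q ℕ.* (l ℕ.* l) ℕ.* 4  ∎))
    where
    open ≡-Reasoning
    open ℕS

-- h has the form s² (4 l + 3)
Excluded : (s : ℕ) .{{_ : NonZero (s ℕ.* s ℕ.* 4)}} → ℕ → Bool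
Excluded s h = h % (s ℕ.* s ℕ.* 4) ℕ.≡ᵇ s ℕ.* s ℕ.* 3

-- The test does not mention `q`, so that one search serves all characteristics. It is only a
-- necessary condition for `h ∼ q`: no `s² (4 l + 3)` with `s ≥ 1` is `q` times a rational square.
-- The five values of `s` suffice for the small triangles searched below.
admissible : ℤ → Bool
admissible (+ h) = not (h ℕ.≡ᵇ 0) ∧ not (Excluded 1 h) ∧ not (Excluded 2 h) ∧ not (Excluded 4 h) ∧ not (Excluded 8 h) ∧ not (Excluded 16 h)
admissible -[1+ _ ] = false

∼⇒0< : ∀ {h q} → h ≢ + 0 → h ∼ q → + 0 ℤ.< h
∼⇒0< {+ zero}  h≢0 _ = contradiction refl h≢0
∼⇒0< {+ suc h} h≢0 _ = ℤ.+<+ (ℕ.s≤s ℕ.z≤n)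
∼⇒0< { -[1+ h ]} {q} _ (mk∼ w z w≢0 eq) = contradiction (begin-strict
    -[1+ h ] ℤ.* (w ℤ.* w)  <⟨ subst (λ t → -[1+ h ] ℤ.* t ℤ.< + 0) (square w) (negative (ℤ.∣ w ∣ ℕ.* ℤ.∣ w ∣) (λ eq → w≢0 (ℤ.∣i∣≡0⇒i≡0 (Sum.reduce (ℕ.m*n≡0⇒m≡0∨n≡0 ℤ.∣ w ∣ eq))))) ⟩
    + 0  ≤⟨ ℤ.+≤+ ℕ.z≤n ⟩
    + (q ℕ.* (ℤ.∣ z ∣ ℕ.* ℤ.∣ z ∣))  ≡⟨ ℤ.pos-* q (ℤ.∣ z ∣ ℕ.* ℤ.∣ z ∣) ⟩
    + q ℤ.* + (ℤ.∣ z ∣ ℕ.* ℤ.∣ z ∣)  ≡⟨ cong (+ q ℤ.*_) (square z) ⟩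
    + q ℤ.* (z ℤ.* z)  ∎) (ℤ.<-irrefl eq)
  where
  open ℤ.≤-Reasoning
  square : ∀ i → + (ℤ.∣ i ∣ ℕ.* ℤ.∣ i ∣) ≡ i ℤ.* i
  square (+ n)    = ℤ.pos-* n n
  square -[1+ n ] = refl
  negative : ∀ m → m ≢ 0 → -[1+ h ] ℤ.* + m ℤ.< + 0
  negative zero    m≢0 = contradiction refl m≢0
  negative (suc m) _   = ℤ.-<+

module HeronParity where
  open ℤS
  open ≡-Reasoning

  -- Four times an integer minus an odd square is 3 modulo 4, and `a² + b² − c²` has the parity of
  -- the perimeter.
  heron-odd : ∀ a b c t → a ℤ.* a ℤ.+ b ℤ.* b ℤ.- c ℤ.* c ≡ + 2 ℤ.* t ℤ.+ + 1 →
              ∃[ k ] heron a b c ≡ + 4 ℤ.* k ℤ.+ + 3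
  heron-odd a b c t eq = a ℤ.* a ℤ.* (b ℤ.* b) ℤ.- t ℤ.* t ℤ.- t ℤ.- + 1 ,
    trans (cong (λ s → + 4 ℤ.* (a ℤ.* a ℤ.* (b ℤ.* b)) ℤ.- s ℤ.* s) eq)
    (solve 2 (λ x t → con (+ 4) :* x :- (con (+ 2) :* t :+ con (+ 1)) :* (con (+ 2) :* t :+ con (+ 1)) :=
       con (+ 4) :* (x :- t :* t :- t :- con (+ 1)) :+ con (+ 3)) refl (a ℤ.* a ℤ.* (b ℤ.* b)) t)

  pos-odd : ∀ i → + suc (i ℕ.* 2) ≡ + 1 ℤ.+ + i ℤ.* + 2
  pos-odd i = cong (ℤ._+_ (+ 1)) (ℤ.pos-* i 2)

  square : ∀ {x y} → x ≡ y → x ℤ.* x ≡ y ℤ.* y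
  square refl = refl

  τ : ℕ → ℕ → ℕ → ℤ
  τ i j k = + 2 ℤ.* (+ i ℤ.* + i) ℤ.+ + 2 ℤ.* (+ j ℤ.* + j) ℤ.- + 2 ℤ.* (+ k ℤ.* + k)

  τ′ : ∀ {n} → Polynomial n → Polynomial n → Polynomial n → Polynomial n
  τ′ i j k = con (+ 2) :* (i :* i) :+ con (+ 2) :* (j :* j) :- con (+ 2) :* (k :* k)

  o e : ∀ {n} → Polynomial n → Polynomial n
  o i = con (+ 1) :+ i :* con (+ 2)
  e i = i :* con (+ 2)

module _ {q : ℕ} (q≢0 : q % 4 ≢ 0) (q≢3 : q % 4 ≢ 3) where

  ∼⇒¬Excluded : ∀ s .{{_ : NonZero s}} .{{_ : NonZero (s ℕ.* s ℕ.* 4)}} {h} → + h ∼ q → Excluded s h ≡ false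
  ∼⇒¬Excluded s {h} (mk∼ w z w≢0 eq) with Excluded s h in e
  ... | false = refl
  ... | true  = contradiction ℕeq (p*w²≢q*z² (3 ℕ.+ j ℕ.* 4) q ([m+kn]%n≡m%n 3 j 4) q≢0 q≢3 (s ℕ.* ℤ.∣ w ∣) ℤ.∣ z ∣ sw≢0)
    where
    open ≡-Reasoning
    open ℕS
    j = h ℕ./ (s ℕ.* s ℕ.* 4)
    h≡ : h ≡ s ℕ.* s ℕ.* (3 ℕ.+ j ℕ.* 4)
    h≡ = begin
      h  ≡⟨ m≡m%n+[m/n]*n h (s ℕ.* s ℕ.* 4) ⟩
      h % (s ℕ.* s ℕ.* 4) ℕ.+ j ℕ.* (s ℕ.* s ℕ.* 4)  ≡⟨ cong (ℕ._+ j ℕ.* (s ℕ.* s ℕ.* 4)) (ℕ.≡ᵇ⇒≡ _ _ (subst T (sym e) _)) ⟩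
      s ℕ.* s ℕ.* 3 ℕ.+ j ℕ.* (s ℕ.* s ℕ.* 4)  ≡⟨ solve 2 (λ j s → s :* s :* con 3 :+ j :* (s :* s :* con 4) := s :* s :* (con 3 :+ j :* con 4)) refl j s ⟩
      s ℕ.* s ℕ.* (3 ℕ.+ j ℕ.* 4)  ∎
    sw≢0 : s ℕ.* ℤ.∣ w ∣ ≢ 0
    sw≢0 sw≡0 with ℕ.m*n≡0⇒m≡0∨n≡0 s sw≡0
    ... | inj₁ s≡0 = ℕ.≢-nonZero⁻¹ s s≡0
    ... | inj₂ w≡0 = w≢0 (ℤ.∣i∣≡0⇒i≡0 w≡0)
    ℕeq : (3 ℕ.+ j ℕ.* 4) ℕ.* (s ℕ.* ℤ.∣ w ∣ ℕ.* (s ℕ.* ℤ.∣ w ∣)) ≡ q ℕ.* (ℤ.∣ z ∣ ℕ.* ℤ.∣ z ∣)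
    ℕeq = begin
      (3 ℕ.+ j ℕ.* 4) ℕ.* (s ℕ.* ℤ.∣ w ∣ ℕ.* (s ℕ.* ℤ.∣ w ∣))
        ≡⟨ solve 3 (λ p s w → p :* (s :* w :* (s :* w)) := s :* s :* p :* (w :* w)) refl (3 ℕ.+ j ℕ.* 4) s ℤ.∣ w ∣ ⟩
      s ℕ.* s ℕ.* (3 ℕ.+ j ℕ.* 4) ℕ.* (ℤ.∣ w ∣ ℕ.* ℤ.∣ w ∣)
        ≡⟨ cong₂ ℕ._*_ h≡ (ℤ.abs-* w w) ⟨
      h ℕ.* ℤ.∣ w ℤ.* w ∣
        ≡⟨ ℤ.abs-* (+ h) (w ℤ.* w) ⟨
      ℤ.∣ + h ℤ.* (w ℤ.* w) ∣
        ≡⟨ cong ℤ.∣_∣ eq ⟩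
      ℤ.∣ + q ℤ.* (z ℤ.* z) ∣
        ≡⟨ ℤ.abs-* (+ q) (z ℤ.* z) ⟩
      q ℕ.* ℤ.∣ z ℤ.* z ∣
        ≡⟨ cong (q ℕ.*_) (ℤ.abs-* z z) ⟩
      q ℕ.* (ℤ.∣ z ∣ ℕ.* ℤ.∣ z ∣) ∎

  ∼⇒admissible : ∀ {h} → h ≢ + 0 → h ∼ q → admissible h ≡ true
  ∼⇒admissible {+ zero}   h≢0 _ = contradiction refl h≢0
  ∼⇒admissible {+ suc h}  _ h∼q = cong₂ _∧_ (ok 1) (cong₂ _∧_ (ok 2) (cong₂ _∧_ (ok 4) (cong₂ _∧_ (ok 8) (ok 16))))
    where
    ok : ∀ s .{{_ : NonZero s}} .{{_ : NonZero (s ℕ.* s ℕ.* 4)}} → not (Excluded s (suc h)) ≡ true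
    ok s = cong not (∼⇒¬Excluded s h∼q)
  ∼⇒admissible { -[1+ h ]} h≢0 h∼q = contradiction (∼⇒0< {q = q} h≢0 h∼q) λ ()

  ∼⇒≢4k+3 : ∀ {h} → h ≢ + 0 → h ∼ q → ∀ k → h ≢ + 4 ℤ.* k ℤ.+ + 3
  ∼⇒≢4k+3 h≢0 h∼q (+ k) refl = contradiction (subst T (∼⇒¬Excluded 1 {4 ℕ.* k ℕ.+ 3} (subst (_∼ q) (cong (ℤ._+ + 3) (sym (ℤ.pos-* 4 k))) h∼q))
     (ℕ.≡⇒≡ᵇ _ 3 (trans (cong (_% 4) (trans (ℕ.+-comm (4 ℕ.* k) 3) (cong (3 ℕ.+_) (ℕ.*-comm 4 k)))) ([m+kn]%n≡m%n 3 k 4)))) (λ ())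
  -- The quotient supplied by `heron-odd` has no known sign; a negative one contradicts the
  -- positivity of `h`.
  ∼⇒≢4k+3 h≢0 h∼q -[1+ k ] refl = contradiction (ℤ.<-trans (∼⇒0< {q = q} h≢0 h∼q) (begin-strict
      + 4 ℤ.* -[1+ k ] ℤ.+ + 3  ≤⟨ ℤ.+-monoˡ-≤ (+ 3) (ℤ.*-monoˡ-≤-nonNeg (+ 4) (ℤ.-≤- {k} {0} ℕ.z≤n)) ⟩
      -[1+ 0 ]  <⟨ ℤ.-<+ ⟩
      + 0  ∎)) (ℤ.<-irrefl refl)
    where open ℤ.≤-Reasoning

  open HeronParity
  open ℤS

  4k+3⇒⊥ : ∀ {A : Set} {h} → h ≢ + 0 → h ∼ q → ∃[ k ] h ≡ + 4 ℤ.* k ℤ.+ + 3 → A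
  4k+3⇒⊥ h≢0 h∼q (k , eq) = contradiction eq (∼⇒≢4k+3 h≢0 h∼q k)

  open ≡-Reasoning

  xor-sides : ∀ a b c → heron (+ a) (+ b) (+ c) ≢ + 0 → heron (+ a) (+ b) (+ c) ∼ q → odd a xor odd b ≡ odd c
  xor-sides a b c h≢0 h∼q with half a | half b | half c
  ... | inj₁ (_ , _ , p) | inj₁ (_ , _ , r) | inj₁ (_ , _ , s) rewrite p | r | s = refl
  ... | inj₁ (_ , _ , p) | inj₂ (_ , _ , r) | inj₂ (_ , _ , s) rewrite p | r | s = refl
  ... | inj₂ (_ , _ , p) | inj₁ (_ , _ , r) | inj₂ (_ , _ , s) rewrite p | r | s = refl
  ... | inj₂ (_ , _ , p) | inj₂ (_ , _ , r) | inj₁ (_ , _ , s) rewrite p | r | s = refl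
  ... | inj₂ (i , refl , _) | inj₂ (j , refl , _) | inj₂ (k , refl , _) = 4k+3⇒⊥ h≢0 h∼q
    (heron-odd (+ suc (i ℕ.* 2)) (+ suc (j ℕ.* 2)) (+ suc (k ℕ.* 2)) (τ i j k ℤ.+ + 2 ℤ.* + i ℤ.+ + 2 ℤ.* + j ℤ.- + 2 ℤ.* + k) (begin
      _ ≡⟨ cong₂ ℤ._-_ (cong₂ ℤ._+_ (square (pos-odd i)) (square (pos-odd j))) (square (pos-odd k)) ⟩
      _ ≡⟨ solve 3 (λ i j k → o i :* o i :+ o j :* o j :- o k :* o k :=
             con (+ 2) :* (τ′ i j k :+ con (+ 2) :* i :+ con (+ 2) :* j :- con (+ 2) :* k) :+ con (+ 1)) refl (+ i) (+ j) (+ k) ⟩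
      _ ∎))
  ... | inj₂ (i , refl , _) | inj₁ (j , refl , _) | inj₁ (k , refl , _) = 4k+3⇒⊥ h≢0 h∼q
    (heron-odd (+ suc (i ℕ.* 2)) (+ (j ℕ.* 2)) (+ (k ℕ.* 2)) (τ i j k ℤ.+ + 2 ℤ.* + i) (begin
      _ ≡⟨ cong₂ ℤ._-_ (cong₂ ℤ._+_ (square (pos-odd i)) (square (ℤ.pos-* j 2))) (square (ℤ.pos-* k 2)) ⟩
      _ ≡⟨ solve 3 (λ i j k → o i :* o i :+ e j :* e j :- e k :* e k :=
             con (+ 2) :* (τ′ i j k :+ con (+ 2) :* i) :+ con (+ 1)) refl (+ i) (+ j) (+ k) ⟩
      _ ∎))
  ... | inj₁ (i , refl , _) | inj₂ (j , refl , _) | inj₁ (k , refl , _) = 4k+3⇒⊥ h≢0 h∼q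
    (heron-odd (+ (i ℕ.* 2)) (+ suc (j ℕ.* 2)) (+ (k ℕ.* 2)) (τ i j k ℤ.+ + 2 ℤ.* + j) (begin
      _ ≡⟨ cong₂ ℤ._-_ (cong₂ ℤ._+_ (square (ℤ.pos-* i 2)) (square (pos-odd j))) (square (ℤ.pos-* k 2)) ⟩
      _ ≡⟨ solve 3 (λ i j k → e i :* e i :+ o j :* o j :- e k :* e k :=
             con (+ 2) :* (τ′ i j k :+ con (+ 2) :* j) :+ con (+ 1)) refl (+ i) (+ j) (+ k) ⟩
      _ ∎))
  ... | inj₁ (i , refl , _) | inj₁ (j , refl , _) | inj₂ (k , refl , _) = 4k+3⇒⊥ h≢0 h∼q
    (heron-odd (+ (i ℕ.* 2)) (+ (j ℕ.* 2)) (+ suc (k ℕ.* 2)) (τ i j k ℤ.- + 2 ℤ.* + k ℤ.- + 1) (begin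
      _ ≡⟨ cong₂ ℤ._-_ (cong₂ ℤ._+_ (square (ℤ.pos-* i 2)) (square (ℤ.pos-* j 2))) (square (pos-odd k)) ⟩
      _ ≡⟨ solve 3 (λ i j k → e i :* e i :+ e j :* e j :- o k :* o k :=
             con (+ 2) :* (τ′ i j k :- con (+ 2) :* k :- con (+ 1)) :+ con (+ 1)) refl (+ i) (+ j) (+ k) ⟩
      _ ∎))

-- Few points

all≤ : ℕ → (ℕ → Bool) → Bool
all≤ zero    f = true
all≤ (suc n) f = f (suc n) ∧ all≤ n f

all≤-sound : ∀ n f → all≤ n f ≡ true → ∀ {i} → 0 ℕ.< i → i ℕ.≤ n → f i ≡ true
all≤-sound (suc n) f eq {i} 0<i i≤n with f (suc n) in fe | i ℕ.≟ suc n
... | true | yes refl = fe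
... | true | no  i≢   = all≤-sound n f eq 0<i (ℕ.≤-pred (ℕ.≤∧≢⇒< i≤n i≢))
all≤-sound zero f eq {suc i} 0<i ()

-- The Cayley–Menger relation between the distances a = |P₀P₁|, b = |P₀P₂|,
-- c = |P₁P₂|, x = |P₀P₃|, y = |P₁P₃|, z = |P₂P₃| in the plane
module Cayley where
  open import Data.Integer.Base using (_+_; _*_; _-_)

  pol gram : ℤ → ℤ → ℤ → ℤ
  pol  u v w = u + v - w
  gram u v e = + 4 * (u * v) - e * e

  mixed : ℤ → ℤ → ℤ → ℤ → ℤ
  mixed u w e v = + 2 * (u * w) - e * v

  -- The arguments are squared distances. By Sylvester's determinant identity, with the first
  -- diagonal entry as pivot, the value is `16 u` times the Gram determinant of the three edge
  -- vectors from P₀, which vanishes in the plane.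
  cayley : ℤ → ℤ → ℤ → ℤ → ℤ → ℤ → ℤ
  cayley u b c x y z = gram u x (pol u x y) * gram u b (pol u b c) - Z * Z
    where Z = mixed u (pol b x z) (pol u x y) (pol u b c)

  open ℤS

  pol-* : ∀ k u v w → pol (k * u) (k * v) (k * w) ≡ k * pol u v w
  pol-* = solve 4 (λ k u v w → k :* u :+ k :* v :- k :* w := k :* (u :+ v :- w)) refl

  gram-* : ∀ k u v e → gram (k * u) (k * v) (k * e) ≡ k * k * gram u v e
  gram-* = solve 4 (λ k u v e → con (+ 4) :* (k :* u :* (k :* v)) :- k :* e :* (k :* e) :=
    k :* k :* (con (+ 4) :* (u :* v) :- e :* e)) refl

  mixed-* : ∀ k u w e v → mixed (k * u) (k * w) (k * e) (k * v) ≡ k * k * mixed u w e v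
  mixed-* = solve 5 (λ k u w e v → con (+ 2) :* (k :* u :* (k :* w)) :- k :* e :* (k :* v) :=
    k :* k :* (con (+ 2) :* (u :* w) :- e :* v)) refl

  cayley-* : ∀ k u b c x y z → cayley (k * u) (k * b) (k * c) (k * x) (k * y) (k * z) ≡ k * k * (k * k) * cayley u b c x y z
  cayley-* k u b c x y z = trans
    (cong₃ (trans (cong (gram (k * u) (k * x)) (pol-* k u x y)) (gram-* k u x (pol u x y)))
           (trans (cong (gram (k * u) (k * b)) (pol-* k u b c)) (gram-* k u b (pol u b c)))
           (trans (trans (cong₂ (λ w e → mixed (k * u) w e (pol (k * u) (k * b) (k * c))) (pol-* k b x z) (pol-* k u x y))
             (cong (mixed (k * u) (k * pol b x z) (k * pol u x y)) (pol-* k u b c))) (mixed-* k u (pol b x z) (pol u x y) (pol u b c))))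
    (solve 4 (λ k g h m → k :* k :* g :* (k :* k :* h) :- k :* k :* m :* (k :* k :* m) :=
        k :* k :* (k :* k) :* (g :* h :- m :* m)) refl
        k (gram u x (pol u x y)) (gram u b (pol u b c)) (mixed u (pol b x z) (pol u x y) (pol u b c)))
    where
    cong₃ : ∀ {g h m g′ h′ m′} → g ≡ g′ → h ≡ h′ → m ≡ m′ → g * h - m * m ≡ g′ * h′ - m′ * m′
    cong₃ refl refl refl = refl

  -- This is `planar` at `j = a`, where `E a` and `Z a` vanish.
  planar⇒cayley≡0 : ∀ {I : Set} (S : I → I → ℤ) → (∀ i → S i i ≡ + 0) → (∀ i j → S i j ≡ S j i) → IsPlanar S →
                    ∀ a b c i → cayley (S a b) (S a c) (S b c) (S a i) (S b i) (S c i) ≡ + 0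
  planar⇒cayley≡0 S S-refl S-sym planar a b c i = begin
    gram (S a b) (S a i) (E i) * N - Z i * Z i
      ≡⟨ cong₂ (λ e t → gram (S a b) t e * N - Z i * Z i) (sym Ei) (S-sym a i) ⟩
    gram (S a b) (S i a) (E i - E a) * N - Z i * Z i
      ≡⟨ cong (_- Z i * Z i) (planar a b c i a) ⟩
    (Z i - Z a) * (Z i - Z a) - Z i * Z i
      ≡⟨ cong (λ t → t * t - Z i * Z i) Zi ⟩
    Z i * Z i - Z i * Z i
      ≡⟨ ℤ.+-inverseʳ (Z i * Z i) ⟩
    + 0 ∎
    where
    open ≡-Reasoning
    open Frame S a b c
    E≡0 : E a ≡ + 0
    E≡0 = trans (cong₂ (λ s t → S a b + s - t) (S-refl a) (S-sym b a))
      (solve 1 (λ u → u :+ con (+ 0) :- u := con (+ 0)) refl (S a b))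
    W≡0 : W a ≡ + 0
    W≡0 = trans (cong₂ (λ s t → S a c + s - t) (S-refl a) (S-sym c a))
      (solve 1 (λ u → u :+ con (+ 0) :- u := con (+ 0)) refl (S a c))
    Ei : E i - E a ≡ E i
    Ei = trans (cong (λ t → E i - t) E≡0) (ℤ.+-identityʳ (E i))
    Zi : Z i - Z a ≡ Z i
    Zi = trans (cong₂ (λ s t → Z i - (+ 2 * (S a b * s) - t * V)) W≡0 E≡0)
      (solve 3 (λ z u v → z :- (con (+ 2) :* (u :* con (+ 0)) :- con (+ 0) :* v) := z) refl (Z i) (S a b) V)

open Cayley using (cayley; cayley-*; planar⇒cayley≡0)

sq : ℕ → ℤ
sq a = + a ℤ.* + a

admissibleSides : ℕ → ℕ → ℕ → Bool
admissibleSides a b c = admissible (heron (+ a) (+ b) (+ c))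

nonZero : ℤ → Bool
nonZero (+ zero)  = false
nonZero (+ suc _) = true
nonZero -[1+ _ ]  = true

-- No four points have distances s a, s b, s c, x, y, z with a, b, c ≤ t and x, y, z ≤ r
-- unless one of the triangles is inadmissible.
noFourPoints : (s t r : ℕ) → Bool
noFourPoints s t r = all≤ t λ a′ → all≤ t λ b′ → all≤ t λ c′ →
  let a = s ℕ.* a′; b = s ℕ.* b′; c = s ℕ.* c′ in
  not (admissibleSides a b c) ∨ all≤ r λ x → all≤ r λ y →
  not (admissibleSides a x y) ∨ all≤ r λ z →
  not (admissibleSides b x z) ∨ (not (admissibleSides c y z) ∨
    nonZero (cayley (sq a) (sq b) (sq c) (sq x) (sq y) (sq z)))

∨-elimʳ : ∀ {a b} → not a ∨ b ≡ true → a ≡ true → b ≡ true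
∨-elimʳ {true} h refl = h

noFourPoints-sound : ∀ s t r → noFourPoints s t r ≡ true → ∀ {a b c x y z} →
  0 ℕ.< a → a ℕ.≤ t → 0 ℕ.< b → b ℕ.≤ t → 0 ℕ.< c → c ℕ.≤ t →
  0 ℕ.< x → x ℕ.≤ r → 0 ℕ.< y → y ℕ.≤ r → 0 ℕ.< z → z ℕ.≤ r →
  admissibleSides (s ℕ.* a) (s ℕ.* b) (s ℕ.* c) ≡ true → admissibleSides (s ℕ.* a) x y ≡ true →
  admissibleSides (s ℕ.* b) x z ≡ true → admissibleSides (s ℕ.* c) y z ≡ true →
  cayley (sq (s ℕ.* a)) (sq (s ℕ.* b)) (sq (s ℕ.* c)) (sq x) (sq y) (sq z) ≢ + 0
noFourPoints-sound s t r h {a} {b} {c} {x} {y} {z} 0<a a≤ 0<b b≤ 0<c c≤ 0<x x≤ 0<y y≤ 0<z z≤ abc axy bxz cyz ≡0 =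
  contradiction (trans (sym nz) (cong nonZero ≡0)) λ ()
  where
  nz : nonZero (cayley (sq (s ℕ.* a)) (sq (s ℕ.* b)) (sq (s ℕ.* c)) (sq x) (sq y) (sq z)) ≡ true
  nz = ∨-elimʳ (∨-elimʳ (all≤-sound r _ (∨-elimʳ (all≤-sound r _ (all≤-sound r _ (∨-elimʳ
    (all≤-sound t _ (all≤-sound t _ (all≤-sound t _ h 0<a a≤) 0<b b≤) 0<c c≤) abc) 0<x x≤) 0<y y≤) axy) 0<z z≤) bxz) cyz

noThreePoints-sound : ∀ {a b c} → 0 ℕ.< a → a ℕ.≤ 2 → 0 ℕ.< b → b ℕ.≤ 2 → 0 ℕ.< c → c ℕ.≤ 2 →
                      admissibleSides a b c ≢ true
noThreePoints-sound {a} {b} {c} 0<a a≤ 0<b b≤ 0<c c≤ adm = contradiction (trans (sym inadm) (cong not adm)) λ ()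
  where
  inadm : not (admissibleSides a b c) ≡ true
  inadm = all≤-sound 2 (λ c → not (admissibleSides a b c)) (all≤-sound 2 (λ b → all≤ 2 λ c → not (admissibleSides a b c))
    (all≤-sound 2 (λ a → all≤ 2 λ b → all≤ 2 λ c → not (admissibleSides a b c)) refl 0<a a≤) 0<b b≤) 0<c c≤

noFourPoints₄ : noFourPoints 1 4 4 ≡ true
noFourPoints₄ = refl

-- Asking for a triangle with even sides shortens the search and is also essential: without it the 3
-- × 4 rectangle, with distances 3, 4 and 5, would be found.
noFourPoints₈ : noFourPoints 2 4 8 ≡ true
noFourPoints₈ = refl

heron-* : ∀ k a b c → heron (k ℤ.* a) (k ℤ.* b) (k ℤ.* c) ≡ k ℤ.* k ℤ.* (k ℤ.* k) ℤ.* heron a b c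
heron-* = solve 4 (λ k a b c →
  let h = λ a b c → con (+ 4) :* (a :* a :* (b :* b)) :- (a :* a :+ b :* b :- c :* c) :* (a :* a :+ b :* b :- c :* c)
  in h (k :* a) (k :* b) (k :* c) := k :* k :* (k :* k) :* h a b c) refl
  where open ℤS

heron-cong : ∀ {a a′ b b′ c c′} → a ≡ a′ → b ≡ b′ → c ≡ c′ → heron a b c ≡ heron a′ b′ c′
heron-cong refl refl refl = refl

∼-cancel : ∀ k {h q} → k ≢ + 0 → k ℤ.* k ℤ.* (k ℤ.* k) ℤ.* h ∼ q → h ∼ q
∼-cancel k {h} {q} k≢0 (mk∼ w z w≢0 eq) = mk∼ (k ℤ.* k ℤ.* w) z kkw≢0 (trans
    (solve 3 (λ k h w → h :* (k :* k :* w :* (k :* k :* w)) := k :* k :* (k :* k) :* h :* (w :* w)) refl k h w) eq)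
  where
  open ℤS
  kkw≢0 : k ℤ.* k ℤ.* w ≢ + 0
  kkw≢0 ≡0 with ℤ.i*j≡0⇒i≡0∨j≡0 (k ℤ.* k) ≡0
  ... | inj₂ w≡0 = w≢0 w≡0
  ... | inj₁ kk≡0 with ℤ.i*j≡0⇒i≡0∨j≡0 k kk≡0
  ...   | inj₁ k≡0 = k≢0 k≡0
  ...   | inj₂ k≡0 = k≢0 k≡0

length-filter-split : ∀ {A : Set} (f : A → Bool) xs →
  length xs ≡ length (filter (λ x → f x Bool.≟ false) xs) ℕ.+ length (filter (λ x → f x Bool.≟ true) xs)
length-filter-split f [] = refl
length-filter-split f (x ∷ xs) with f x
... | false = cong suc (length-filter-split f xs)
... | true  = trans (cong suc (length-filter-split f xs)) (sym (ℕ.+-suc _ _))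

remove : ∀ {n} → Fin n → List (Fin n) → List (Fin n)
remove a = filter (λ x → ¬? (x Fin.≟ a))

length-remove : ∀ {n} (a : Fin n) {xs} → Unique xs → length xs ℕ.≤ suc (length (remove a xs))
length-remove a [] = ℕ.z≤n
length-remove a {x ∷ xs} (x∉ ∷ u) with x Fin.≟ a
... | yes refl = ℕ.s≤s (ℕ.≤-reflexive (sym (cong length
                   (filter-all (λ y → ¬? (y Fin.≟ a)) (All.map (λ x≢y y≡x → x≢y (sym y≡x)) x∉)))))
... | no _     = ℕ.s≤s (length-remove a u)

∈-remove⁻ : ∀ {n} (a : Fin n) {xs x} → x ∈ remove a xs → x ∈ xs × x ≢ a
∈-remove⁻ a = ∈-filter⁻ (λ x → ¬? (x Fin.≟ a))

remove-unique : ∀ {n} (a : Fin n) {xs} → Unique xs → Unique (remove a xs)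
remove-unique a = Unique.filter⁺ (λ x → ¬? (x Fin.≟ a))

module Scales {n q} {D : Fin n → Fin n → ℕ} (isD : IsDistanceMatrix q D) (q≢0 : q % 4 ≢ 0) (q≢3 : q % 4 ≢ 3) where
  open IsDistanceMatrix isD

  Distinct : Fin n → Fin n → Fin n → Set
  Distinct i j k = i ≢ j × j ≢ k × i ≢ k

  triangle : ∀ g .{{_ : NonZero g}} {i j k a b c} → Distinct i j k →
             D i j ≡ g ℕ.* a → D i k ≡ g ℕ.* b → D j k ≡ g ℕ.* c →
             heron (+ a) (+ b) (+ c) ≢ + 0 × heron (+ a) (+ b) (+ c) ∼ q
  triangle g {i} {j} {k} {a} {b} {c} (i≢j , j≢k , i≢k) ij ik jk =
    (λ h≡0 → heron≢0 i≢j j≢k i≢k (trans H≡ (trans (cong (ℤ._*_ g⁴) h≡0) (ℤ.*-zeroʳ g⁴)))) ,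
    ∼-cancel (+ g) (λ g≡0 → ℕ.≢-nonZero⁻¹ g (ℤ.+-injective g≡0)) (subst (_∼ q) H≡ (heron-commensurable i j k))
    where
    g⁴ = + g ℤ.* + g ℤ.* (+ g ℤ.* + g)
    H≡ : heron (+ D i j) (+ D i k) (+ D j k) ≡ g⁴ ℤ.* heron (+ a) (+ b) (+ c)
    H≡ = trans (heron-cong (trans (cong +_ ij) (ℤ.pos-* g a)) (trans (cong +_ ik) (ℤ.pos-* g b)) (trans (cong +_ jk) (ℤ.pos-* g c)))
      (heron-* (+ g) (+ a) (+ b) (+ c))

  triangle-admissible : ∀ g .{{_ : NonZero g}} {i j k a b c} → Distinct i j k →
    D i j ≡ g ℕ.* a → D i k ≡ g ℕ.* b → D j k ≡ g ℕ.* c → admissibleSides a b c ≡ true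
  triangle-admissible g dist ij ik jk = let h≢0 , h∼q = triangle g dist ij ik jk in ∼⇒admissible q≢0 q≢3 h≢0 h∼q

  triangle-parity : ∀ g .{{_ : NonZero g}} {i j k a b c} → Distinct i j k →
    D i j ≡ g ℕ.* a → D i k ≡ g ℕ.* b → D j k ≡ g ℕ.* c → odd a xor odd b ≡ odd c
  triangle-parity g {a = a} {b} {c} dist ij ik jk =
    let h≢0 , h∼q = triangle g dist ij ik jk in xor-sides q≢0 q≢3 a b c h≢0 h∼q

  Scale : ℕ → List (Fin n) → Set
  Scale g L = ∀ {i j} → i ∈ L → j ∈ L → g ∣ D i j

  Class : ℕ → ℕ → Set
  Class g k = ∃[ L ] k ℕ.≤ length L × Unique L × Scale g L

  -- Points at odd distance from a common point are, by parity of the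
  -- perimeters, at even distance from each other.
  halve : ∀ g .{{_ : NonZero g}} k (L : Class g (suc (k ℕ.* 2))) →
          Σ[ L′ ∈ Class (g ℕ.* 2) (suc k) ] (∀ {x} → x ∈ proj₁ L′ → x ∈ proj₁ L)
  halve g k (L@(p ∷ L′) , size , unique , scale) = result
    where
    f : Fin n → Bool
    f x = odd (D p x / g)
    D≡ : ∀ {i j} → i ∈ L → j ∈ L → D i j ≡ g ℕ.* (D i j / g)
    D≡ i∈ j∈ = trans (sym (m/n*n≡m (scale i∈ j∈))) (ℕ.*-comm _ g)
    even⇒∣ : ∀ {i j} → i ∈ L → j ∈ L → odd (D i j / g) ≡ false → g ℕ.* 2 ∣ D i j
    even⇒∣ {i} {j} i∈ j∈ o with half (D i j / g)
    ... | inj₁ (k , eq , _) = divides k (trans (D≡ i∈ j∈) (trans (cong (g ℕ.*_) eq)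
            (solve 2 (λ g k → g :* (k :* con 2) := k :* (g :* con 2)) refl g k)))
      where open ℕS
    ... | inj₂ (_ , _ , o′) = contradiction (trans (sym o) o′) λ ()
    p∈ : p ∈ L
    p∈ = here refl
    f-p : f p ≡ false
    f-p rewrite D-refl p = cong odd (m*n/n≡m 0 g)
    xor-cancel : ∀ a b c → a xor b ≡ c → a ≡ b → c ≡ false
    xor-cancel true  _ _ eq refl = sym eq
    xor-cancel false _ _ eq refl = sym eq
    same⇒∣ : ∀ {x y} → x ∈ L → y ∈ L → f x ≡ f y → g ℕ.* 2 ∣ D x y
    same⇒∣ {x} {y} x∈ y∈ fx≡fy with x Fin.≟ y | p Fin.≟ x | p Fin.≟ y
    ... | yes refl | _ | _ = subst (g ℕ.* 2 ∣_) (sym (D-refl x)) (_ ∣0)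
    ... | no _ | yes refl | _ = even⇒∣ x∈ y∈ (trans (sym fx≡fy) f-p)
    ... | no _ | no _ | yes refl = subst (g ℕ.* 2 ∣_) (D-sym y x) (even⇒∣ y∈ x∈ (trans fx≡fy f-p))
    ... | no x≢y | no p≢x | no p≢y = even⇒∣ x∈ y∈ (xor-cancel (f x) (f y) _
          (triangle-parity g (p≢x , x≢y , p≢y) (D≡ p∈ x∈) (D≡ p∈ y∈) (D≡ x∈ y∈)) fx≡fy)
    part : Bool → List (Fin n)
    part b = filter (λ x → f x Bool.≟ b) L
    class : ∀ b → suc k ℕ.≤ length (part b) → Σ[ L′ ∈ Class (g ℕ.* 2) (suc k) ] (∀ {x} → x ∈ proj₁ L′ → x ∈ L)
    class b large = (part b , large , Unique.filter⁺ (λ x → f x Bool.≟ b) unique , λ x∈ y∈ →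
      let x∈L , fx = ∈-filter⁻ (λ x → f x Bool.≟ b) x∈
          y∈L , fy = ∈-filter⁻ (λ x → f x Bool.≟ b) y∈
      in same⇒∣ x∈L y∈L (trans fx (sym fy))) , λ x∈ → proj₁ (∈-filter⁻ (λ x → f x Bool.≟ b) x∈)
    result : Σ[ L′ ∈ Class (g ℕ.* 2) (suc k) ] (∀ {x} → x ∈ proj₁ L′ → x ∈ L)
    result with suc k ℕ.≤? length (part false) | suc k ℕ.≤? length (part true)
    ... | yes h | _     = class false h
    ... | no _  | yes h = class true h
    ... | no h₀ | no h₁ = contradiction (begin-strict
      length L  ≡⟨ length-filter-split f L ⟩
      length (part false) ℕ.+ length (part true)  ≤⟨ ℕ.+-mono-≤ (ℕ.≤-pred (ℕ.≰⇒> h₀)) (ℕ.≤-pred (ℕ.≰⇒> h₁)) ⟩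
      k ℕ.+ k  ≡⟨ solve 1 (λ k → k :+ k := k :* con 2) refl k ⟩
      k ℕ.* 2  <⟨ size ⟩
      length L  ∎) (ℕ.<-irrefl refl)
      where
      open ℕ.≤-Reasoning
      open ℕS

  module Bounds (d : ℕ) (D≤d : ∀ i j → D i j ℕ.≤ d) where

    -- Quantifying over all scales `g` makes the bound inheritable: `halve` passes to about half of
    -- the points and doubles `g`, which `double` turns into a doubled `f`.
    Bound : ℕ → ℕ → Set
    Bound k f = ∀ g → .{{NonZero g}} → Class g k → f ℕ.* g ℕ.≤ d

    double : ∀ k f → Bound (suc k) f → Bound (suc (k ℕ.* 2)) (f ℕ.* 2)
    double k f bound g class = subst (ℕ._≤ d) (solve 2 (λ f g → f :* (g :* con 2) := f :* con 2 :* g) refl f g)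
      (bound (g ℕ.* 2) {{ℕ.m*n≢0 g 2}} (proj₁ (halve g k class)))
      where open ℕS

    module _ (g : ℕ) .{{_ : NonZero g}} (f : ℕ) (small : ¬ (suc f ℕ.* g ℕ.≤ d)) where

      scaled : ∀ {i j} → i ≢ j → g ∣ D i j → ∃[ c ] D i j ≡ g ℕ.* c × 0 ℕ.< c × c ℕ.≤ f
      scaled {i} {j} i≢j (divides c eq) = c , D≡ , 0<c ,
          ℕ.≮⇒≥ λ f<c → small (ℕ.≤-trans (ℕ.*-monoˡ-≤ g f<c) (subst (ℕ._≤ d) eq (D≤d i j)))
        where
        D≡ = trans eq (ℕ.*-comm c g)
        0<c : 0 ℕ.< c
        0<c = ℕ.n≢0⇒n>0 λ { refl → ℕ.<-irrefl (sym eq) (D-pos i≢j) }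

    bound₃ : Bound 3 3
    bound₃ g (i ∷ j ∷ k ∷ L , _ , (i≢j ∷ i≢k ∷ _) ∷ (j≢k ∷ _) ∷ _ , scale) = ℕ.≮⇒≥ λ small′ →
      let small = ℕ.<⇒≱ small′
          a , ij , 0<a , a≤ = scaled g 2 small i≢j (scale (here refl) (there (here refl)))
          b , ik , 0<b , b≤ = scaled g 2 small i≢k (scale (here refl) (there (there (here refl))))
          c , jk , 0<c , c≤ = scaled g 2 small j≢k (scale (there (here refl)) (there (there (here refl))))
          adm = triangle-admissible g (i≢j , j≢k , i≢k) ij ik jk
      in noThreePoints-sound 0<a a≤ 0<b b≤ 0<c c≤ adm
    bound₃ g ([] , () , _)
    bound₃ g (_ ∷ [] , ℕ.s≤s () , _)
    bound₃ g (_ ∷ _ ∷ [] , ℕ.s≤s (ℕ.s≤s ()) , _)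

    cayley-D : ∀ g .{{_ : NonZero g}} i j k l {a b c x y z} →
      D i j ≡ g ℕ.* a → D i k ≡ g ℕ.* b → D j k ≡ g ℕ.* c → D i l ≡ g ℕ.* x → D j l ≡ g ℕ.* y → D k l ≡ g ℕ.* z →
      cayley (sq a) (sq b) (sq c) (sq x) (sq y) (sq z) ≡ + 0
    cayley-D g i j k l {a} {b} {c} {x} {y} {z} ij ik jk il jl kl = cancel (begin
        + g ℤ.* + g ℤ.* (+ g ℤ.* + g) ℤ.* (+ g ℤ.* + g ℤ.* (+ g ℤ.* + g)) ℤ.* cayley (sq a) (sq b) (sq c) (sq x) (sq y) (sq z)
          ≡⟨ cayley-* (+ g ℤ.* + g) (sq a) (sq b) (sq c) (sq x) (sq y) (sq z) ⟨
        cayley (+ g ℤ.* + g ℤ.* sq a) (+ g ℤ.* + g ℤ.* sq b) (+ g ℤ.* + g ℤ.* sq c)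
               (+ g ℤ.* + g ℤ.* sq x) (+ g ℤ.* + g ℤ.* sq y) (+ g ℤ.* + g ℤ.* sq z)
          ≡⟨ cong₆ (sq-* ij) (sq-* ik) (sq-* jk) (sq-* il) (sq-* jl) (sq-* kl) ⟩
        cayley (sq (D i j)) (sq (D i k)) (sq (D j k)) (sq (D i l)) (sq (D j l)) (sq (D k l))
          ≡⟨ planar⇒cayley≡0 (λ i j → sq (D i j)) (λ i → cong sq (D-refl i)) (λ i j → cong sq (D-sym i j)) planar i j k l ⟩
        + 0 ∎)
      where
      open ≡-Reasoning
      cong₆ : ∀ {a a′ b b′ c c′ x x′ y y′ z z′} → a ≡ a′ → b ≡ b′ → c ≡ c′ → x ≡ x′ → y ≡ y′ → z ≡ z′ →
              cayley a b c x y z ≡ cayley a′ b′ c′ x′ y′ z′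
      cong₆ refl refl refl refl refl refl = refl
      sq-* : ∀ {e m} → e ≡ g ℕ.* m → + g ℤ.* + g ℤ.* sq m ≡ sq e
      sq-* {m = m} refl = trans (solve 2 (λ g m → g :* g :* (m :* m) := g :* m :* (g :* m)) refl (+ g) (+ m))
        (cong₂ ℤ._*_ (sym (ℤ.pos-* g m)) (sym (ℤ.pos-* g m)))
        where open ℤS
      g≢0 : + g ≢ + 0
      g≢0 eq = ℕ.≢-nonZero⁻¹ g (ℤ.+-injective eq)
      split : ∀ {m} k → k ≢ + 0 → k ℤ.* m ≡ + 0 → m ≡ + 0
      split k k≢0 eq with ℤ.i*j≡0⇒i≡0∨j≡0 k eq
      ... | inj₁ k≡0 = contradiction k≡0 k≢0
      ... | inj₂ m≡0 = m≡0
      g²≢0 : + g ℤ.* + g ≢ + 0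
      g²≢0 eq = g≢0 (split (+ g) g≢0 eq)
      g⁴≢0 : + g ℤ.* + g ℤ.* (+ g ℤ.* + g) ≢ + 0
      g⁴≢0 eq = g²≢0 (split (+ g ℤ.* + g) g²≢0 eq)
      cancel : ∀ {m} → + g ℤ.* + g ℤ.* (+ g ℤ.* + g) ℤ.* (+ g ℤ.* + g ℤ.* (+ g ℤ.* + g)) ℤ.* m ≡ + 0 → m ≡ + 0
      cancel eq = split _ (λ eq → g⁴≢0 (split _ g⁴≢0 eq)) eq

    bound₄ : Bound 4 5
    bound₄ g (i ∷ j ∷ k ∷ l ∷ L , _ , (i≢j ∷ i≢k ∷ i≢l ∷ _) ∷ (j≢k ∷ j≢l ∷ _) ∷ (k≢l ∷ _) ∷ _ , scale) = ℕ.≮⇒≥ λ small′ →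
      let small = ℕ.<⇒≱ small′
          i∈ = here refl
          j∈ = there (here refl)
          k∈ = there (there (here refl))
          l∈ = there (there (there (here refl)))
          a , ij , 0<a , a≤ = scaled g 4 small i≢j (scale i∈ j∈)
          b , ik , 0<b , b≤ = scaled g 4 small i≢k (scale i∈ k∈)
          c , jk , 0<c , c≤ = scaled g 4 small j≢k (scale j∈ k∈)
          x , il , 0<x , x≤ = scaled g 4 small i≢l (scale i∈ l∈)
          y , jl , 0<y , y≤ = scaled g 4 small j≢l (scale j∈ l∈)
          z , kl , 0<z , z≤ = scaled g 4 small k≢l (scale k∈ l∈)
          1* = λ m → sym (ℕ.*-identityˡ m)
          g1* = λ {e} m (eq : e ≡ g ℕ.* m) → trans eq (cong (g ℕ.*_) (1* m))
      in noFourPoints-sound 1 4 4 noFourPoints₄ 0<a a≤ 0<b b≤ 0<c c≤ 0<x x≤ 0<y y≤ 0<z z≤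
           (triangle-admissible g (i≢j , j≢k , i≢k) (g1* a ij) (g1* b ik) (g1* c jk))
           (triangle-admissible g (i≢j , j≢l , i≢l) (g1* a ij) il jl)
           (triangle-admissible g (i≢k , k≢l , i≢l) (g1* b ik) il kl)
           (triangle-admissible g (j≢k , k≢l , j≢l) (g1* c jk) jl kl)
           (cayley-D g i j k l (g1* a ij) (g1* b ik) (g1* c jk) il jl kl)
    bound₄ g ([] , () , _)
    bound₄ g (_ ∷ [] , ℕ.s≤s () , _)
    bound₄ g (_ ∷ _ ∷ [] , ℕ.s≤s (ℕ.s≤s ()) , _)
    bound₄ g (_ ∷ _ ∷ _ ∷ [] , ℕ.s≤s (ℕ.s≤s (ℕ.s≤s ())) , _)

    -- `halve` yields three of the five points with distances divisible by `2 g`. Any further one of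
    -- the five completes them to a configuration excluded by `noFourPoints₈`.
    bound₅ : Bound 5 9
    bound₅ g L@(xs , size , unique , scale) with halve g 2 L
    ... | (i ∷ j ∷ k ∷ L′ , _ , (i≢j ∷ i≢k ∷ _) ∷ (j≢k ∷ _) ∷ _ , scale′) , L′⊆L = ℕ.≮⇒≥ λ small′ →
      let small = ℕ.<⇒≱ small′
          -- A multiple of `2 g` below `9 g` is at most `4 · 2 g`, since `5 · 2 g = 10 g`.
          small₄ = λ h → ℕ.<⇒≱ small′ (ℕ.≤-trans (subst (9 ℕ.* g ℕ.≤_) (10g g) (ℕ.m≤n+m (9 ℕ.* g) g)) h)
          i∈ = here refl
          j∈ = there (here refl)
          k∈ = there (there (here refl))
          l , l∈ , l≢i , l≢j , l≢k = other
          i≢l = λ i≡l → l≢i (sym i≡l)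
          j≢l = λ j≡l → l≢j (sym j≡l)
          k≢l = λ k≡l → l≢k (sym k≡l)
          a , ij , 0<a , a≤ = scaled (g ℕ.* 2) {{ℕ.m*n≢0 g 2}} 4 small₄ i≢j (scale′ i∈ j∈)
          b , ik , 0<b , b≤ = scaled (g ℕ.* 2) {{ℕ.m*n≢0 g 2}} 4 small₄ i≢k (scale′ i∈ k∈)
          c , jk , 0<c , c≤ = scaled (g ℕ.* 2) {{ℕ.m*n≢0 g 2}} 4 small₄ j≢k (scale′ j∈ k∈)
          x , il , 0<x , x≤ = scaled g 8 small i≢l (scale (L′⊆L i∈) l∈)
          y , jl , 0<y , y≤ = scaled g 8 small j≢l (scale (L′⊆L j∈) l∈)
          z , kl , 0<z , z≤ = scaled g 8 small k≢l (scale (L′⊆L k∈) l∈)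
          g2 = λ {e} m (eq : e ≡ g ℕ.* 2 ℕ.* m) → trans eq (ℕ.*-assoc g 2 m)
      in noFourPoints-sound 2 4 8 noFourPoints₈ 0<a a≤ 0<b b≤ 0<c c≤ 0<x x≤ 0<y y≤ 0<z z≤
           (triangle-admissible g (i≢j , j≢k , i≢k) (g2 a ij) (g2 b ik) (g2 c jk))
           (triangle-admissible g (i≢j , j≢l , i≢l) (g2 a ij) il jl)
           (triangle-admissible g (i≢k , k≢l , i≢l) (g2 b ik) il kl)
           (triangle-admissible g (j≢k , k≢l , j≢l) (g2 c jk) jl kl)
           (cayley-D g i j k l (g2 a ij) (g2 b ik) (g2 c jk) il jl kl)
      where
      10g : ∀ g → g ℕ.+ 9 ℕ.* g ≡ 5 ℕ.* (g ℕ.* 2)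
      10g = solve 1 (λ g → g :+ con 9 :* g := con 5 :* (g :* con 2)) refl
        where open ℕS
      other : ∃[ l ] l ∈ xs × l ≢ i × l ≢ j × l ≢ k
      other with remove k (remove j (remove i xs)) in eq
      ... | [] = contradiction (begin
              5  ≤⟨ size ⟩
              length xs  ≤⟨ length-remove i unique ⟩
              1 ℕ.+ length (remove i xs)  ≤⟨ ℕ.+-monoʳ-≤ 1 (length-remove j (remove-unique i unique)) ⟩
              2 ℕ.+ length (remove j (remove i xs))  ≤⟨ ℕ.+-monoʳ-≤ 2 (length-remove k (remove-unique j (remove-unique i unique))) ⟩
              3 ℕ.+ length (remove k (remove j (remove i xs)))  ≡⟨ cong (λ t → 3 ℕ.+ length t) eq ⟩
              3  ∎) (ℕ.<⇒≱ (ℕ.s≤s (ℕ.s≤s (ℕ.s≤s (ℕ.s≤s ℕ.z≤n)))))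
        where open ℕ.≤-Reasoning
      ... | l ∷ _ =
        let l∈₂ , l≢k = ∈-remove⁻ k (subst (l ∈_) (sym eq) (here refl))
            l∈₁ , l≢j = ∈-remove⁻ j l∈₂
            l∈  , l≢i = ∈-remove⁻ i l∈₁
        in l , l∈ , l≢i , l≢j , l≢k
    ... | ([] , () , _) , _
    ... | (_ ∷ [] , ℕ.s≤s () , _) , _
    ... | (_ ∷ _ ∷ [] , ℕ.s≤s (ℕ.s≤s ()) , _) , _

    bound₇ : Bound 7 10
    bound₇ = double 3 5 bound₄

    bound₉ : Bound 9 18
    bound₉ = double 4 9 bound₅

    bound₁₃ : Bound 13 20
    bound₁₃ = double 6 10 bound₇

    bound₁₇ : Bound 17 36
    bound₁₇ = double 8 18 bound₉

-- Conics through five points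

i*j≡0⇒j≡0 : ∀ i {j} → i ≢ + 0 → i ℤ.* j ≡ + 0 → j ≡ + 0
i*j≡0⇒j≡0 i i≢0 eq with ℤ.i*j≡0⇒i≡0∨j≡0 i eq
... | inj₁ i≡0 = contradiction i≡0 i≢0
... | inj₂ j≡0 = j≡0

i*j≢0 : ∀ {i j} → i ≢ + 0 → j ≢ + 0 → i ℤ.* j ≢ + 0
i*j≢0 {i} i≢0 j≢0 eq = j≢0 (i*j≡0⇒j≡0 i i≢0 eq)

i*i-nonNeg : ∀ i → + 0 ℤ.≤ i ℤ.* i
i*i-nonNeg (+ n)    = subst (+ 0 ℤ.≤_) (ℤ.pos-* n n) (ℤ.+≤+ ℕ.z≤n)
i*i-nonNeg -[1+ n ] = ℤ.+≤+ ℕ.z≤n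

i*i≡0⇒i≡0 : ∀ i → i ℤ.* i ≡ + 0 → i ≡ + 0
i*i≡0⇒i≡0 i eq = Sum.reduce (ℤ.i*j≡0⇒i≡0∨j≡0 i eq)

i+j≡0⇒i≡0 : ∀ {i j} → + 0 ℤ.≤ i → + 0 ℤ.≤ j → i ℤ.+ j ≡ + 0 → i ≡ + 0
i+j≡0⇒i≡0 {i} {j} 0≤i 0≤j eq = ℤ.≤-antisym (subst (i ℤ.≤_) eq (subst (ℤ._≤ i ℤ.+ j) (ℤ.+-identityʳ i) (ℤ.+-monoʳ-≤ i 0≤j))) 0≤i

module Conics where
  open import Data.Integer.Base using (_+_; _*_; _-_; -_)
  open ℤS
  open ≡-Reasoning

  quadratic : ℤ → ℤ → ℤ → ℤ → ℤ → ℤ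
  quadratic a b c x y = a * (x * x) + b * (x * y) + c * (y * y)

  conic : ℤ → ℤ → ℤ → ℤ → ℤ → ℤ → ℤ → ℤ
  conic a b c d e x y = quadratic a b c x y + (d * x + e * y)

  det : ℤ → ℤ → ℤ → ℤ → ℤ → ℤ → ℤ
  det x₁ y₁ x₂ y₂ x₃ y₃ = (x₂ - x₁) * (y₃ - y₁) - (x₃ - x₁) * (y₂ - y₁)

  affine≡0 : ∀ β₁ β₂ γ x₁ y₁ x₂ y₂ x₃ y₃ → det x₁ y₁ x₂ y₂ x₃ y₃ ≢ + 0 →
    β₁ * x₁ + β₂ * y₁ + γ ≡ + 0 → β₁ * x₂ + β₂ * y₂ + γ ≡ + 0 → β₁ * x₃ + β₂ * y₃ + γ ≡ + 0 →
    β₁ ≡ + 0 × β₂ ≡ + 0 × γ ≡ + 0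
  affine≡0 β₁ β₂ γ x₁ y₁ x₂ y₂ x₃ y₃ det≢0 g₁ g₂ g₃ = β₁≡0 , β₂≡0 , γ≡0
    where
    β₁≡0 : β₁ ≡ + 0
    β₁≡0 = i*j≡0⇒j≡0 (det x₁ y₁ x₂ y₂ x₃ y₃) det≢0 (begin
      det x₁ y₁ x₂ y₂ x₃ y₃ * β₁
        ≡⟨ solve 9 (λ β₁ β₂ γ x₁ y₁ x₂ y₂ x₃ y₃ →
             let g = λ x y → β₁ :* x :+ β₂ :* y :+ γ in
             ((x₂ :- x₁) :* (y₃ :- y₁) :- (x₃ :- x₁) :* (y₂ :- y₁)) :* β₁ :=
             (g x₂ y₂ :- g x₁ y₁) :* (y₃ :- y₁) :- (g x₃ y₃ :- g x₁ y₁) :* (y₂ :- y₁)) refl β₁ β₂ γ x₁ y₁ x₂ y₂ x₃ y₃ ⟩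
      ((β₁ * x₂ + β₂ * y₂ + γ) - (β₁ * x₁ + β₂ * y₁ + γ)) * (y₃ - y₁) -
        ((β₁ * x₃ + β₂ * y₃ + γ) - (β₁ * x₁ + β₂ * y₁ + γ)) * (y₂ - y₁)
        ≡⟨ cong₂ (λ s t → s * (y₃ - y₁) - t * (y₂ - y₁)) (cong₂ _-_ g₂ g₁) (cong₂ _-_ g₃ g₁) ⟩
      (+ 0) * (y₃ - y₁) - (+ 0) * (y₂ - y₁)
        ≡⟨ solve 2 (λ s t → con (+ 0) :* s :- con (+ 0) :* t := con (+ 0)) refl (y₃ - y₁) (y₂ - y₁) ⟩
      + 0 ∎)
    β₂≡0 : β₂ ≡ + 0
    β₂≡0 = i*j≡0⇒j≡0 (det x₁ y₁ x₂ y₂ x₃ y₃) det≢0 (begin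
      det x₁ y₁ x₂ y₂ x₃ y₃ * β₂
        ≡⟨ solve 9 (λ β₁ β₂ γ x₁ y₁ x₂ y₂ x₃ y₃ →
             let g = λ x y → β₁ :* x :+ β₂ :* y :+ γ in
             ((x₂ :- x₁) :* (y₃ :- y₁) :- (x₃ :- x₁) :* (y₂ :- y₁)) :* β₂ :=
             (g x₃ y₃ :- g x₁ y₁) :* (x₂ :- x₁) :- (g x₂ y₂ :- g x₁ y₁) :* (x₃ :- x₁)) refl β₁ β₂ γ x₁ y₁ x₂ y₂ x₃ y₃ ⟩
      ((β₁ * x₃ + β₂ * y₃ + γ) - (β₁ * x₁ + β₂ * y₁ + γ)) * (x₂ - x₁) -
        ((β₁ * x₂ + β₂ * y₂ + γ) - (β₁ * x₁ + β₂ * y₁ + γ)) * (x₃ - x₁)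
        ≡⟨ cong₂ (λ s t → s * (x₂ - x₁) - t * (x₃ - x₁)) (cong₂ _-_ g₃ g₁) (cong₂ _-_ g₂ g₁) ⟩
      (+ 0) * (x₂ - x₁) - (+ 0) * (x₃ - x₁)
        ≡⟨ solve 2 (λ s t → con (+ 0) :* s :- con (+ 0) :* t := con (+ 0)) refl (x₂ - x₁) (x₃ - x₁) ⟩
      + 0 ∎)
    γ≡0 : γ ≡ + 0
    γ≡0 = begin
      γ  ≡⟨ solve 3 (λ x y γ → γ := con (+ 0) :* x :+ con (+ 0) :* y :+ γ) refl x₁ y₁ γ ⟩
      (+ 0) * x₁ + (+ 0) * y₁ + γ  ≡⟨ cong₂ (λ s t → s * x₁ + t * y₁ + γ) β₁≡0 β₂≡0 ⟨
      β₁ * x₁ + β₂ * y₁ + γ  ≡⟨ g₁ ⟩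
      + 0  ∎

  -- In the orthogonal coordinates s = p x + r y, t = p y − r x attached to the
  -- direction (p , r), a conic through 0 that contains the line t = 0 is
  -- t (B s + C t + n E) up to the factor n², n = p² + r².
  module Line (a b c d e p r : ℤ) where
    n B C E : ℤ
    n = p * p + r * r
    B = b * (p * p - r * r) - + 2 * a * (p * r) + + 2 * c * (p * r)
    C = a * (r * r) - b * (p * r) + c * (p * p)
    E = e * p - d * r

    factor : ∀ x y → n * n * conic a b c d e x y ≡
      quadratic a b c p r * ((p * x + r * y) * (p * x + r * y)) + n * (p * x + r * y) * (d * p + e * r) +
      (p * y - r * x) * ((p * B - r * C) * x + (r * B + p * C) * y + n * E)
    factor = solve 9 (λ a b c d e p r x y →
      let n = p :* p :+ r :* r
          B = b :* (p :* p :- r :* r) :- con (+ 2) :* a :* (p :* r) :+ con (+ 2) :* c :* (p :* r)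
          C = a :* (r :* r) :- b :* (p :* r) :+ c :* (p :* p)
          E = e :* p :- d :* r
          q = λ x y → a :* (x :* x) :+ b :* (x :* y) :+ c :* (y :* y)
      in n :* n :* (q x y :+ (d :* x :+ e :* y)) :=
         q p r :* ((p :* x :+ r :* y) :* (p :* x :+ r :* y)) :+ n :* (p :* x :+ r :* y) :* (d :* p :+ e :* r) :+
         (p :* y :- r :* x) :* ((p :* B :- r :* C) :* x :+ (r :* B :+ p :* C) :* y :+ n :* E)) refl a b c d e p r

    Q L : ℤ
    Q = quadratic a b c p r
    L = d * p + e * r

    coefficients : n * n * a ≡ p * p * Q + - (p * r) * B + r * r * C ×
                   n * n * b ≡ + 2 * (p * r) * Q + (p * p - r * r) * B + - (+ 2 * (p * r)) * C ×
                   n * n * c ≡ r * r * Q + p * r * B + p * p * C ×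
                   n * d ≡ p * L + - r * E ×
                   n * e ≡ r * L + p * E
    coefficients =
      solve 5 (λ a b c p r → let n = n′ p r in n :* n :* a :=
        p :* p :* q a b c p r :+ :- (p :* r) :* B′ a b c p r :+ r :* r :* C′ a b c p r) refl a b c p r ,
      solve 5 (λ a b c p r → let n = n′ p r in n :* n :* b :=
        con (+ 2) :* (p :* r) :* q a b c p r :+ (p :* p :- r :* r) :* B′ a b c p r :+ :- (con (+ 2) :* (p :* r)) :* C′ a b c p r) refl a b c p r ,
      solve 5 (λ a b c p r → let n = n′ p r in n :* n :* c :=
        r :* r :* q a b c p r :+ p :* r :* B′ a b c p r :+ p :* p :* C′ a b c p r) refl a b c p r ,
      solve 4 (λ d e p r → (p :* p :+ r :* r) :* d := p :* (d :* p :+ e :* r) :+ :- r :* (e :* p :- d :* r)) refl d e p r ,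
      solve 4 (λ d e p r → (p :* p :+ r :* r) :* e := r :* (d :* p :+ e :* r) :+ p :* (e :* p :- d :* r)) refl d e p r
      where
      n′ : ∀ {m} → Polynomial m → Polynomial m → Polynomial m
      n′ p r = p :* p :+ r :* r
      q B′ C′ : ∀ {m} → Polynomial m → Polynomial m → Polynomial m → Polynomial m → Polynomial m → Polynomial m
      q a b c p r = a :* (p :* p) :+ b :* (p :* r) :+ c :* (r :* r)
      B′ a b c p r = b :* (p :* p :- r :* r) :- con (+ 2) :* a :* (p :* r) :+ con (+ 2) :* c :* (p :* r)
      C′ a b c p r = a :* (r :* r) :- b :* (p :* r) :+ c :* (p :* p)

  combine₂ : ∀ k₁ k₂ {i j} → i ≡ + 0 → j ≡ + 0 → k₁ * i + k₂ * j ≡ + 0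
  combine₂ k₁ k₂ refl refl = cong₂ _+_ (ℤ.*-zeroʳ k₁) (ℤ.*-zeroʳ k₂)

  combine₃ : ∀ k₁ k₂ k₃ {i j l} → i ≡ + 0 → j ≡ + 0 → l ≡ + 0 → k₁ * i + k₂ * j + k₃ * l ≡ + 0
  combine₃ k₁ k₂ k₃ i≡0 j≡0 refl = cong₂ _+_ (combine₂ k₁ k₂ i≡0 j≡0) (ℤ.*-zeroʳ k₃)

  -- The two conditions at `(p , r)` say that the conic contains the line through 0 and `(p , r)`.
  -- The conic is then this line times an affine form, which vanishes at three noncollinear points
  -- off the line and therefore identically.
  conic≡0 : ∀ a b c d e p r x₁ y₁ x₂ y₂ x₃ y₃ →
    quadratic a b c p r ≡ + 0 → conic a b c d e p r ≡ + 0 →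
    conic a b c d e x₁ y₁ ≡ + 0 → conic a b c d e x₂ y₂ ≡ + 0 → conic a b c d e x₃ y₃ ≡ + 0 →
    p * y₁ - r * x₁ ≢ + 0 → p * y₂ - r * x₂ ≢ + 0 → p * y₃ - r * x₃ ≢ + 0 → det x₁ y₁ x₂ y₂ x₃ y₃ ≢ + 0 →
    a ≡ + 0 × b ≡ + 0 × c ≡ + 0 × d ≡ + 0 × e ≡ + 0
  conic≡0 a b c d e p r x₁ y₁ x₂ y₂ x₃ y₃ Q≡0 cpr c₁ c₂ c₃ t₁≢0 t₂≢0 t₃≢0 det≢0 =
    let a≡ , b≡ , c≡ , d≡ , e≡ = coefficients in
    i*j≡0⇒j≡0 (n * n) nn≢0 (trans a≡ (combine₃ (p * p) (- (p * r)) (r * r) Q≡0 B≡0 C≡0)) ,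
    i*j≡0⇒j≡0 (n * n) nn≢0 (trans b≡ (combine₃ (+ 2 * (p * r)) (p * p - r * r) (- (+ 2 * (p * r))) Q≡0 B≡0 C≡0)) ,
    i*j≡0⇒j≡0 (n * n) nn≢0 (trans c≡ (combine₃ (r * r) (p * r) (p * p) Q≡0 B≡0 C≡0)) ,
    i*j≡0⇒j≡0 n n≢0 (trans d≡ (combine₂ p (- r) L≡0 E≡0)) ,
    i*j≡0⇒j≡0 n n≢0 (trans e≡ (combine₂ r p L≡0 E≡0))
    where
    open Line a b c d e p r
    n≢0 : n ≢ + 0
    n≢0 n≡0 = t₁≢0 (trans (cong₂ (λ p r → p * y₁ - r * x₁) p≡0 r≡0)
        (solve 2 (λ x y → con (+ 0) :* y :- con (+ 0) :* x := con (+ 0)) refl x₁ y₁))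
      where
      p≡0 : p ≡ + 0
      p≡0 = i*i≡0⇒i≡0 p (i+j≡0⇒i≡0 (i*i-nonNeg p) (i*i-nonNeg r) n≡0)
      r≡0 : r ≡ + 0
      r≡0 = i*i≡0⇒i≡0 r (i+j≡0⇒i≡0 (i*i-nonNeg r) (i*i-nonNeg p) (trans (ℤ.+-comm (r * r) (p * p)) n≡0))
    nn≢0 : n * n ≢ + 0
    nn≢0 = i*j≢0 n≢0 n≢0
    L≡0 : L ≡ + 0
    L≡0 = trans (trans (sym (ℤ.+-identityˡ L)) (cong (_+ L) (sym Q≡0))) cpr
    β₁ β₂ : ℤ
    β₁ = p * B - r * C
    β₂ = r * B + p * C
    on-line : ∀ x y → conic a b c d e x y ≡ + 0 → p * y - r * x ≢ + 0 → β₁ * x + β₂ * y + n * E ≡ + 0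
    on-line x y c≡0 t≢0 = i*j≡0⇒j≡0 (p * y - r * x) t≢0 (begin
      t * G  ≡⟨ solve 3 (λ tG k l → tG := con (+ 0) :* k :+ l :* con (+ 0) :+ tG) refl (t * G) (s * s) (n * s) ⟩
      (+ 0) * (s * s) + n * s * (+ 0) + t * G  ≡⟨ cong₂ (λ i j → i * (s * s) + n * s * j + t * G) Q≡0 L≡0 ⟨
      Q * (s * s) + n * s * L + t * G  ≡⟨ factor x y ⟨
      n * n * conic a b c d e x y  ≡⟨ cong (n * n *_) c≡0 ⟩
      n * n * + 0  ≡⟨ ℤ.*-zeroʳ (n * n) ⟩
      + 0  ∎)
      where
      s = p * x + r * y
      t = p * y - r * x
      G = β₁ * x + β₂ * y + n * E
    zeros : β₁ ≡ + 0 × β₂ ≡ + 0 × n * E ≡ + 0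
    zeros = affine≡0 β₁ β₂ (n * E) x₁ y₁ x₂ y₂ x₃ y₃ det≢0 (on-line x₁ y₁ c₁ t₁≢0) (on-line x₂ y₂ c₂ t₂≢0) (on-line x₃ y₃ c₃ t₃≢0)
    β₁≡0 = proj₁ zeros
    β₂≡0 = proj₁ (proj₂ zeros)
    E≡0 : E ≡ + 0
    E≡0 = i*j≡0⇒j≡0 n n≢0 (proj₂ (proj₂ zeros))
    B≡0 : B ≡ + 0
    B≡0 = i*j≡0⇒j≡0 n n≢0 (trans
      (solve 4 (λ p r B C → (p :* p :+ r :* r) :* B := p :* (p :* B :- r :* C) :+ r :* (r :* B :+ p :* C)) refl p r B C)
      (combine₂ p r β₁≡0 β₂≡0))
    C≡0 : C ≡ + 0
    C≡0 = i*j≡0⇒j≡0 n n≢0 (trans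
      (solve 4 (λ p r B C → (p :* p :+ r :* r) :* C := :- r :* (p :* B :- r :* C) :+ p :* (r :* B :+ p :* C)) refl p r B C)
      (combine₂ (- r) p β₁≡0 β₂≡0))

  -- If P₁ = 0, P₂ = (p , r), P₃, P₄, P₅ lie on two conics, the member l F₁ + m F₂
  -- of the pencil with l = q₂ (p , r), m = − q₁ (p , r) contains the line P₁P₂.
  pencil≡0 : ∀ a b c d e a′ b′ c′ d′ e′ p r x₁ y₁ x₂ y₂ x₃ y₃ →
    conic a b c d e p r ≡ + 0 → conic a b c d e x₁ y₁ ≡ + 0 → conic a b c d e x₂ y₂ ≡ + 0 → conic a b c d e x₃ y₃ ≡ + 0 →
    conic a′ b′ c′ d′ e′ p r ≡ + 0 → conic a′ b′ c′ d′ e′ x₁ y₁ ≡ + 0 → conic a′ b′ c′ d′ e′ x₂ y₂ ≡ + 0 → conic a′ b′ c′ d′ e′ x₃ y₃ ≡ + 0 →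
    p * y₁ - r * x₁ ≢ + 0 → p * y₂ - r * x₂ ≢ + 0 → p * y₃ - r * x₃ ≢ + 0 → det x₁ y₁ x₂ y₂ x₃ y₃ ≢ + 0 →
    let l = quadratic a′ b′ c′ p r ; m = - quadratic a b c p r in
    l * a + m * a′ ≡ + 0 × l * b + m * b′ ≡ + 0 × l * c + m * c′ ≡ + 0 × l * d + m * d′ ≡ + 0 × l * e + m * e′ ≡ + 0
  pencil≡0 a b c d e a′ b′ c′ d′ e′ p r x₁ y₁ x₂ y₂ x₃ y₃ v₀ v₁ v₂ v₃ v₀′ v₁′ v₂′ v₃′ =
    conic≡0 (l * a + m * a′) (l * b + m * b′) (l * c + m * c′) (l * d + m * d′) (l * e + m * e′) p r x₁ y₁ x₂ y₂ x₃ y₃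
      q≡0 (on p r v₀ v₀′) (on x₁ y₁ v₁ v₁′) (on x₂ y₂ v₂ v₂′) (on x₃ y₃ v₃ v₃′)
    where
    l = quadratic a′ b′ c′ p r
    m = - quadratic a b c p r
    q≡0 : quadratic (l * a + m * a′) (l * b + m * b′) (l * c + m * c′) p r ≡ + 0
    q≡0 = solve 8 (λ a b c a′ b′ c′ p r →
      let q = λ a b c → a :* (p :* p) :+ b :* (p :* r) :+ c :* (r :* r)
          l = q a′ b′ c′
          m = :- q a b c
      in q (l :* a :+ m :* a′) (l :* b :+ m :* b′) (l :* c :+ m :* c′) := con (+ 0)) refl a b c a′ b′ c′ p r
    on : ∀ x y → conic a b c d e x y ≡ + 0 → conic a′ b′ c′ d′ e′ x y ≡ + 0 →
         conic (l * a + m * a′) (l * b + m * b′) (l * c + m * c′) (l * d + m * d′) (l * e + m * e′) x y ≡ + 0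
    on x y h h′ = trans (expand l m) (combine₂ l m h h′)
      where
      expand : ∀ l m → conic (l * a + m * a′) (l * b + m * b′) (l * c + m * c′) (l * d + m * d′) (l * e + m * e′) x y ≡
                       l * conic a b c d e x y + m * conic a′ b′ c′ d′ e′ x y
      expand l m = trans (cong₂ _+_
        (solve 10 (λ l m a b c a′ b′ c′ x y →
          let q = λ a b c → a :* (x :* x) :+ b :* (x :* y) :+ c :* (y :* y)
          in q (l :* a :+ m :* a′) (l :* b :+ m :* b′) (l :* c :+ m :* c′) := l :* q a b c :+ m :* q a′ b′ c′) refl l m a b c a′ b′ c′ x y)
        (solve 8 (λ l m d e d′ e′ x y →
          (l :* d :+ m :* d′) :* x :+ (l :* e :+ m :* e′) :* y := l :* (d :* x :+ e :* y) :+ m :* (d′ :* x :+ e′ :* y)) refl l m d e d′ e′ x y))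
        (solve 6 (λ l m q q′ k k′ → (l :* q :+ m :* q′) :+ (l :* k :+ m :* k′) := l :* (q :+ k) :+ m :* (q′ :+ k′)) refl
          l m (quadratic a b c x y) (quadratic a′ b′ c′ x y) (d * x + e * y) (d′ * x + e′ * y))

  -- The central conic α x² + β x y + γ y² = c in the coordinates 2 P − S
  record Central : Set where
    field
      α β γ c S₁ S₂ : ℤ

    centred : ℤ → ℤ → ℤ
    centred X Y = quadratic α β γ (+ 2 * X - S₁) (+ 2 * Y - S₂)

    discriminant : ℤ
    discriminant = + 4 * (α * γ) - β * β

    On : ℤ → ℤ → Set
    On X Y = centred X Y ≡ c

    module At (X₀ Y₀ : ℤ) where
      d e : ℤ
      d = + 4 * α * (+ 2 * X₀ - S₁) + + 2 * β * (+ 2 * Y₀ - S₂)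
      e = + 2 * β * (+ 2 * X₀ - S₁) + + 4 * γ * (+ 2 * Y₀ - S₂)

      -- The equations at the two points are subtracted, which eliminates `c` and gives a conic
      -- through 0. The factors 4 and 2 in its coefficients come from the doubled coordinates
      -- `2 P − S`.
      translate : ∀ X Y → On X₀ Y₀ → On X Y → conic (+ 4 * α) (+ 4 * β) (+ 4 * γ) d e (X - X₀) (Y - Y₀) ≡ + 0
      translate X Y o₀ o = begin
        conic (+ 4 * α) (+ 4 * β) (+ 4 * γ) d e (X - X₀) (Y - Y₀)
          ≡⟨ solve 7 (λ α β γ w₁ w₂ x y →
               let q = λ α β γ x y → α :* (x :* x) :+ β :* (x :* y) :+ γ :* (y :* y)
                   d = con (+ 4) :* α :* w₁ :+ con (+ 2) :* β :* w₂
                   e = con (+ 2) :* β :* w₁ :+ con (+ 4) :* γ :* w₂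
               in q (con (+ 4) :* α) (con (+ 4) :* β) (con (+ 4) :* γ) x y :+ (d :* x :+ e :* y) :=
                  q α β γ (w₁ :+ con (+ 2) :* x) (w₂ :+ con (+ 2) :* y) :- q α β γ w₁ w₂)
               refl α β γ (+ 2 * X₀ - S₁) (+ 2 * Y₀ - S₂) (X - X₀) (Y - Y₀) ⟩
        quadratic α β γ (+ 2 * X₀ - S₁ + + 2 * (X - X₀)) (+ 2 * Y₀ - S₂ + + 2 * (Y - Y₀)) - centred X₀ Y₀
          ≡⟨ cong₂ (λ x y → quadratic α β γ x y - centred X₀ Y₀) (shift X X₀ S₁) (shift Y Y₀ S₂) ⟩
        centred X Y - centred X₀ Y₀
          ≡⟨ cong₂ _-_ o o₀ ⟩
        c - c
          ≡⟨ ℤ.+-inverseʳ c ⟩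
        + 0 ∎
        where
        shift : ∀ X X₀ S → + 2 * X₀ - S + + 2 * (X - X₀) ≡ + 2 * X - S
        shift = solve 3 (λ X X₀ S → con (+ 2) :* X₀ :- S :+ con (+ 2) :* (X :- X₀) := con (+ 2) :* X :- S) refl

  record FivePoints : Set where
    field
      X₀ Y₀ X₁ Y₁ X₂ Y₂ X₃ Y₃ X₄ Y₄ : ℤ
      det₀₁₂ : det X₀ Y₀ X₁ Y₁ X₂ Y₂ ≢ + 0
      det₀₁₃ : det X₀ Y₀ X₁ Y₁ X₃ Y₃ ≢ + 0
      det₀₁₄ : det X₀ Y₀ X₁ Y₁ X₄ Y₄ ≢ + 0
      det₂₃₄ : det X₂ Y₂ X₃ Y₃ X₄ Y₄ ≢ + 0

    AllOn : Central → Set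
    AllOn K = On X₀ Y₀ × On X₁ Y₁ × On X₂ Y₂ × On X₃ Y₃ × On X₄ Y₄
      where open Central K

    p r x₂ y₂ x₃ y₃ x₄ y₄ : ℤ
    p = X₁ - X₀
    r = Y₁ - Y₀
    x₂ = X₂ - X₀
    y₂ = Y₂ - Y₀
    x₃ = X₃ - X₀
    y₃ = Y₃ - Y₀
    x₄ = X₄ - X₀
    y₄ = Y₄ - Y₀

    off-line : ∀ X Y → det X₀ Y₀ X₁ Y₁ X Y ≢ + 0 → p * (Y - Y₀) - r * (X - X₀) ≢ + 0
    off-line X Y det≢0 eq = det≢0 (trans (cong (λ t → p * (Y - Y₀) - t) (ℤ.*-comm (X - X₀) r)) eq)

    det-shift : det x₂ y₂ x₃ y₃ x₄ y₄ ≢ + 0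
    det-shift eq = det₂₃₄ (trans (solve 8 (λ X₀ Y₀ X₂ Y₂ X₃ Y₃ X₄ Y₄ →
      let det = λ x₁ y₁ x₂ y₂ x₃ y₃ → (x₂ :- x₁) :* (y₃ :- y₁) :- (x₃ :- x₁) :* (y₂ :- y₁)
      in det X₂ Y₂ X₃ Y₃ X₄ Y₄ := det (X₂ :- X₀) (Y₂ :- Y₀) (X₃ :- X₀) (Y₃ :- Y₀) (X₄ :- X₀) (Y₄ :- Y₀))
      refl X₀ Y₀ X₂ Y₂ X₃ Y₃ X₄ Y₄) eq)

    -- Otherwise the line P₀P₁ would be contained in the conic.
    chord≢0 : ∀ K → let open Central K in discriminant ≢ + 0 → AllOn K → quadratic (+ 4 * α) (+ 4 * β) (+ 4 * γ) p r ≢ + 0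
    chord≢0 K disc≢0 (o₀ , o₁ , o₂ , o₃ , o₄) q≡0 =
      let α≡0 , β≡0 , γ≡0 , _ = conic≡0 (+ 4 * α) (+ 4 * β) (+ 4 * γ) d e p r x₂ y₂ x₃ y₃ x₄ y₄ q≡0
            (translate X₁ Y₁ o₀ o₁) (translate X₂ Y₂ o₀ o₂) (translate X₃ Y₃ o₀ o₃) (translate X₄ Y₄ o₀ o₄)
            (off-line X₂ Y₂ det₀₁₂) (off-line X₃ Y₃ det₀₁₃) (off-line X₄ Y₄ det₀₁₄) det-shift
      in disc≢0 (trans (cong₂ (λ a b → + 4 * (a * γ) - b * b) (i*j≡0⇒j≡0 (+ 4) (λ ()) α≡0) (i*j≡0⇒j≡0 (+ 4) (λ ()) β≡0))
           (solve 1 (λ γ → con (+ 4) :* (con (+ 0) :* γ) :- con (+ 0) :* con (+ 0) := con (+ 0)) refl γ))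
      where
      open Central K
      open At X₀ Y₀

    module TwoConics (K K′ : Central) (on : AllOn K) (on′ : AllOn K′)
      (disc≢0 : Central.discriminant K ≢ + 0) (disc≢0′ : Central.discriminant K′ ≢ + 0) where
      open Central K
      open At X₀ Y₀
      open Central K′ using () renaming (α to α′; β to β′; γ to γ′; c to c′; S₁ to S₁′; S₂ to S₂′; discriminant to discriminant′)
      open Central.At K′ X₀ Y₀ using () renaming (d to d′; e to e′; translate to translate′)

      l m : ℤ
      l = quadratic (+ 4 * α′) (+ 4 * β′) (+ 4 * γ′) p r
      m = - quadratic (+ 4 * α) (+ 4 * β) (+ 4 * γ) p r

      l≢0 : l ≢ + 0
      l≢0 = chord≢0 K′ disc≢0′ on′

      m≢0 : m ≢ + 0
      m≢0 m≡0 = chord≢0 K disc≢0 on (ℤ.neg-injective m≡0)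

      relations : l * (+ 4 * α) + m * (+ 4 * α′) ≡ + 0 × l * (+ 4 * β) + m * (+ 4 * β′) ≡ + 0 ×
                  l * (+ 4 * γ) + m * (+ 4 * γ′) ≡ + 0 × l * d + m * d′ ≡ + 0 × l * e + m * e′ ≡ + 0
      relations = let (o₀ , o₁ , o₂ , o₃ , o₄) = on ; (o₀′ , o₁′ , o₂′ , o₃′ , o₄′) = on′ in
        pencil≡0 (+ 4 * α) (+ 4 * β) (+ 4 * γ) d e (+ 4 * α′) (+ 4 * β′) (+ 4 * γ′) d′ e′ p r x₂ y₂ x₃ y₃ x₄ y₄
          (translate X₁ Y₁ o₀ o₁) (translate X₂ Y₂ o₀ o₂) (translate X₃ Y₃ o₀ o₃) (translate X₄ Y₄ o₀ o₄)
          (translate′ X₁ Y₁ o₀′ o₁′) (translate′ X₂ Y₂ o₀′ o₂′) (translate′ X₃ Y₃ o₀′ o₃′) (translate′ X₄ Y₄ o₀′ o₄′)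
          (off-line X₂ Y₂ det₀₁₂) (off-line X₃ Y₃ det₀₁₃) (off-line X₄ Y₄ det₀₁₄) det-shift

      cancel-4 : ∀ i j → l * (+ 4 * i) + m * (+ 4 * j) ≡ + 0 → l * i + m * j ≡ + 0
      cancel-4 i j eq = i*j≡0⇒j≡0 (+ 4) (λ ()) (trans
        (solve 4 (λ l m i j → con (+ 4) :* (l :* i :+ m :* j) := l :* (con (+ 4) :* i) :+ m :* (con (+ 4) :* j)) refl l m i j) eq)

      rα : l * α + m * α′ ≡ + 0
      rα = cancel-4 α α′ (proj₁ relations)
      rβ : l * β + m * β′ ≡ + 0
      rβ = cancel-4 β β′ (proj₁ (proj₂ relations))
      rγ : l * γ + m * γ′ ≡ + 0
      rγ = cancel-4 γ γ′ (proj₁ (proj₂ (proj₂ relations)))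

      δ₁ δ₂ w₁ w₂ : ℤ
      δ₁ = S₁ - S₁′
      δ₂ = S₂ - S₂′
      w₁ = + 2 * X₀ - S₁
      w₂ = + 2 * Y₀ - S₂

      w+δ : ∀ X S S′ → + 2 * X - S′ ≡ (+ 2 * X - S) + (S - S′)
      w+δ = solve 3 (λ X S S′ → con (+ 2) :* X :- S′ := (con (+ 2) :* X :- S) :+ (S :- S′)) refl

      -- The vector `(d , e)` is twice the gradient of the quadratic form at `w = 2 P₀ − S`. As the
      -- quadratic forms already satisfy the relation with `l` and `m`, the contributions at `w`
      -- cancel, and the gradient of the second form at `δ = S − S′` remains. Thus `gd` and `ge` are
      -- a homogeneous linear system for `δ` with determinant four times `discriminant′`.
      gradient : ∀ k k′ a b a′ b′ → l * a + m * a′ ≡ + 0 → l * b + m * b′ ≡ + 0 →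
        l * (k * a * w₁ + k′ * b * w₂) + m * (k * a′ * (+ 2 * X₀ - S₁′) + k′ * b′ * (+ 2 * Y₀ - S₂′)) ≡ + 0 →
        k * a′ * δ₁ + k′ * b′ * δ₂ ≡ + 0
      gradient k k′ a b a′ b′ ra rb eq = i*j≡0⇒j≡0 m m≢0 (begin
        m * (k * a′ * δ₁ + k′ * b′ * δ₂)
          ≡⟨ expand l m ⟩
        (l * (k * a * w₁ + k′ * b * w₂) + m * (k * a′ * (w₁ + δ₁) + k′ * b′ * (w₂ + δ₂))) +
          ((- (k * w₁)) * (l * a + m * a′) + (- (k′ * w₂)) * (l * b + m * b′))
          ≡⟨ cong₂ _+_ (trans (cong₂ (λ s t → l * (k * a * w₁ + k′ * b * w₂) + m * (k * a′ * s + k′ * b′ * t))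
               (sym (w+δ X₀ S₁ S₁′)) (sym (w+δ Y₀ S₂ S₂′))) eq) (combine₂ (- (k * w₁)) (- (k′ * w₂)) ra rb) ⟩
        + 0 ∎)
        where
        part : ∀ l m k a a′ w δ → m * (k * a′ * δ) ≡ (l * (k * a * w) + m * (k * a′ * (w + δ))) + (- (k * w)) * (l * a + m * a′)
        part = solve 7 (λ l m k a a′ w δ → m :* (k :* a′ :* δ) :=
          (l :* (k :* a :* w) :+ m :* (k :* a′ :* (w :+ δ))) :+ (:- (k :* w)) :* (l :* a :+ m :* a′)) refl
        expand : ∀ l m → m * (k * a′ * δ₁ + k′ * b′ * δ₂) ≡
          (l * (k * a * w₁ + k′ * b * w₂) + m * (k * a′ * (w₁ + δ₁) + k′ * b′ * (w₂ + δ₂))) +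
          ((- (k * w₁)) * (l * a + m * a′) + (- (k′ * w₂)) * (l * b + m * b′))
        expand l m = trans (ℤ.*-distribˡ-+ m (k * a′ * δ₁) (k′ * b′ * δ₂))
          (trans (cong₂ _+_ (part l m k a a′ w₁ δ₁) (part l m k′ b b′ w₂ δ₂))
          (solve 8 (λ l m A B A′ B′ s t → ((l :* A :+ m :* A′) :+ s) :+ ((l :* B :+ m :* B′) :+ t) :=
            (l :* (A :+ B) :+ m :* (A′ :+ B′)) :+ (s :+ t)) refl
            l m (k * a * w₁) (k′ * b * w₂) (k * a′ * (w₁ + δ₁)) (k′ * b′ * (w₂ + δ₂))
            ((- (k * w₁)) * (l * a + m * a′)) ((- (k′ * w₂)) * (l * b + m * b′))))

      gd : + 4 * α′ * δ₁ + + 2 * β′ * δ₂ ≡ + 0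
      gd = gradient (+ 4) (+ 2) α β α′ β′ rα rβ (proj₁ (proj₂ (proj₂ (proj₂ relations))))

      ge : + 2 * β′ * δ₁ + + 4 * γ′ * δ₂ ≡ + 0
      ge = gradient (+ 2) (+ 4) β γ β′ γ′ rβ rγ (proj₂ (proj₂ (proj₂ (proj₂ relations))))

      same-centre₁ : S₁ ≡ S₁′
      same-centre₁ = ℤ.i-j≡0⇒i≡j S₁ S₁′ (i*j≡0⇒j≡0 (+ 2) (λ ()) (i*j≡0⇒j≡0 discriminant′ disc≢0′ (trans
        (solve 5 (λ α β γ x y → (con (+ 4) :* (α :* γ) :- β :* β) :* (con (+ 2) :* x) :=
          con (+ 2) :* γ :* (con (+ 4) :* α :* x :+ con (+ 2) :* β :* y) :+ :- β :* (con (+ 2) :* β :* x :+ con (+ 4) :* γ :* y))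
          refl α′ β′ γ′ δ₁ δ₂)
        (combine₂ (+ 2 * γ′) (- β′) gd ge))))

      same-centre₂ : S₂ ≡ S₂′
      same-centre₂ = ℤ.i-j≡0⇒i≡j S₂ S₂′ (i*j≡0⇒j≡0 (+ 2) (λ ()) (i*j≡0⇒j≡0 discriminant′ disc≢0′ (trans
        (solve 5 (λ α β γ x y → (con (+ 4) :* (α :* γ) :- β :* β) :* (con (+ 2) :* y) :=
          :- β :* (con (+ 4) :* α :* x :+ con (+ 2) :* β :* y) :+ con (+ 2) :* α :* (con (+ 2) :* β :* x :+ con (+ 4) :* γ :* y))
          refl α′ β′ γ′ δ₁ δ₂)
        (combine₂ (- β′) (+ 2 * α′) gd ge))))

      rc : l * c + m * c′ ≡ + 0
      rc = begin
        l * c + m * c′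
          ≡⟨ cong₂ (λ s t → l * s + m * t) (proj₁ on) (proj₁ on′) ⟨
        l * quadratic α β γ w₁ w₂ + m * quadratic α′ β′ γ′ (+ 2 * X₀ - S₁′) (+ 2 * Y₀ - S₂′)
          ≡⟨ cong₂ (λ s t → l * quadratic α β γ w₁ w₂ + m * quadratic α′ β′ γ′ (+ 2 * X₀ - s) (+ 2 * Y₀ - t)) same-centre₁ same-centre₂ ⟨
        l * quadratic α β γ w₁ w₂ + m * quadratic α′ β′ γ′ w₁ w₂
          ≡⟨ expand l m w₁ w₂ ⟩
        w₁ * w₁ * (l * α + m * α′) + w₁ * w₂ * (l * β + m * β′) + w₂ * w₂ * (l * γ + m * γ′)
          ≡⟨ combine₃ (w₁ * w₁) (w₁ * w₂) (w₂ * w₂) rα rβ rγ ⟩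
        + 0 ∎
        where
        expand : ∀ l m w₁ w₂ → l * quadratic α β γ w₁ w₂ + m * quadratic α′ β′ γ′ w₁ w₂ ≡
          w₁ * w₁ * (l * α + m * α′) + w₁ * w₂ * (l * β + m * β′) + w₂ * w₂ * (l * γ + m * γ′)
        expand l m w₁ w₂ = solve 10 (λ l m α β γ α′ β′ γ′ w₁ w₂ →
          let q = λ α β γ x y → α :* (x :* x) :+ β :* (x :* y) :+ γ :* (y :* y)
          in l :* q α β γ w₁ w₂ :+ m :* q α′ β′ γ′ w₁ w₂ :=
             w₁ :* w₁ :* (l :* α :+ m :* α′) :+ w₁ :* w₂ :* (l :* β :+ m :* β′) :+ w₂ :* w₂ :* (l :* γ :+ m :* γ′))
          refl l m α β γ α′ β′ γ′ w₁ w₂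

      -- The constants `c`, `c′` obey the same relation (`rc`), because both conics pass through P₀
      -- and have the same centre; `l` and `m` are eliminated against it.
      proportional : ∀ i j → l * i + m * j ≡ + 0 → i * c′ ≡ j * c
      proportional i j eq = ℤ.i-j≡0⇒i≡j (i * c′) (j * c) (i*j≡0⇒j≡0 l l≢0 (trans
        (expand l m) (combine₂ c′ (- j) eq rc)))
        where
        expand : ∀ l m → l * (i * c′ - j * c) ≡ c′ * (l * i + m * j) + (- j) * (l * c + m * c′)
        expand l m = solve 6 (λ l m i j c c′ → l :* (i :* c′ :- j :* c) := c′ :* (l :* i :+ m :* j) :+ :- j :* (l :* c :+ m :* c′)) refl l m i j c c′

i*j≡i*k⇒j≡k : ∀ i {j k} → i ≢ + 0 → i ℤ.* j ≡ i ℤ.* k → j ≡ k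
i*j≡i*k⇒j≡k i {j} {k} i≢0 eq = ℤ.i-j≡0⇒i≡j j k (i*j≡0⇒j≡0 i i≢0 (trans
  (ℤS.solve 3 (λ i j k → i :* (j :- k) := i :* j :- i :* k) refl i j k)
  (trans (cong (ℤ._- i ℤ.* k) eq) (ℤ.+-inverseʳ (i ℤ.* k)))))
  where open ℤS

-- Recovering the foci of a hyperbola from its equation

module Hyperbolas (N : ℤ) (0<N : + 0 ℤ.< N) where
  open import Data.Integer.Base using (_+_; _*_; _-_; -_)
  open Conics
  open ℤS
  open ≡-Reasoning

  N≢0 : N ≢ + 0
  N≢0 N≡0 = ℤ.<-irrefl (sym N≡0) 0<N

  norm : ℤ → ℤ → ℤ
  norm x y = N * (x * x) + y * y

  -- With respect to the form N x² + y², the points P for which the distances to the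
  -- foci (S ± u) / 2 differ by √H satisfy ⟨u , 2 P − S⟩² − H |2 P − S|² = H (|u|² − H).
  hyperbola : (u₁ u₂ S₁ S₂ H : ℤ) → Central
  hyperbola u₁ u₂ S₁ S₂ H = record
    { α  = N * u₁ * (N * u₁) - H * N
    ; β  = + 2 * N * (u₁ * u₂)
    ; γ  = u₂ * u₂ - H
    ; c  = H * (norm u₁ u₂ - H)
    ; S₁ = S₁
    ; S₂ = S₂
    }

  -- The discriminant is quadratic in the coefficients of a conic and `c` is linear, so this
  -- relation fixes the scaling of the equation. It also shows that the conic is nondegenerate when
  -- `c ≢ 0`.
  discriminant-hyperbola : ∀ u₁ u₂ S₁ S₂ H → let open Central (hyperbola u₁ u₂ S₁ S₂ H) in
    discriminant ≡ - (+ 4) * N * c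
  discriminant-hyperbola u₁ u₂ S₁ S₂ H = solve 4 (λ N u₁ u₂ H →
    con (+ 4) :* ((N :* u₁ :* (N :* u₁) :- H :* N) :* (u₂ :* u₂ :- H)) :- con (+ 2) :* N :* (u₁ :* u₂) :* (con (+ 2) :* N :* (u₁ :* u₂)) :=
    :- con (+ 4) :* N :* (H :* ((N :* (u₁ :* u₁) :+ u₂ :* u₂) :- H))) refl N u₁ u₂ H

  discriminant≢0 : ∀ u₁ u₂ S₁ S₂ H → let open Central (hyperbola u₁ u₂ S₁ S₂ H) in c ≢ + 0 → discriminant ≢ + 0
  discriminant≢0 u₁ u₂ S₁ S₂ H c≢0 eq =
    i*j≢0 (i*j≢0 {i = - (+ 4)} (λ ()) N≢0) c≢0 (trans (sym (discriminant-hyperbola u₁ u₂ S₁ S₂ H)) eq)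

  on-hyperbola : ∀ u₁ u₂ S₁ S₂ κ a b X Y → let H = κ * ((a - b) * (a - b)) in
    N * u₁ * (+ 2 * X - S₁) + u₂ * (+ 2 * Y - S₂) ≡ κ * (a * a) - κ * (b * b) →
    norm (+ 2 * X - S₁) (+ 2 * Y - S₂) ≡ + 2 * (κ * (a * a)) + + 2 * (κ * (b * b)) - norm u₁ u₂ →
    Central.On (hyperbola u₁ u₂ S₁ S₂ H) X Y
  on-hyperbola u₁ u₂ S₁ S₂ κ a b X Y bil nrm = begin
    quadratic (N * u₁ * (N * u₁) - H * N) (+ 2 * N * (u₁ * u₂)) (u₂ * u₂ - H) x y
      ≡⟨ expand x y H ⟩
    (N * u₁ * x + u₂ * y) * (N * u₁ * x + u₂ * y) - H * norm x y
      ≡⟨ cong₂ (λ s t → s * s - H * t) bil nrm ⟩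
    (κ * (a * a) - κ * (b * b)) * (κ * (a * a) - κ * (b * b)) - H * (+ 2 * (κ * (a * a)) + + 2 * (κ * (b * b)) - norm u₁ u₂)
      ≡⟨ solve 4 (λ κ a b U → let H = κ :* ((a :- b) :* (a :- b)) in
           (κ :* (a :* a) :- κ :* (b :* b)) :* (κ :* (a :* a) :- κ :* (b :* b)) :-
             H :* (con (+ 2) :* (κ :* (a :* a)) :+ con (+ 2) :* (κ :* (b :* b)) :- U) := H :* (U :- H)) refl κ a b (norm u₁ u₂) ⟩
    H * (norm u₁ u₂ - H) ∎
    where
    H x y : ℤ
    H = κ * ((a - b) * (a - b))
    x = + 2 * X - S₁
    y = + 2 * Y - S₂
    expand : ∀ x y H → quadratic (N * u₁ * (N * u₁) - H * N) (+ 2 * N * (u₁ * u₂)) (u₂ * u₂ - H) x y ≡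
                     (N * u₁ * x + u₂ * y) * (N * u₁ * x + u₂ * y) - H * norm x y
    expand x y H = solve 6 (λ N u₁ u₂ H x y →
      (N :* u₁ :* (N :* u₁) :- H :* N) :* (x :* x) :+ con (+ 2) :* N :* (u₁ :* u₂) :* (x :* y) :+ (u₂ :* u₂ :- H) :* (y :* y) :=
      (N :* u₁ :* x :+ u₂ :* y) :* (N :* u₁ :* x :+ u₂ :* y) :- H :* (N :* (x :* x) :+ y :* y)) refl N u₁ u₂ H x y

  -- Comparing discriminants, the factor between proportional hyperbolas is 1.
  module SameFoci (u₁ u₂ H v₁ v₂ H′ : ℤ) (0<U : + 0 ℤ.< norm u₁ u₂) where
    -- `α`, `β`, `γ` and `c` do not depend on the centre, so 0 stands for any centre.
    open Central (hyperbola u₁ u₂ (+ 0) (+ 0) H)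
    open Central (hyperbola v₁ v₂ (+ 0) (+ 0) H′) using () renaming (α to α′; β to β′; γ to γ′; c to c′; discriminant to discriminant′)

    -- The product equals `(|v|² − |u|²)² + 4 N (u₁ v₂ − u₂ v₁)²`, so it suffices that `u₁²`, `u₂²`
    -- and `u₁ u₂` agree with their counterparts for `v`. Comparing `α` and `γ` eliminates the
    -- unknown `H` and `H′` and leaves `N u₁² − u₂²`; together with `u₁ u₂` from `β` this determines
    -- the square of the complex number `√N u₁ + i u₂`, hence the number up to sign.
    u≡±v : c ≢ + 0 → c′ ≢ + 0 → α * c′ ≡ α′ * c → β * c′ ≡ β′ * c → γ * c′ ≡ γ′ * c →
           norm (v₁ - u₁) (v₂ - u₂) * norm (v₁ + u₁) (v₂ + u₂) ≡ + 0
    u≡±v c≢0 c′≢0 pα pβ pγ = begin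
      norm (v₁ - u₁) (v₂ - u₂) * norm (v₁ + u₁) (v₂ + u₂)
        ≡⟨ solve 5 (λ N u₁ u₂ v₁ v₂ →
             let n = λ x y → N :* (x :* x) :+ y :* y
             in n (v₁ :- u₁) (v₂ :- u₂) :* n (v₁ :+ u₁) (v₂ :+ u₂) :=
                (n v₁ v₂ :- n u₁ u₂) :* (n v₁ v₂ :- n u₁ u₂) :+
                con (+ 4) :* N :* (u₁ :* u₁ :* (v₂ :* v₂) :+ u₂ :* u₂ :* (v₁ :* v₁) :- con (+ 2) :* (u₁ :* u₂ :* (v₁ :* v₂))))
             refl N u₁ u₂ v₁ v₂ ⟩
      (norm v₁ v₂ - norm u₁ u₂) * (norm v₁ v₂ - norm u₁ u₂) +
        + 4 * N * (u₁ * u₁ * (v₂ * v₂) + u₂ * u₂ * (v₁ * v₁) - + 2 * (u₁ * u₂ * (v₁ * v₂)))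
        ≡⟨ subst-all (sym u₁²) (sym u₂²) (sym u₁u₂) ⟩
      ((N * (u₁ * u₁) + u₂ * u₂) - norm u₁ u₂) * ((N * (u₁ * u₁) + u₂ * u₂) - norm u₁ u₂) +
        + 4 * N * (u₁ * u₁ * (u₂ * u₂) + u₂ * u₂ * (u₁ * u₁) - + 2 * (u₁ * u₂ * (u₁ * u₂)))
        ≡⟨ solve 3 (λ N u₁ u₂ → let U = N :* (u₁ :* u₁) :+ u₂ :* u₂ in (U :- U) :* (U :- U) :+
             con (+ 4) :* N :* (u₁ :* u₁ :* (u₂ :* u₂) :+ u₂ :* u₂ :* (u₁ :* u₁) :- con (+ 2) :* (u₁ :* u₂ :* (u₁ :* u₂))) := con (+ 0)) refl N u₁ u₂ ⟩
      + 0 ∎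
      where
      subst-all : ∀ {s t r} → v₁ * v₁ ≡ s → v₂ * v₂ ≡ t → v₁ * v₂ ≡ r →
        (norm v₁ v₂ - norm u₁ u₂) * (norm v₁ v₂ - norm u₁ u₂) +
          + 4 * N * (u₁ * u₁ * (v₂ * v₂) + u₂ * u₂ * (v₁ * v₁) - + 2 * (u₁ * u₂ * (v₁ * v₂))) ≡
        ((N * s + t) - norm u₁ u₂) * ((N * s + t) - norm u₁ u₂) +
          + 4 * N * (u₁ * u₁ * t + u₂ * u₂ * s - + 2 * (u₁ * u₂ * r))
      subst-all refl refl refl = refl

      -4N≢0 : - (+ 4) * N ≢ + 0
      -4N≢0 = i*j≢0 {i = - (+ 4)} (λ ()) N≢0

      c≡c′ : c ≡ c′
      c≡c′ = sym (i*j≡i*k⇒j≡k (c * c′) (i*j≢0 c≢0 c′≢0) (i*j≡i*k⇒j≡k (- (+ 4) * N) -4N≢0 (begin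
        - (+ 4) * N * (c * c′ * c′)  ≡⟨ assoc (- (+ 4) * N) c c′ c′ ⟩
        - (+ 4) * N * c * (c′ * c′)  ≡⟨ cong (_* (c′ * c′)) (discriminant-hyperbola u₁ u₂ (+ 0) (+ 0) H) ⟨
        discriminant * (c′ * c′)  ≡⟨ distr α β γ c′ ⟩
        + 4 * (α * c′ * (γ * c′)) - β * c′ * (β * c′)
                                      ≡⟨ cong₂ _-_ (cong (+ 4 *_) (cong₂ _*_ pα pγ)) (cong₂ _*_ pβ pβ) ⟩
        + 4 * (α′ * c * (γ′ * c)) - β′ * c * (β′ * c)
                                      ≡⟨ distr α′ β′ γ′ c ⟨
        discriminant′ * (c * c)  ≡⟨ cong (_* (c * c)) (discriminant-hyperbola v₁ v₂ (+ 0) (+ 0) H′) ⟩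
        - (+ 4) * N * c′ * (c * c)  ≡⟨ comm (- (+ 4) * N) c c′ ⟩
        - (+ 4) * N * (c * c′ * c)  ∎)))
        where
        assoc : ∀ k x y z → k * (x * y * z) ≡ k * x * (y * z)
        assoc = solve 4 (λ k x y z → k :* (x :* y :* z) := k :* x :* (y :* z)) refl
        comm : ∀ k x y → k * y * (x * x) ≡ k * (x * y * x)
        comm = solve 3 (λ k x y → k :* y :* (x :* x) := k :* (x :* y :* x)) refl
        distr : ∀ α β γ c → (+ 4 * (α * γ) - β * β) * (c * c) ≡ + 4 * (α * c * (γ * c)) - β * c * (β * c)
        distr = solve 4 (λ α β γ c → (con (+ 4) :* (α :* γ) :- β :* β) :* (c :* c) :=
          con (+ 4) :* (α :* c :* (γ :* c)) :- β :* c :* (β :* c)) refl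

      cancel-c : ∀ i j → i * c′ ≡ j * c → i ≡ j
      cancel-c i j eq = i*j≡i*k⇒j≡k c c≢0 (trans (ℤ.*-comm c i) (trans (cong (i *_) c≡c′) (trans eq (ℤ.*-comm j c))))

      α≡ : N * (u₁ * u₁) - H ≡ N * (v₁ * v₁) - H′
      α≡ = i*j≡i*k⇒j≡k N N≢0 (trans (distr u₁ H) (trans (cancel-c α α′ pα) (sym (distr v₁ H′))))
        where
        distr : ∀ u H → N * (N * (u * u) - H) ≡ N * u * (N * u) - H * N
        distr u H = solve 3 (λ N u H → N :* (N :* (u :* u) :- H) := N :* u :* (N :* u) :- H :* N) refl N u H

      u₁u₂ : u₁ * u₂ ≡ v₁ * v₂
      u₁u₂ = i*j≡i*k⇒j≡k (+ 2 * N) (i*j≢0 {i = + 2} (λ ()) N≢0) (cancel-c β β′ pβ)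

      γ≡ : u₂ * u₂ - H ≡ v₂ * v₂ - H′
      γ≡ = cancel-c γ γ′ pγ

      difference : N * (u₁ * u₁) - u₂ * u₂ ≡ N * (v₁ * v₁) - v₂ * v₂
      difference = trans (shift (N * (u₁ * u₁)) (u₂ * u₂) H) (trans (cong₂ _-_ α≡ γ≡) (sym (shift (N * (v₁ * v₁)) (v₂ * v₂) H′)))
        where
        shift : ∀ p r H → p - r ≡ (p - H) - (r - H)
        shift = solve 3 (λ p r H → p :- r := (p :- H) :- (r :- H)) refl

      -- The modulus comes from the real and imaginary parts of that square:
      -- `|u|⁴ = (N u₁² − u₂²)² + 4 N (u₁ u₂)²`. The sum of the two norms is positive and can be
      -- cancelled.
      U≡V : norm u₁ u₂ ≡ norm v₁ v₂
      U≡V = ℤ.i-j≡0⇒i≡j (norm u₁ u₂) (norm v₁ v₂) (i*j≡0⇒j≡0 (norm u₁ u₂ + norm v₁ v₂) sum≢0 (begin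
        (norm u₁ u₂ + norm v₁ v₂) * (norm u₁ u₂ - norm v₁ v₂)
          ≡⟨ solve 5 (λ N u₁ u₂ v₁ v₂ →
               let p = N :* (u₁ :* u₁) ; r = u₂ :* u₂ ; s = N :* (v₁ :* v₁) ; t = v₂ :* v₂ in
               ((p :+ r) :+ (s :+ t)) :* ((p :+ r) :- (s :+ t)) :=
               ((p :- r) :* (p :- r) :- (s :- t) :* (s :- t)) :+
               con (+ 4) :* N :* (u₁ :* u₂ :* (u₁ :* u₂) :- v₁ :* v₂ :* (v₁ :* v₂))) refl N u₁ u₂ v₁ v₂ ⟩
        ((N * (u₁ * u₁) - u₂ * u₂) * (N * (u₁ * u₁) - u₂ * u₂) - (N * (v₁ * v₁) - v₂ * v₂) * (N * (v₁ * v₁) - v₂ * v₂)) +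
          + 4 * N * (u₁ * u₂ * (u₁ * u₂) - v₁ * v₂ * (v₁ * v₂))
          ≡⟨ cong₂ (λ s t → (s * s - (N * (v₁ * v₁) - v₂ * v₂) * (N * (v₁ * v₁) - v₂ * v₂)) + + 4 * N * (t * t - v₁ * v₂ * (v₁ * v₂))) difference u₁u₂ ⟩
        _ ≡⟨ solve 3 (λ s t k → (s :* s :- s :* s) :+ k :* (t :* t :- t :* t) := con (+ 0)) refl (N * (v₁ * v₁) - v₂ * v₂) (v₁ * v₂) (+ 4 * N) ⟩
        + 0 ∎))
        where
        0≤V : + 0 ℤ.≤ norm v₁ v₂
        0≤V = ℤ.+-mono-≤ (subst (ℤ._≤ N * (v₁ * v₁)) (ℤ.*-zeroʳ N)
          (ℤ.*-monoˡ-≤-nonNeg N {{ℤ.nonNegative (ℤ.<⇒≤ 0<N)}} (i*i-nonNeg v₁))) (i*i-nonNeg v₂)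
        sum≢0 : norm u₁ u₂ + norm v₁ v₂ ≢ + 0
        sum≢0 eq = ℤ.<-irrefl (sym eq) (ℤ.+-mono-<-≤ 0<U 0≤V)

      Nu₁² : N * (u₁ * u₁) ≡ N * (v₁ * v₁)
      Nu₁² = i*j≡i*k⇒j≡k (+ 2) (λ ()) (trans (twice (N * (u₁ * u₁)) (u₂ * u₂))
          (trans (cong₂ _+_ U≡V difference) (sym (twice (N * (v₁ * v₁)) (v₂ * v₂)))))
        where
        twice : ∀ p r → + 2 * p ≡ (p + r) + (p - r)
        twice = solve 2 (λ p r → con (+ 2) :* p := (p :+ r) :+ (p :- r)) refl

      u₁² : u₁ * u₁ ≡ v₁ * v₁
      u₁² = i*j≡i*k⇒j≡k N N≢0 Nu₁²

      u₂² : u₂ * u₂ ≡ v₂ * v₂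
      u₂² = i*j≡i*k⇒j≡k (+ 2) (λ ()) (trans (twice (N * (u₁ * u₁)) (u₂ * u₂))
          (trans (cong₂ _-_ U≡V difference) (sym (twice (N * (v₁ * v₁)) (v₂ * v₂)))))
        where
        twice : ∀ p r → + 2 * r ≡ (p + r) - (p - r)
        twice = solve 2 (λ p r → con (+ 2) :* r := (p :+ r) :- (p :- r)) refl

0<i*j : ∀ {i j} → + 0 ℤ.< i → + 0 ℤ.< j → + 0 ℤ.< i ℤ.* j
0<i*j {+ suc m} {+ suc n} _ _ = ℤ.+<+ (ℕ.s≤s ℕ.z≤n)
0<i*j {+ suc m} {+ zero} _ (ℤ.+<+ ())
0<i*j {+ zero} (ℤ.+<+ ()) _

0<i⇒i≢0 : ∀ {i} → + 0 ℤ.< i → i ≢ + 0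
0<i⇒i≢0 0<i i≡0 = ℤ.<-irrefl (sym i≡0) 0<i

∣m-n∣² : ∀ m n → + ℕ.∣ m - n ∣ ℤ.* + ℕ.∣ m - n ∣ ≡ (+ m ℤ.- + n) ℤ.* (+ m ℤ.- + n)
∣m-n∣² m n with ℕ.≤-total n m
... | inj₁ n≤m = trans (cong (λ t → + t ℤ.* + t) (ℕ.m≤n⇒∣n-m∣≡n∸m n≤m))
      (cong (λ t → t ℤ.* t) (trans (sym (ℤ.⊖-≥ n≤m)) (sym (ℤ.m-n≡m⊖n m n))))
... | inj₂ m≤n = trans (cong (λ t → + t ℤ.* + t) (ℕ.m≤n⇒∣m-n∣≡n∸m m≤n))
      (trans (cong (λ t → t ℤ.* t) (trans (sym (ℤ.⊖-≥ m≤n)) (sym (ℤ.m-n≡m⊖n n m))))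
      (ℤS.solve 2 (λ k m → (k :- m) :* (k :- m) := (m :- k) :* (m :- k)) refl (+ n) (+ m)))
  where open ℤS

-- Integral coordinates and their conics

module _ where
  open Conics using (det)
  open import Data.Integer.Base using (_+_; _*_; _-_; -_)

  record Coordinates {n : ℕ} (D : Fin n → Fin n → ℕ) : Set where
    field
      X Y  : Fin n → ℤ
      N κ  : ℤ
      0<N  : + 0 ℤ.< N
      0<κ  : + 0 ℤ.< κ
      metric : ∀ i j → N * ((X i - X j) * (X i - X j)) + (Y i - Y j) * (Y i - Y j) ≡ κ * (+ D i j * + D i j)

    κ≢0 : κ ≢ + 0
    κ≢0 = 0<i⇒i≢0 0<κ

    -- Heron's formula for the form `N x² + y²`. It transports both the nonvanishing of `heron`
    -- (noncollinearity) and its size (heights) to the coordinates.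
    det-heron : ∀ i j k → + 4 * N * (det (X i) (Y i) (X j) (Y j) (X k) (Y k) * det (X i) (Y i) (X j) (Y j) (X k) (Y k)) ≡
                          κ * κ * heron (+ D i j) (+ D i k) (+ D j k)
    det-heron i j k = begin
      + 4 * N * (det (X i) (Y i) (X j) (Y j) (X k) (Y k) * det (X i) (Y i) (X j) (Y j) (X k) (Y k))
        ≡⟨ solve 7 (λ N x₁ y₁ x₂ y₂ x₃ y₃ →
             let d = (x₂ :- x₁) :* (y₃ :- y₁) :- (x₃ :- x₁) :* (y₂ :- y₁)
                 n = λ x y x′ y′ → N :* ((x :- x′) :* (x :- x′)) :+ (y :- y′) :* (y :- y′)
                 s = n x₁ y₁ x₂ y₂ :+ n x₁ y₁ x₃ y₃ :- n x₂ y₂ x₃ y₃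
             in con (+ 4) :* N :* (d :* d) := con (+ 4) :* (n x₁ y₁ x₂ y₂ :* n x₁ y₁ x₃ y₃) :- s :* s)
             refl N (X i) (Y i) (X j) (Y j) (X k) (Y k) ⟩
      + 4 * (dist² i j * dist² i k) - (dist² i j + dist² i k - dist² j k) * (dist² i j + dist² i k - dist² j k)
        ≡⟨ subst₃ (metric i j) (metric i k) (metric j k) ⟩
      + 4 * (κ * A * (κ * B)) - (κ * A + κ * B - κ * C) * (κ * A + κ * B - κ * C)
        ≡⟨ solve 4 (λ κ A B C → con (+ 4) :* (κ :* A :* (κ :* B)) :- (κ :* A :+ κ :* B :- κ :* C) :* (κ :* A :+ κ :* B :- κ :* C) :=
             κ :* κ :* (con (+ 4) :* (A :* B) :- (A :+ B :- C) :* (A :+ B :- C))) refl κ A B C ⟩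
      κ * κ * heron (+ D i j) (+ D i k) (+ D j k) ∎
      where
      open ℤS
      open ≡-Reasoning
      dist² : Fin n → Fin n → ℤ
      dist² i j = N * ((X i - X j) * (X i - X j)) + (Y i - Y j) * (Y i - Y j)
      A B C : ℤ
      A = + D i j * + D i j
      B = + D i k * + D i k
      C = + D j k * + D j k
      subst₃ : ∀ {a b c a′ b′ c′} → a ≡ a′ → b ≡ b′ → c ≡ c′ →
               + 4 * (a * b) - (a + b - c) * (a + b - c) ≡ + 4 * (a′ * b′) - (a′ + b′ - c′) * (a′ + b′ - c′)
      subst₃ refl refl refl = refl

    det≢0 : ∀ {i j k} → heron (+ D i j) (+ D i k) (+ D j k) ≢ + 0 → det (X i) (Y i) (X j) (Y j) (X k) (Y k) ≢ + 0
    det≢0 {i} {j} {k} h≢0 det≡0 = i*j≢0 (i*j≢0 κ≢0 κ≢0) h≢0 (trans (sym (det-heron i j k))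
      (trans (cong (λ d → + 4 * N * (d * d)) det≡0) (ℤ.*-zeroʳ (+ 4 * N))))

-- Up to the common factor `√κ`, the numbers `√N E` and `Z` are orthonormal coordinates along and
-- across the edge `a b`. The weight `N` on the first coordinate keeps everything integral.
coordinates : ∀ {n q} {D : Fin n → Fin n → ℕ} → IsDistanceMatrix q D → ∀ a b c → a ≢ b → b ≢ c → a ≢ c → Coordinates D
coordinates {D = D} isD a b c a≢b b≢c a≢c = record
  { X = E ; Y = Z ; N = N ; κ = + 4 * S a b * N
  ; 0<N = 0<N
  ; 0<κ = 0<i*j (0<i*j {+ 4} (ℤ.+<+ (ℕ.s≤s ℕ.z≤n)) (0<i*j 0<ab 0<ab)) 0<N
  ; metric = λ i j → begin
      N * ((E i - E j) * (E i - E j)) + (Z i - Z j) * (Z i - Z j)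
        ≡⟨ cong (λ t → N * ((E i - E j) * (E i - E j)) + t) (planar a b c i j) ⟨
      N * ((E i - E j) * (E i - E j)) + (+ 4 * (S a b * S i j) - (E i - E j) * (E i - E j)) * N
        ≡⟨ solve 4 (λ N e s t → N :* e :+ (con (+ 4) :* (s :* t) :- e) :* N := con (+ 4) :* s :* N :* t)
             refl N ((E i - E j) * (E i - E j)) (S a b) (S i j) ⟩
      + 4 * S a b * N * S i j ∎
  }
  where
  open import Data.Integer.Base using (_+_; _*_; _-_; -_)
  open IsDistanceMatrix isD
  open ≡-Reasoning
  open ℤS
  S : _ → _ → ℤ
  S i j = + D i j * + D i j
  open Frame S a b c
  0<N : + 0 ℤ.< N
  0<N = ∼⇒0< (heron≢0 a≢b b≢c a≢c) (heron-commensurable a b c)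
  0<ab : + 0 ℤ.< + D a b
  0<ab = ℤ.+<+ (D-pos a≢b)

module Foci {n q} {D : Fin n → Fin n → ℕ} (isD : IsDistanceMatrix q D) (coords : Coordinates D) where
  open IsDistanceMatrix isD
  open Coordinates coords
  open Conics
  open Hyperbolas N 0<N
  open import Data.Integer.Base using (_+_; _*_; _-_; -_)
  open ℤS
  open ≡-Reasoning

  metric≢0 : ∀ {i j} → i ≢ j → + 0 ℤ.< κ * (+ D i j * + D i j)
  metric≢0 i≢j = 0<i*j 0<κ (0<i*j (ℤ.+<+ (D-pos i≢j)) (ℤ.+<+ (D-pos i≢j)))

  distinct-coordinates : ∀ {i j} → norm (X i - X j) (Y i - Y j) ≡ + 0 → ¬ i ≢ j
  distinct-coordinates {i} {j} eq i≢j = 0<i⇒i≢0 (metric≢0 i≢j) (trans (sym (metric i j)) eq)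

  noncollinear : ∀ {i j k} → i ≢ j → j ≢ k → i ≢ k → det (X i) (Y i) (X j) (Y j) (X k) (Y k) ≢ + 0
  noncollinear i≢j j≢k i≢k = det≢0 (heron≢0 i≢j j≢k i≢k)

  gap : Fin n → Fin n → Fin n → ℕ
  gap A B P = ℕ.∣ D P A - D P B ∣

  module Edge (A B : Fin n) where
    u₁ u₂ S₁ S₂ : ℤ
    u₁ = X B - X A
    u₂ = Y B - Y A
    S₁ = X A + X B
    S₂ = Y A + Y B

    U≡ : norm u₁ u₂ ≡ κ * (+ D A B * + D A B)
    U≡ = trans (solve 5 (λ N a b c d → N :* ((b :- a) :* (b :- a)) :+ (d :- c) :* (d :- c) := N :* ((a :- b) :* (a :- b)) :+ (c :- d) :* (c :- d))
      refl N (X A) (X B) (Y A) (Y B)) (metric A B)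

    0<U : A ≢ B → + 0 ℤ.< norm u₁ u₂
    0<U A≢B = subst (+ 0 ℤ.<_) (sym U≡) (metric≢0 A≢B)

    bilinear : ∀ P → N * u₁ * (+ 2 * X P - S₁) + u₂ * (+ 2 * Y P - S₂) ≡ κ * (+ D P A * + D P A) - κ * (+ D P B * + D P B)
    bilinear P = trans (solve 7 (λ N a b c d x y →
        N :* (b :- a) :* (con (+ 2) :* x :- (a :+ b)) :+ (d :- c) :* (con (+ 2) :* y :- (c :+ d)) :=
        (N :* ((x :- a) :* (x :- a)) :+ (y :- c) :* (y :- c)) :- (N :* ((x :- b) :* (x :- b)) :+ (y :- d) :* (y :- d)))
      refl N (X A) (X B) (Y A) (Y B) (X P) (Y P)) (cong₂ _-_ (metric P A) (metric P B))

    parallelogram : ∀ P → norm (+ 2 * X P - S₁) (+ 2 * Y P - S₂) ≡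
      + 2 * (κ * (+ D P A * + D P A)) + + 2 * (κ * (+ D P B * + D P B)) - norm u₁ u₂
    parallelogram P = trans (solve 7 (λ N a b c d x y →
        let s = con (+ 2) :* x :- (a :+ b) ; t = con (+ 2) :* y :- (c :+ d) ; n = λ x y → N :* (x :* x) :+ y :* y in
        n s t := con (+ 2) :* n (x :- a) (y :- c) :+ con (+ 2) :* n (x :- b) (y :- d) :- n (b :- a) (d :- c))
      refl N (X A) (X B) (Y A) (Y B) (X P) (Y P))
      (cong₂ (λ s t → + 2 * s + + 2 * t - norm u₁ u₂) (metric P A) (metric P B))

    conicOf : ℕ → Central
    conicOf h = hyperbola u₁ u₂ S₁ S₂ (κ * (+ h * + h))

    on-conic : ∀ P {h} → gap A B P ≡ h → Central.On (conicOf h) (X P) (Y P)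
    on-conic P refl = subst (λ t → Central.On (hyperbola u₁ u₂ S₁ S₂ (κ * t)) (X P) (Y P)) (sym (∣m-n∣² (D P A) (D P B)))
      (on-hyperbola u₁ u₂ S₁ S₂ κ (+ D P A) (+ D P B) (X P) (Y P) (bilinear P) (parallelogram P))

    -- Here `c = H (U − H)` vanishes just in the degenerate cases: the perpendicular bisector for
    -- `h = 0` and the line A B for `h = |AB|`.
    constant≢0 : ∀ {h} → 0 ℕ.< h → h ℕ.< D A B → Central.c (conicOf h) ≢ + 0
    constant≢0 {h} 0<h h<m = i*j≢0 (i*j≢0 κ≢0 (i*j≢0 h≢0 h≢0)) λ eq → ℤ.<-irrefl
        (trans (sym (ℤ.i-j≡0⇒i≡j (norm u₁ u₂) (κ * (+ h * + h)) eq)) U≡)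
        (ℤ.*-monoˡ-<-pos κ {{ℤ.positive 0<κ}} (subst₂ ℤ._<_ (ℤ.pos-* h h) (ℤ.pos-* (D A B) (D A B)) (ℤ.+<+ (ℕ.*-mono-< h<m h<m))))
      where
      h≢0 : + h ≢ + 0
      h≢0 h≡0 = ℕ.<-irrefl (sym (ℤ.+-injective h≡0)) 0<h

    -- Points with gap 0 satisfy the affine equation of the perpendicular bisector. Three
    -- noncollinear solutions make all its coefficients vanish, so `u = 0`, although A and B differ.
    bisector : A ≢ B → ∀ {i j k} → i ≢ j → j ≢ k → i ≢ k → gap A B i ≡ 0 → gap A B j ≡ 0 → gap A B k ≡ 0 → ⊥
    bisector A≢B {i} {j} {k} i≢j j≢k i≢k gi gj gk = 0<i⇒i≢0 (0<U A≢B) (trans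
        (cong₂ (λ s t → N * (s * s) + t * t) u₁≡0 u₂≡0) (trans (cong (_+ + 0) (ℤ.*-zeroʳ N)) refl))
      where
      on-line : ∀ P → gap A B P ≡ 0 → (+ 2 * N * u₁) * X P + (+ 2 * u₂) * Y P + - (N * u₁ * S₁ + u₂ * S₂) ≡ + 0
      on-line P g≡0 = begin
        (+ 2 * N * u₁) * X P + (+ 2 * u₂) * Y P + - (N * u₁ * S₁ + u₂ * S₂)
          ≡⟨ rearrange N u₁ u₂ S₁ S₂ (X P) (Y P) ⟩
        N * u₁ * (+ 2 * X P - S₁) + u₂ * (+ 2 * Y P - S₂)
          ≡⟨ bilinear P ⟩
        κ * (+ D P A * + D P A) - κ * (+ D P B * + D P B)
          ≡⟨ cong (λ t → κ * (+ t * + t) - κ * (+ D P B * + D P B)) (ℕ.∣m-n∣≡0⇒m≡n {D P A} {D P B} g≡0) ⟩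
        κ * (+ D P B * + D P B) - κ * (+ D P B * + D P B)
          ≡⟨ ℤ.+-inverseʳ (κ * (+ D P B * + D P B)) ⟩
        + 0 ∎
        where
        rearrange : ∀ N u₁ u₂ S₁ S₂ x y → (+ 2 * N * u₁) * x + (+ 2 * u₂) * y + - (N * u₁ * S₁ + u₂ * S₂) ≡
                    N * u₁ * (+ 2 * x - S₁) + u₂ * (+ 2 * y - S₂)
        rearrange = solve 7 (λ N u₁ u₂ S₁ S₂ x y → con (+ 2) :* N :* u₁ :* x :+ con (+ 2) :* u₂ :* y :+ :- (N :* u₁ :* S₁ :+ u₂ :* S₂) :=
          N :* u₁ :* (con (+ 2) :* x :- S₁) :+ u₂ :* (con (+ 2) :* y :- S₂)) refl
      zeros = affine≡0 (+ 2 * N * u₁) (+ 2 * u₂) (- (N * u₁ * S₁ + u₂ * S₂)) (X i) (Y i) (X j) (Y j) (X k) (Y k)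
        (noncollinear i≢j j≢k i≢k) (on-line i gi) (on-line j gj) (on-line k gk)
      u₁≡0 : u₁ ≡ + 0
      u₁≡0 = i*j≡0⇒j≡0 (+ 2 * N) (i*j≢0 {i = + 2} (λ ()) N≢0) (proj₁ zeros)
      u₂≡0 : u₂ ≡ + 0
      u₂≡0 = i*j≡0⇒j≡0 (+ 2) (λ ()) (proj₁ (proj₂ zeros))

  module _ (A B A′ B′ : Fin n) where
    private
      module E = Edge A B
      module E′ = Edge A′ B′

    near : E.S₁ ≡ E′.S₁ → E.S₂ ≡ E′.S₂ → norm (E′.u₁ - E.u₁) (E′.u₂ - E.u₂) ≡ + 0 → A ≡ A′ × B ≡ B′
    near S₁≡ S₂≡ eq = point A A′ (quarter (X A - X A′) (Y A - Y A′) (trans (cong₂ norm (sym (first (X A) (X B) (X A′) (X B′) S₁≡)) (sym (first (Y A) (Y B) (Y A′) (Y B′) S₂≡))) eq)) ,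
                      sym (point B′ B (quarter (X B′ - X B) (Y B′ - Y B) (trans (cong₂ norm (sym (second (X A) (X B) (X A′) (X B′) S₁≡)) (sym (second (Y A) (Y B) (Y A′) (Y B′) S₂≡))) eq)))
      where
      first : ∀ a b a′ b′ → a + b ≡ a′ + b′ → (b′ - a′) - (b - a) ≡ + 2 * (a - a′)
      first a b a′ b′ S≡ = trans (solve 4 (λ a b a′ b′ → (b′ :- a′) :- (b :- a) := con (+ 2) :* (a :- a′) :+ ((a′ :+ b′) :- (a :+ b))) refl a b a′ b′)
        (trans (cong (λ s → + 2 * (a - a′) + (s - (a + b))) (sym S≡))
        (solve 2 (λ x s → x :+ (s :- s) := x) refl (+ 2 * (a - a′)) (a + b)))
      second : ∀ a b a′ b′ → a + b ≡ a′ + b′ → (b′ - a′) - (b - a) ≡ + 2 * (b′ - b)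
      second a b a′ b′ S≡ = trans (solve 4 (λ a b a′ b′ → (b′ :- a′) :- (b :- a) := con (+ 2) :* (b′ :- b) :+ ((a :+ b) :- (a′ :+ b′))) refl a b a′ b′)
        (trans (cong (λ s → + 2 * (b′ - b) + ((a + b) - s)) (sym S≡))
        (solve 2 (λ x s → x :+ (s :- s) := x) refl (+ 2 * (b′ - b)) (a + b)))
      quarter : ∀ x y → norm (+ 2 * x) (+ 2 * y) ≡ + 0 → norm x y ≡ + 0
      quarter x y eq = i*j≡0⇒j≡0 (+ 4) (λ ()) (trans (solve 3 (λ N x y → con (+ 4) :* (N :* (x :* x) :+ y :* y) :=
        N :* (con (+ 2) :* x :* (con (+ 2) :* x)) :+ con (+ 2) :* y :* (con (+ 2) :* y)) refl N x y) eq)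
      point : ∀ P Q → norm (X P - X Q) (Y P - Y Q) ≡ + 0 → P ≡ Q
      point P Q eq = decidable-stable (P Fin.≟ Q) (distinct-coordinates eq)

  five-points : ∀ A B A′ B′ → A ≢ B → A′ ≢ B′ → ¬ ((A ≡ A′ × B ≡ B′) ⊎ (A ≡ B′ × B ≡ A′)) →
    ∀ {h h′} → 0 ℕ.< h → h ℕ.< D A B → 0 ℕ.< h′ → h′ ℕ.< D A′ B′ →
    ∀ {P₀ P₁ P₂ P₃ P₄} → P₀ ≢ P₁ → P₀ ≢ P₂ → P₀ ≢ P₃ → P₀ ≢ P₄ → P₁ ≢ P₂ → P₁ ≢ P₃ → P₁ ≢ P₄ → P₂ ≢ P₃ → P₂ ≢ P₄ → P₃ ≢ P₄ →
    (∀ {P} → P ≡ P₀ ⊎ P ≡ P₁ ⊎ P ≡ P₂ ⊎ P ≡ P₃ ⊎ P ≡ P₄ → gap A B P ≡ h × gap A′ B′ P ≡ h′) → ⊥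
  five-points A B A′ B′ A≢B A′≢B′ different {h} {h′} 0<h h<m 0<h′ h′<m′ {P₀} {P₁} {P₂} {P₃} {P₄}
    n₀₁ n₀₂ n₀₃ n₀₄ n₁₂ n₁₃ n₁₄ n₂₃ n₂₄ n₃₄ gaps = different (foci (ℤ.i*j≡0⇒i≡0∨j≡0 (norm (E′.u₁ - E.u₁) (E′.u₂ - E.u₂)) ±))
    where
    points : FivePoints
    points = record
      { X₀ = X P₀ ; Y₀ = Y P₀ ; X₁ = X P₁ ; Y₁ = Y P₁ ; X₂ = X P₂ ; Y₂ = Y P₂ ; X₃ = X P₃ ; Y₃ = Y P₃ ; X₄ = X P₄ ; Y₄ = Y P₄
      ; det₀₁₂ = noncollinear n₀₁ n₁₂ n₀₂
      ; det₀₁₃ = noncollinear n₀₁ n₁₃ n₀₃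
      ; det₀₁₄ = noncollinear n₀₁ n₁₄ n₀₄
      ; det₂₃₄ = noncollinear n₂₃ n₃₄ n₂₄
      }
    g = λ P i → gaps {P} i
    module E = Edge A B
    module E′ = Edge A′ B′
    on : FivePoints.AllOn points (E.conicOf h)
    on = E.on-conic P₀ (proj₁ (g P₀ (inj₁ refl))) , E.on-conic P₁ (proj₁ (g P₁ (inj₂ (inj₁ refl)))) ,
         E.on-conic P₂ (proj₁ (g P₂ (inj₂ (inj₂ (inj₁ refl))))) , E.on-conic P₃ (proj₁ (g P₃ (inj₂ (inj₂ (inj₂ (inj₁ refl)))))) ,
         E.on-conic P₄ (proj₁ (g P₄ (inj₂ (inj₂ (inj₂ (inj₂ refl))))))
    on′ : FivePoints.AllOn points (E′.conicOf h′)
    on′ = E′.on-conic P₀ (proj₂ (g P₀ (inj₁ refl))) , E′.on-conic P₁ (proj₂ (g P₁ (inj₂ (inj₁ refl)))) ,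
         E′.on-conic P₂ (proj₂ (g P₂ (inj₂ (inj₂ (inj₁ refl))))) , E′.on-conic P₃ (proj₂ (g P₃ (inj₂ (inj₂ (inj₂ (inj₁ refl)))))) ,
         E′.on-conic P₄ (proj₂ (g P₄ (inj₂ (inj₂ (inj₂ (inj₂ refl))))))
    H H′ : ℤ
    H = κ * (+ h * + h)
    H′ = κ * (+ h′ * + h′)
    c≢0 = E.constant≢0 0<h h<m
    c≢0′ = E′.constant≢0 0<h′ h′<m′
    module T = FivePoints.TwoConics points (E.conicOf h) (E′.conicOf h′) on on′
      (discriminant≢0 E.u₁ E.u₂ E.S₁ E.S₂ H c≢0) (discriminant≢0 E′.u₁ E′.u₂ E′.S₁ E′.S₂ H′ c≢0′)

    ± : norm (E′.u₁ - E.u₁) (E′.u₂ - E.u₂) * norm (E′.u₁ + E.u₁) (E′.u₂ + E.u₂) ≡ + 0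
    ± = SameFoci.u≡±v E.u₁ E.u₂ H E′.u₁ E′.u₂ H′ (E.0<U A≢B) c≢0 c≢0′
      (T.proportional (Central.α (E.conicOf h)) (Central.α (E′.conicOf h′)) T.rα)
      (T.proportional (Central.β (E.conicOf h)) (Central.β (E′.conicOf h′)) T.rβ)
      (T.proportional (Central.γ (E.conicOf h)) (Central.γ (E′.conicOf h′)) T.rγ)
    foci : norm (E′.u₁ - E.u₁) (E′.u₂ - E.u₂) ≡ + 0 ⊎ norm (E′.u₁ + E.u₁) (E′.u₂ + E.u₂) ≡ + 0 →
           (A ≡ A′ × B ≡ B′) ⊎ (A ≡ B′ × B ≡ A′)
    foci (inj₁ eq) = inj₁ (near A B A′ B′ T.same-centre₁ T.same-centre₂ eq)
    -- Here the difference vectors are opposite, so `near` is applied to the second edge with its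
    -- ends exchanged.
    foci (inj₂ eq) = inj₂ (near A B B′ A′ (trans T.same-centre₁ (ℤ.+-comm (X A′) (X B′))) (trans T.same-centre₂ (ℤ.+-comm (Y A′) (Y B′)))
      (trans (solve 7 (λ N a b a′ b′ c d → N :* (((a′ :- b′) :- (b :- a)) :* ((a′ :- b′) :- (b :- a))) :+ (c :- d) :* (c :- d) :=
          N :* (((b′ :- a′) :+ (b :- a)) :* ((b′ :- a′) :+ (b :- a))) :+ (d :- c) :* (d :- c)) refl N (X A) (X B) (X A′) (X B′) (Y A′ - Y B′) (Y B - Y A))
        (trans (cong (λ t → N * ((E′.u₁ + E.u₁) * (E′.u₁ + E.u₁)) + t) (square (Y A) (Y B) (Y A′) (Y B′))) eq)))
      where
      square : ∀ a b a′ b′ → ((b - a) - (a′ - b′)) * ((b - a) - (a′ - b′)) ≡ ((b′ - a′) + (b - a)) * ((b′ - a′) + (b - a))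
      square = solve 4 (λ a b a′ b′ → ((b :- a) :- (a′ :- b′)) :* ((b :- a) :- (a′ :- b′)) := ((b′ :- a′) :+ (b :- a)) :* ((b′ :- a′) :+ (b :- a))) refl

-- Counting points on hyperbolas

AtMost : {A : Set} → ℕ → (A → Set) → Set
AtMost c P = ∀ ys → Unique ys → All P ys → length ys ℕ.≤ c

at-most-two : ∀ {A : Set} {P : A → Set} → (∀ {i j k} → i ≢ j → j ≢ k → i ≢ k → P i → P j → P k → ⊥) → AtMost 2 P
at-most-two h []           _ _ = ℕ.z≤n
at-most-two h (_ ∷ [])     _ _ = ℕ.s≤s ℕ.z≤n
at-most-two h (_ ∷ _ ∷ []) _ _ = ℕ.s≤s (ℕ.s≤s ℕ.z≤n)
at-most-two h (_ ∷ _ ∷ _ ∷ _) ((ij ∷ ik ∷ _) ∷ (jk ∷ _) ∷ _) (pi ∷ pj ∷ pk ∷ _) = contradiction (h ij jk ik pi pj pk) λ ()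

length-filter-¬ : ∀ {A : Set} {P : A → Set} (P? : Decidable P) xs →
                  length xs ≡ length (filter P? xs) ℕ.+ length (filter (¬? ∘ P?) xs)
length-filter-¬ P? [] = refl
length-filter-¬ P? (x ∷ xs) with P? x
... | yes _ = cong suc (length-filter-¬ P? xs)
... | no  _ = trans (cong suc (length-filter-¬ P? xs)) (sym (ℕ.+-suc _ _))

drop-class : ∀ {A : Set} {P : A → Set} (P? : Decidable P) {c} → AtMost c P → ∀ {xs} → Unique xs →
             length xs ℕ.≤ c ℕ.+ length (filter (¬? ∘ P?) xs)
drop-class P? h {xs} u = ℕ.≤-trans (ℕ.≤-reflexive (length-filter-¬ P? xs))
  (ℕ.+-monoˡ-≤ _ (h (filter P? xs) (Unique.filter⁺ P? u) (All.all-filter P? xs)))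

fibres : ∀ {A : Set} {P : A → Set} (f : A → ℕ) {c} → (∀ v → AtMost c (λ x → P x × f x ≡ v)) →
         ∀ k → AtMost (k ℕ.* c) (λ x → P x × f x ℕ.< k)
fibres f h zero    []      u all = ℕ.z≤n
fibres f h zero    (_ ∷ _) u ((_ , ()) ∷ _)
fibres {P = P} f {c} h (suc k) xs u all = ℕ.≤-trans (ℕ.≤-reflexive (length-filter-¬ top? xs))
  (ℕ.+-mono-≤
    (h k (filter top? xs) (Unique.filter⁺ top? u)
      (All.zipWith (λ { ((p , _) , e) → p , e }) (All.filter⁺ top? all , All.all-filter top? xs)))
    (fibres f h k (filter (¬? ∘ top?) xs) (Unique.filter⁺ (¬? ∘ top?) u)
      (All.zipWith (λ { ((p , lt) , ne) → p , ℕ.≤∧≢⇒< (ℕ.≤-pred lt) ne })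
        (All.filter⁺ (¬? ∘ top?) all , All.all-filter (¬? ∘ top?) xs))))
  where
  top? : ∀ x → Dec (f x ≡ k)
  top? x = f x ℕ.≟ k

odd-∣-∣ : ∀ m n → odd ℕ.∣ m - n ∣ ≡ odd m xor odd n
odd-∣-∣ zero    n       = refl
odd-∣-∣ (suc m) zero    with not (odd m)
... | true  = refl
... | false = refl
odd-∣-∣ (suc m) (suc n) rewrite odd-∣-∣ m n with odd m | odd n
... | true  | true  = refl
... | true  | false = refl
... | false | true  = refl
... | false | false = refl

half-injective : ∀ m n → odd m ≡ odd n → ⌊ m /2⌋ ≡ ⌊ n /2⌋ → m ≡ n
half-injective zero          zero          _ _ = refl
half-injective (suc zero)    (suc zero)    _ _ = refl
half-injective (suc (suc m)) (suc (suc n)) o h = cong (suc ∘ suc)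
  (half-injective m n (not² (odd m) (odd n) o) (ℕ.suc-injective h))
  where
  not² : ∀ a b → not (not a) ≡ not (not b) → a ≡ b
  not² true  true  _ = refl
  not² false false _ = refl
half-injective zero          (suc zero)    () _
half-injective (suc zero)    zero          () _

half-< : ∀ n k → n ℕ.< k ℕ.* 2 → ⌊ n /2⌋ ℕ.< k
half-< zero          (suc k) _ = ℕ.s≤s ℕ.z≤n
half-< (suc zero)    (suc k) _ = ℕ.s≤s ℕ.z≤n
half-< (suc (suc n)) (suc k) (ℕ.s≤s (ℕ.s≤s h)) = ℕ.s≤s (half-< n k h)

heron-factor : ∀ a b c → heron a b c ≡ ((a ℤ.+ b) ℤ.* (a ℤ.+ b) ℤ.- c ℤ.* c) ℤ.* (c ℤ.* c ℤ.- (a ℤ.- b) ℤ.* (a ℤ.- b))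
heron-factor = solve 3 (λ a b c → con (+ 4) :* (a :* a :* (b :* b)) :- (a :* a :+ b :* b :- c :* c) :* (a :* a :+ b :* b :- c :* c) :=
  ((a :+ b) :* (a :+ b) :- c :* c) :* (c :* c :- (a :- b) :* (a :- b))) refl
  where open ℤS

+-square-mono : ∀ {m n} → m ℕ.≤ n → + m ℤ.* + m ℤ.≤ + n ℤ.* + n
+-square-mono {m} {n} m≤n = subst₂ ℤ._≤_ (ℤ.pos-* m m) (ℤ.pos-* n n) (ℤ.+≤+ (ℕ.*-mono-≤ m≤n m≤n))

-- `heron` is the product of `(a + b)² − c²` and `c² − (a − b)²`. If `c ≤ |a − b| ≤ a + b`, the
-- first factor is nonnegative and the second is not positive.
∣a-b∣<c : ∀ a b c → + 0 ℤ.< heron (+ a) (+ b) (+ c) → ℕ.∣ a - b ∣ ℕ.< c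
∣a-b∣<c a b c 0<h = ℕ.≰⇒> λ c≤g → ℤ.<-irrefl refl (ℤ.<-≤-trans 0<h (begin
    heron (+ a) (+ b) (+ c)  ≡⟨ heron-factor (+ a) (+ b) (+ c) ⟩
    F₁ ℤ.* F₂  ≤⟨ ℤ.*-monoˡ-≤-nonNeg F₁ {{ℤ.nonNegative (ℤ.i≤j⇒0≤j-i (+-square-mono (ℕ.≤-trans c≤g g≤a+b)))}}
                                  (ℤ.i≤j⇒i-j≤0 (ℤ.≤-trans (+-square-mono c≤g) (ℤ.≤-reflexive (∣m-n∣² a b)))) ⟩
    F₁ ℤ.* + 0  ≡⟨ ℤ.*-zeroʳ F₁ ⟩
    + 0  ∎))
  where
  open ℤ.≤-Reasoning
  F₁ F₂ : ℤ
  F₁ = (+ a ℤ.+ + b) ℤ.* (+ a ℤ.+ + b) ℤ.- + c ℤ.* + c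
  F₂ = + c ℤ.* + c ℤ.- (+ a ℤ.- + b) ℤ.* (+ a ℤ.- + b)
  g≤a+b : ℕ.∣ a - b ∣ ℕ.≤ a ℕ.+ b
  g≤a+b = ℕ.≤-trans (ℕ.∣m-n∣≤m⊔n a b) (ℕ.⊔-lub (ℕ.m≤m+n a b) (ℕ.m≤n+m b a))

module Hyperbolic {n q} {D : Fin n → Fin n → ℕ} (isD : IsDistanceMatrix q D) (q≢0 : q % 4 ≢ 0) (q≢3 : q % 4 ≢ 3)
  (coords : Coordinates D) where
  open IsDistanceMatrix isD
  open Foci isD coords
  open Scales isD q≢0 q≢3 using (triangle-parity)

  module _ {A B : Fin n} (A≢B : A ≢ B) where

    gap<AB : ∀ {P} → P ≢ A → P ≢ B → gap A B P ℕ.< D A B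
    gap<AB {P} P≢A P≢B = ∣a-b∣<c (D P A) (D P B) (D A B) (∼⇒0< (heron≢0 P≢A A≢B P≢B) (heron-commensurable P A B))

    gap-A : gap A B A ≡ D A B
    gap-A rewrite D-refl A = refl

    gap-B : gap A B B ≡ D A B
    gap-B rewrite D-refl B | D-sym B A = ℕ.∣-∣-identityʳ (D A B)

    gap≢⇒≢A : ∀ {P} → gap A B P ≢ D A B → P ≢ A × P ≢ B
    gap≢⇒≢A g≢ = (λ { refl → g≢ gap-A }) , (λ { refl → g≢ gap-B })

    odd-gap : ∀ {P} → gap A B P ≢ D A B → odd (gap A B P) ≡ odd (D A B)
    odd-gap {P} g≢ = let P≢A , P≢B = gap≢⇒≢A g≢ in
      trans (odd-∣-∣ (D P A) (D P B))
        (triangle-parity 1 (P≢A , A≢B , P≢B) (sym (ℕ.*-identityˡ _)) (sym (ℕ.*-identityˡ _)) (sym (ℕ.*-identityˡ _)))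

    gap≡0-bound : AtMost 2 (λ P → gap A B P ≡ 0)
    gap≡0-bound = at-most-two (Edge.bisector A B A≢B)

    gap≡AB-bound : AtMost 2 (λ P → gap A B P ≡ D A B)
    gap≡AB-bound = at-most-two λ i≢j j≢k i≢k gi gj gk → go i≢j j≢k i≢k (end gi) (end gj) (end gk)
      where
      end : ∀ {P} → gap A B P ≡ D A B → P ≡ A ⊎ P ≡ B
      end {P} g with P Fin.≟ A | P Fin.≟ B
      ... | yes P≡A | _       = inj₁ P≡A
      ... | no _    | yes P≡B = inj₂ P≡B
      ... | no P≢A  | no P≢B  = contradiction g (ℕ.<⇒≢ (gap<AB P≢A P≢B))
      go : ∀ {i j k} → i ≢ j → j ≢ k → i ≢ k → i ≡ A ⊎ i ≡ B → j ≡ A ⊎ j ≡ B → k ≡ A ⊎ k ≡ B → ⊥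
      go i≢j _ _ (inj₁ refl) (inj₁ refl) _           = i≢j refl
      go i≢j _ _ (inj₂ refl) (inj₂ refl) _           = i≢j refl
      go _ _ i≢k (inj₁ refl) (inj₂ refl) (inj₁ refl) = i≢k refl
      go _ j≢k _ (inj₁ refl) (inj₂ refl) (inj₂ refl) = j≢k refl
      go _ j≢k _ (inj₂ refl) (inj₁ refl) (inj₁ refl) = j≢k refl
      go _ _ i≢k (inj₂ refl) (inj₁ refl) (inj₂ refl) = i≢k refl

    Regular : Fin n → Set
    Regular P = gap A B P ≢ 0 × gap A B P ≢ D A B

    -- The gaps of regular points lie between 1 and `|AB| − 2` and have the parity of `|AB|`. This
    -- formula numbers them from 0 in both cases: 1, 3, 5, ... as well as 2, 4, 6, ... go to 0, 1,
    -- 2, ....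
    index : Fin n → ℕ
    index P = ⌊ pred (gap A B P) /2⌋

    index-injective : ∀ {P Q} → Regular P → Regular Q → index P ≡ index Q → gap A B P ≡ gap A B Q
    index-injective {P} {Q} (p≢0 , p≢) (q≢0 , q≢) eq =
      pred-injective p≢0 q≢0 (half-injective _ _ (odd-pred p≢0 q≢0 (trans (odd-gap p≢) (sym (odd-gap q≢)))) eq)
      where
      pred-injective : ∀ {m k} → m ≢ 0 → k ≢ 0 → pred m ≡ pred k → m ≡ k
      pred-injective {zero}          m≢0 _ _ = contradiction refl m≢0
      pred-injective {suc m} {zero}  _ k≢0 _ = contradiction refl k≢0
      pred-injective {suc m} {suc k} _ _ eq  = cong suc eq
      odd-pred : ∀ {m k} → m ≢ 0 → k ≢ 0 → odd m ≡ odd k → odd (pred m) ≡ odd (pred k)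
      odd-pred {zero}          m≢0 _ _ = contradiction refl m≢0
      odd-pred {suc m} {zero}  _ k≢0 _ = contradiction refl k≢0
      odd-pred {suc m} {suc k} _ _ eq with odd m | odd k
      ... | true  | true  = refl
      ... | false | false = refl

    index-< : ∀ {τ P} → D A B ℕ.≤ suc (suc (τ ℕ.* 2)) → Regular P → index P ℕ.< τ
    index-< {τ} {P} AB≤ (g≢0 , g≢) = half-< _ τ (pred-< g≢0 (ℕ.≤-pred (ℕ.≤-pred (ℕ.≤-trans gap+2≤ AB≤))))
      where
      pred-< : ∀ {m k} → m ≢ 0 → m ℕ.≤ k → pred m ℕ.< k
      pred-< {zero}  m≢0 _ = contradiction refl m≢0
      pred-< {suc m} _   h = h
      gap+2≤ : suc (suc (gap A B P)) ℕ.≤ D A B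
      gap+2≤ = let P≢A , P≢B = gap≢⇒≢A g≢ in ℕ.≤∧≢⇒< (gap<AB P≢A P≢B) λ eq →
        contradiction (trans (odd-gap g≢) (cong odd (sym eq))) (b≢not-b (odd (gap A B P)))
        where
        b≢not-b : ∀ b → b ≢ not b
        b≢not-b true  ()
        b≢not-b false ()

  module _ {A B A′ B′ : Fin n} (A≢B : A ≢ B) (A′≢B′ : A′ ≢ B′) (different : ¬ ((A ≡ A′ × B ≡ B′) ⊎ (A ≡ B′ × B ≡ A′))) where

    class-bound : ∀ i j → AtMost 4 (λ P → ((Regular A≢B P × Regular A′≢B′ P) × index A≢B P ≡ i) × index A′≢B′ P ≡ j)
    class-bound i j []                      _ _ = ℕ.z≤n
    class-bound i j (_ ∷ [])                _ _ = ℕ.s≤s ℕ.z≤n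
    class-bound i j (_ ∷ _ ∷ [])            _ _ = ℕ.s≤s (ℕ.s≤s ℕ.z≤n)
    class-bound i j (_ ∷ _ ∷ _ ∷ [])        _ _ = ℕ.s≤s (ℕ.s≤s (ℕ.s≤s ℕ.z≤n))
    class-bound i j (_ ∷ _ ∷ _ ∷ _ ∷ [])    _ _ = ℕ.s≤s (ℕ.s≤s (ℕ.s≤s (ℕ.s≤s ℕ.z≤n)))
    class-bound i j (P₀ ∷ P₁ ∷ P₂ ∷ P₃ ∷ P₄ ∷ _)
      ((n₀₁ ∷ n₀₂ ∷ n₀₃ ∷ n₀₄ ∷ _) ∷ (n₁₂ ∷ n₁₃ ∷ n₁₄ ∷ _) ∷ (n₂₃ ∷ n₂₄ ∷ _) ∷ (n₃₄ ∷ _) ∷ _)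
      (c₀@(((r , r′) , _) , _) ∷ c₁ ∷ c₂ ∷ c₃ ∷ c₄ ∷ _) = contradiction
        (five-points A B A′ B′ A≢B A′≢B′ different
          (ℕ.n≢0⇒n>0 (proj₁ r)) (lt A≢B r) (ℕ.n≢0⇒n>0 (proj₁ r′)) (lt A′≢B′ r′)
          n₀₁ n₀₂ n₀₃ n₀₄ n₁₂ n₁₃ n₁₄ n₂₃ n₂₄ n₃₄
          λ { (inj₁ refl) → same c₀ ; (inj₂ (inj₁ refl)) → same c₁ ; (inj₂ (inj₂ (inj₁ refl))) → same c₂
            ; (inj₂ (inj₂ (inj₂ (inj₁ refl)))) → same c₃ ; (inj₂ (inj₂ (inj₂ (inj₂ refl)))) → same c₄ }) λ ()
      where
      lt : ∀ {A B P} (A≢B : A ≢ B) → Regular A≢B P → gap A B P ℕ.< D A B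
      lt A≢B (_ , g≢) = let P≢A , P≢B = gap≢⇒≢A A≢B g≢ in gap<AB A≢B P≢A P≢B
      same : ∀ {P} → ((Regular A≢B P × Regular A′≢B′ P) × index A≢B P ≡ i) × index A′≢B′ P ≡ j →
             gap A B P ≡ gap A B P₀ × gap A′ B′ P ≡ gap A′ B′ P₀
      same (((s , s′) , e) , e′) with c₀
      ... | ((_ , _) , e₀) , e₀′ = index-injective A≢B s r (trans e (sym e₀)) , index-injective A′≢B′ s′ r′ (trans e′ (sym e₀′))

    -- Apart from at most eight points, every point lies on one of τ hyperbolas with foci A, B
    -- and on one of τ hyperbolas with foci A′, B′.
    two-short-edges : ∀ τ → D A B ℕ.≤ suc (suc (τ ℕ.* 2)) → D A′ B′ ℕ.≤ suc (suc (τ ℕ.* 2)) → n ℕ.≤ 8 ℕ.+ τ ℕ.* (τ ℕ.* 4)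
    two-short-edges τ AB≤ AB≤′ = begin
      n  ≡⟨ length-tabulate id ⟨
      length xs₀  ≤⟨ drop-class p₁? (gap≡0-bound A≢B) u₀ ⟩
      2 ℕ.+ length xs₁  ≤⟨ ℕ.+-monoʳ-≤ 2 (drop-class p₂? (gap≡AB-bound A≢B) u₁) ⟩
      4 ℕ.+ length xs₂  ≤⟨ ℕ.+-monoʳ-≤ 4 (drop-class p₃? (gap≡0-bound A′≢B′) u₂) ⟩
      6 ℕ.+ length xs₃  ≤⟨ ℕ.+-monoʳ-≤ 6 (drop-class p₄? (gap≡AB-bound A′≢B′) u₃) ⟩
      8 ℕ.+ length xs₄  ≤⟨ ℕ.+-monoʳ-≤ 8 (fibres (index A≢B)
                                              (λ i ys u all → fibres (index A′≢B′) (class-bound i) τ ys u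
                                                (All.map (λ { (r@(_ , r′) , e) → (r , e) , index-< A′≢B′ AB≤′ r′ }) all))
                                              τ xs₄ u₄ regular) ⟩
      8 ℕ.+ τ ℕ.* (τ ℕ.* 4)  ∎
      where
      open ℕ.≤-Reasoning
      p₁? = λ P → gap A B P ℕ.≟ 0
      p₂? = λ P → gap A B P ℕ.≟ D A B
      p₃? = λ P → gap A′ B′ P ℕ.≟ 0
      p₄? = λ P → gap A′ B′ P ℕ.≟ D A′ B′
      xs₀ = allFin n
      xs₁ = filter (¬? ∘ p₁?) xs₀
      xs₂ = filter (¬? ∘ p₂?) xs₁
      xs₃ = filter (¬? ∘ p₃?) xs₂
      xs₄ = filter (¬? ∘ p₄?) xs₃
      u₀ = Unique.allFin⁺ n
      u₁ = Unique.filter⁺ (¬? ∘ p₁?) u₀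
      u₂ = Unique.filter⁺ (¬? ∘ p₂?) u₁
      u₃ = Unique.filter⁺ (¬? ∘ p₃?) u₂
      u₄ = Unique.filter⁺ (¬? ∘ p₄?) u₃
      a₁ = All.all-filter (¬? ∘ p₁?) xs₀
      a₂ = All.zip (All.filter⁺ (¬? ∘ p₂?) a₁ , All.all-filter (¬? ∘ p₂?) xs₁)
      a₃ = All.zip (All.filter⁺ (¬? ∘ p₃?) a₂ , All.all-filter (¬? ∘ p₃?) xs₂)
      a₄ = All.zip (All.filter⁺ (¬? ∘ p₄?) a₃ , All.all-filter (¬? ∘ p₄?) xs₃)
      regular : All (λ P → (Regular A≢B P × Regular A′≢B′ P) × index A≢B P ℕ.< τ) xs₄
      regular = All.map (λ { ((r , s) , s′) → (r , s , s′) , index-< A≢B AB≤ r }) a₄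

-- Heights of triangles

*-nonNegℤ : ∀ {i j} → + 0 ℤ.≤ i → + 0 ℤ.≤ j → + 0 ℤ.≤ i ℤ.* j
*-nonNegℤ {+ m} {+ n} _ _ = subst (+ 0 ℤ.≤_) (ℤ.pos-* m n) (ℤ.+≤+ ℕ.z≤n)

-- With e = a + b − c = x + 2, z = c − b and k = b − a the difference of the two sides
-- of the inequality is a polynomial in x, z, k with nonnegative coefficients.
module SortedSides (X Z K : ℤ) (0≤X : + 0 ℤ.≤ X) (0≤Z : + 0 ℤ.≤ Z) (0≤K : + 0 ℤ.≤ K) where
  open import Data.Integer.Base using (_+_; _*_; _-_; -_; _≤_)

  a b c : ℤ
  a = + 2 + X + Z
  b = a + K
  c = b + Z

  remainder : ℤ
  remainder = X * (+ 16 + + 40 * K + + 8 * (K * K) + + 48 * Z + + 64 * (Z * K) + + 8 * (Z * (K * K)) + + 48 * (Z * Z) + + 24 * (Z * (Z * K)) + + 16 * (Z * (Z * Z)) +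
      X * (+ 28 + + 32 * K + + 4 * (K * K) + + 56 * Z + + 28 * (Z * K) + + 28 * (Z * Z) +
        X * (+ 16 + + 8 * K + + 16 * Z + + 3 * X))) +
    K * (+ 16 + + 4 * K + + 32 * Z + + 8 * (Z * K) + + 16 * (Z * Z))

  expand : heron a b c ≡ + 4 * (c * c) * (+ 2 * a - + 1) + remainder
  expand = solve 3 (λ X Z K →
    let a = con (+ 2) :+ X :+ Z
        b = a :+ K
        c = b :+ Z
        t = a :* a :+ b :* b :- c :* c
    in n 4 :* (a :* a :* (b :* b)) :- t :* t :=
       n 4 :* (c :* c) :* (n 2 :* a :- n 1) :+
       (X :* (n 16 :+ n 40 :* K :+ n 8 :* (K :* K) :+ n 48 :* Z :+ n 64 :* (Z :* K) :+ n 8 :* (Z :* (K :* K)) :+ n 48 :* (Z :* Z) :+ n 24 :* (Z :* (Z :* K)) :+ n 16 :* (Z :* (Z :* Z)) :+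
         X :* (n 28 :+ n 32 :* K :+ n 4 :* (K :* K) :+ n 56 :* Z :+ n 28 :* (Z :* K) :+ n 28 :* (Z :* Z) :+
           X :* (n 16 :+ n 8 :* K :+ n 16 :* Z :+ n 3 :* X))) :+
        K :* (n 16 :+ n 4 :* K :+ n 32 :* Z :+ n 8 :* (Z :* K) :+ n 16 :* (Z :* Z)))) refl X Z K
    where
    open ℤS
    n : ∀ {v} → ℕ → Polynomial v
    n m = con (+ m)

  infixl 6 _⊕_
  infixl 7 _⊗_

  _⊕_ : ∀ {i j} → + 0 ≤ i → + 0 ≤ j → + 0 ≤ i + j
  _⊕_ = ℤ.+-mono-≤

  _⊗_ : ∀ {i j} → + 0 ≤ i → + 0 ≤ j → + 0 ≤ i * j
  _⊗_ = *-nonNegℤ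

  n : ∀ m → + 0 ≤ + m
  n m = ℤ.+≤+ ℕ.z≤n

  0≤remainder : + 0 ≤ remainder
  0≤remainder = 0≤X ⊗ (n 16 ⊕ n 40 ⊗ 0≤K ⊕ n 8 ⊗ (0≤K ⊗ 0≤K) ⊕ n 48 ⊗ 0≤Z ⊕ n 64 ⊗ (0≤Z ⊗ 0≤K) ⊕ n 8 ⊗ (0≤Z ⊗ (0≤K ⊗ 0≤K)) ⊕ n 48 ⊗ (0≤Z ⊗ 0≤Z) ⊕ n 24 ⊗ (0≤Z ⊗ (0≤Z ⊗ 0≤K)) ⊕ n 16 ⊗ (0≤Z ⊗ (0≤Z ⊗ 0≤Z)) ⊕
      0≤X ⊗ (n 28 ⊕ n 32 ⊗ 0≤K ⊕ n 4 ⊗ (0≤K ⊗ 0≤K) ⊕ n 56 ⊗ 0≤Z ⊕ n 28 ⊗ (0≤Z ⊗ 0≤K) ⊕ n 28 ⊗ (0≤Z ⊗ 0≤Z) ⊕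
        0≤X ⊗ (n 16 ⊕ n 8 ⊗ 0≤K ⊕ n 16 ⊗ 0≤Z ⊕ n 3 ⊗ 0≤X))) ⊕
    0≤K ⊗ (n 16 ⊕ n 4 ⊗ 0≤K ⊕ n 32 ⊗ 0≤Z ⊕ n 8 ⊗ (0≤Z ⊗ 0≤K) ⊕ n 16 ⊗ (0≤Z ⊗ 0≤Z))

  sorted-bound : ∀ w → + suc w ≤ + 2 * a → + 4 * (c * c) * + w ≤ heron a b c
  sorted-bound w w< = ℤ.≤-trans (ℤ.*-monoˡ-≤-nonNeg (+ 4 * (c * c)) {{ℤ.nonNegative (n 4 ⊗ i*i-nonNeg c)}} w≤)
    (subst (+ 4 * (c * c) * (+ 2 * a - + 1) ≤_) (sym expand)
      (subst (_≤ + 4 * (c * c) * (+ 2 * a - + 1) + remainder) (ℤ.+-identityʳ (+ 4 * (c * c) * (+ 2 * a - + 1)))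
        (ℤ.+-monoʳ-≤ (+ 4 * (c * c) * (+ 2 * a - + 1)) 0≤remainder)))
    where
    w≤ : + w ≤ + 2 * a - + 1
    w≤ = ℤ.+-monoˡ-≤ (- (+ 1)) w<

record Sides (w a b c : ℕ) : Set where
  field
    parity : odd a xor odd b ≡ odd c
    a<     : a ℕ.< b ℕ.+ c
    b<     : b ℕ.< a ℕ.+ c
    c<     : c ℕ.< a ℕ.+ b
    w<a    : suc w ℕ.≤ 2 ℕ.* a
    w<b    : suc w ℕ.≤ 2 ℕ.* b
    w<c    : suc w ℕ.≤ 2 ℕ.* c

-- As `heron` is `16 S²` and `2 S` is a side times its height, this says that the height on a side
-- of length `y` has square at least `w`. It is strongest for the longest side.
record Tall (w a b c y : ℕ) : Set where
  constructor mkTall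
  field tall-≤heron : + 4 ℤ.* (+ y ℤ.* + y) ℤ.* + w ℤ.≤ heron (+ a) (+ b) (+ c)

heron-swap : ∀ a b c → heron a b c ≡ heron b a c
heron-swap = solve 3 (λ a b c → con (+ 4) :* (a :* a :* (b :* b)) :- (a :* a :+ b :* b :- c :* c) :* (a :* a :+ b :* b :- c :* c) :=
  con (+ 4) :* (b :* b :* (a :* a)) :- (b :* b :+ a :* a :- c :* c) :* (b :* b :+ a :* a :- c :* c)) refl
  where open ℤS

heron-swap′ : ∀ a b c → heron a b c ≡ heron a c b
heron-swap′ = solve 3 (λ a b c → con (+ 4) :* (a :* a :* (b :* b)) :- (a :* a :+ b :* b :- c :* c) :* (a :* a :+ b :* b :- c :* c) :=
  con (+ 4) :* (a :* a :* (c :* c)) :- (a :* a :+ c :* c :- b :* b) :* (a :* a :+ c :* c :- b :* b)) refl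
  where open ℤS

Sides-swap : ∀ {w a b c} → Sides w a b c → Sides w b a c
Sides-swap {w} {a} {b} {c} s = record
  { parity = trans (xor-comm (odd b) (odd a)) parity ; a< = b< ; b< = a< ; c< = subst (c ℕ.<_) (ℕ.+-comm a b) c<
  ; w<a = w<b ; w<b = w<a ; w<c = w<c }
  where
  open Sides s
  xor-comm : ∀ x y → x xor y ≡ y xor x
  xor-comm true  true  = refl
  xor-comm true  false = refl
  xor-comm false true  = refl
  xor-comm false false = refl

Sides-swap′ : ∀ {w a b c} → Sides w a b c → Sides w a c b
Sides-swap′ {w} {a} {b} {c} s = record
  { parity = xor-move (odd a) (odd b) (odd c) parity ; a< = subst (a ℕ.<_) (ℕ.+-comm b c) a< ; b< = c< ; c< = b<
  ; w<a = w<a ; w<b = w<c ; w<c = w<b }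
  where
  open Sides s
  xor-move : ∀ x y z → x xor y ≡ z → x xor z ≡ y
  xor-move true  true  false _ = refl
  xor-move true  false true  _ = refl
  xor-move false true  true  _ = refl
  xor-move false false false _ = refl

tall-sorted : ∀ {w a b c} → Sides w a b c → a ℕ.≤ b → b ℕ.≤ c → Tall w a b c c
tall-sorted {w} {a} {b} {c} s a≤b b≤c with ℕ.m≤n⇒∃[o]m+o≡n a≤b | ℕ.m≤n⇒∃[o]m+o≡n b≤c
... | k , refl | z , refl = result (ℕ.m≤n⇒∃[o]m+o≡n z<a)
  where
  open Sides s
  z<a : z ℕ.< a
  z<a = ℕ.+-cancelˡ-< (a ℕ.+ k) z a (subst (a ℕ.+ k ℕ.+ z ℕ.<_) (ℕ.+-comm a (a ℕ.+ k)) c<)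
  result : (∃[ o ] suc z ℕ.+ o ≡ a) → Tall w a (a ℕ.+ k) (a ℕ.+ k ℕ.+ z) (a ℕ.+ k ℕ.+ z)
  -- Since `a + b − c = a − z`, this is the case `a + b − c = 1` of an odd perimeter. Otherwise
  -- `a + b − c = x + 2`, as `SortedSides` requires.
  result (zero , refl) = contradiction (parity-clash (odd z) (odd (suc z ℕ.+ 0 ℕ.+ k)) _ odd-a parity (odd-+ (suc z ℕ.+ 0 ℕ.+ k) z)) λ ()
    where
    odd-a : odd (suc z ℕ.+ 0) ≡ not (odd z)
    odd-a = cong (odd ∘ suc) (ℕ.+-identityʳ z)
    parity-clash : ∀ {p} q r t → p ≡ not q → p xor r ≡ t → t ≡ r xor q → ⊥
    parity-clash true  true  _ refl refl ()
    parity-clash true  false _ refl refl ()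
    parity-clash false true  _ refl refl ()
    parity-clash false false _ refl refl ()
  result (suc x , refl) = subst (λ a → Tall w a (a ℕ.+ k) (a ℕ.+ k ℕ.+ z) (a ℕ.+ k ℕ.+ z)) a≡
      (mkTall (SortedSides.sorted-bound (+ x) (+ z) (+ k) (ℤ.+≤+ ℕ.z≤n) (ℤ.+≤+ ℕ.z≤n) (ℤ.+≤+ ℕ.z≤n) w (subst (+ suc w ℤ.≤_) (ℤ.pos-* 2 (2 ℕ.+ x ℕ.+ z)) (ℤ.+≤+ (subst (λ a → suc w ℕ.≤ 2 ℕ.* a) (sym a≡) w<a)))))
    where
    a≡ : 2 ℕ.+ x ℕ.+ z ≡ suc z ℕ.+ suc x
    a≡ = cong suc (trans (cong suc (ℕ.+-comm x z)) (sym (ℕ.+-suc z x)))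

tall-≤ : ∀ {w a b c y x} → y ℕ.≤ x → Tall w a b c x → Tall w a b c y
tall-≤ {w} {y = y} {c} y≤c (mkTall t) = mkTall (ℤ.≤-trans {j = + 4 ℤ.* (+ c ℤ.* + c) ℤ.* + w}
  (ℤ.*-monoʳ-≤-nonNeg (+ w) (ℤ.*-monoˡ-≤-nonNeg (+ 4) (+-square-mono y≤c))) t)

tall : ∀ {w a b c} → Sides w a b c → Tall w a b c a × Tall w a b c c
tall {w} {a} {b} {c} s with ℕ.≤-total a b | ℕ.≤-total b c | ℕ.≤-total a c
... | inj₁ a≤b | inj₁ b≤c | _ = tall-≤ (ℕ.≤-trans a≤b b≤c) t , t
  where t = tall-sorted s a≤b b≤c
... | inj₁ a≤b | inj₂ c≤b | inj₁ a≤c = back (tall-≤ a≤b t) , back (tall-≤ c≤b t)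
  where
  t = tall-sorted (Sides-swap′ s) a≤c c≤b
  back : ∀ {y} → Tall w a c b y → Tall w a b c y
  back {y} (mkTall h) = mkTall (subst (+ 4 ℤ.* (+ y ℤ.* + y) ℤ.* + w ℤ.≤_) (sym (heron-swap′ (+ a) (+ b) (+ c))) h)
... | inj₁ a≤b | inj₂ c≤b | inj₂ c≤a = back (tall-≤ a≤b t) , back (tall-≤ c≤b t)
  where
  t = tall-sorted (Sides-swap (Sides-swap′ s)) c≤a a≤b
  back : ∀ {y} → Tall w c a b y → Tall w a b c y
  back {y} (mkTall h) = mkTall (subst (+ 4 ℤ.* (+ y ℤ.* + y) ℤ.* + w ℤ.≤_) (sym (trans (heron-swap′ (+ a) (+ b) (+ c)) (heron-swap (+ a) (+ c) (+ b)))) h)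
... | inj₂ b≤a | _ | inj₁ a≤c = back (tall-≤ a≤c t) , back t
  where
  t = tall-sorted (Sides-swap s) b≤a a≤c
  back : ∀ {y} → Tall w b a c y → Tall w a b c y
  back {y} (mkTall h) = mkTall (subst (+ 4 ℤ.* (+ y ℤ.* + y) ℤ.* + w ℤ.≤_) (sym (heron-swap (+ a) (+ b) (+ c))) h)
... | inj₂ b≤a | inj₁ b≤c | inj₂ c≤a = back t , back (tall-≤ c≤a t)
  where
  t = tall-sorted (Sides-swap′ (Sides-swap s)) b≤c c≤a
  back : ∀ {y} → Tall w b c a y → Tall w a b c y
  back {y} (mkTall h) = mkTall (subst (+ 4 ℤ.* (+ y ℤ.* + y) ℤ.* + w ℤ.≤_) (sym (trans (heron-swap (+ a) (+ b) (+ c)) (heron-swap′ (+ b) (+ a) (+ c)))) h)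
... | inj₂ b≤a | inj₂ c≤b | inj₂ c≤a = back t , back (tall-≤ c≤a t)
  where
  t = tall-sorted (Sides-swap (Sides-swap′ (Sides-swap s))) c≤b b≤a
  back : ∀ {y} → Tall w c b a y → Tall w a b c y
  back {y} (mkTall h) = mkTall (subst (+ 4 ℤ.* (+ y ℤ.* + y) ℤ.* + w ℤ.≤_) (sym (trans (heron-swap (+ a) (+ b) (+ c)) (trans (heron-swap′ (+ b) (+ a) (+ c)) (heron-swap (+ b) (+ c) (+ a))))) h)

module _ where
  open import Data.Integer.Base using (_+_; _*_; _-_; -_; _≤_; _<_)
  open ℤS
  open ℤ.≤-Reasoning

  square-cancel-≤ : ∀ {i j} → + 0 ≤ j → i * i ≤ j * j → i ≤ j
  square-cancel-≤ {i} {j} 0≤j h = ℤ.≮⇒≥ λ j<i → ℤ.<-irrefl refl (begin-strict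
    i * i  ≤⟨ h ⟩
    j * j  ≤⟨ ℤ.*-monoˡ-≤-nonNeg j {{ℤ.nonNegative 0≤j}} (ℤ.<⇒≤ j<i) ⟩
    j * i  <⟨ ℤ.*-monoʳ-<-pos i {{ℤ.positive (ℤ.≤-<-trans 0≤j j<i)}} j<i ⟩
    i * i  ∎)

  -- The squared form of adding `√W ≤ √N x` and `j √W ≤ √N y`. The mixed term `j W ≤ N x y` is the
  -- root of the product of the hypotheses.
  minkowski : ∀ N W x y j → + 0 ≤ N → + 0 ≤ W → + 0 ≤ x → + 0 ≤ y → + 0 ≤ j →
    W ≤ N * (x * x) → j * j * W ≤ N * (y * y) → (+ 1 + j) * (+ 1 + j) * W ≤ N * ((x + y) * (x + y))
  minkowski N W x y j 0≤N 0≤W 0≤x 0≤y 0≤j hx hy = begin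
    (+ 1 + j) * (+ 1 + j) * W
      ≡⟨ solve 2 (λ j W → (con (+ 1) :+ j) :* (con (+ 1) :+ j) :* W := W :+ j :* j :* W :+ con (+ 2) :* (j :* W)) refl j W ⟩
    W + j * j * W + + 2 * (j * W)
      ≤⟨ ℤ.+-mono-≤ (ℤ.+-mono-≤ hx hy) (ℤ.*-monoˡ-≤-nonNeg (+ 2) mixed) ⟩
    N * (x * x) + N * (y * y) + + 2 * (N * (x * y))
      ≡⟨ solve 3 (λ N x y → N :* (x :* x) :+ N :* (y :* y) :+ con (+ 2) :* (N :* (x :* y)) := N :* ((x :+ y) :* (x :+ y))) refl N x y ⟩
    N * ((x + y) * (x + y)) ∎
    where
    mixed : j * W ≤ N * (x * y)
    mixed = square-cancel-≤ (*-nonNegℤ 0≤N (*-nonNegℤ 0≤x 0≤y)) (begin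
      j * W * (j * W)  ≡⟨ solve 2 (λ j W → j :* W :* (j :* W) := W :* (j :* j :* W)) refl j W ⟩
      W * (j * j * W)  ≤⟨ ℤ.*-monoˡ-≤-nonNeg W {{ℤ.nonNegative 0≤W}} hy ⟩
      W * (N * (y * y))  ≤⟨ ℤ.*-monoʳ-≤-nonNeg (N * (y * y)) {{ℤ.nonNegative (*-nonNegℤ 0≤N (i*i-nonNeg y))}} hx ⟩
      N * (x * x) * (N * (y * y))  ≡⟨ solve 3 (λ N x y → N :* (x :* x) :* (N :* (y :* y)) := N :* (x :* y) :* (N :* (x :* y))) refl N x y ⟩
      N * (x * y) * (N * (x * y))  ∎)

module Strips {n q} {D : Fin n → Fin n → ℕ} (isD : IsDistanceMatrix q D) (q≢0 : q % 4 ≢ 0) (q≢3 : q % 4 ≢ 3)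
  (coords : Coordinates D) (w : ℕ) where
  open IsDistanceMatrix isD
  open Coordinates coords
  open Conics using (det)
  open Scales isD q≢0 q≢3 using (triangle-parity)
  open import Data.Integer.Base using (_+_; _*_; _-_; -_; _≤_; _<_)
  open ℤS
  open ℤ.≤-Reasoning

  Far : Fin n → Fin n → Set
  Far i j = i ≢ j × suc w ℕ.≤ 2 ℕ.* D i j

  Far-sym : ∀ {i j} → Far i j → Far j i
  Far-sym {i} {j} (i≢j , w<) = (λ j≡i → i≢j (sym j≡i)) , subst (λ d → suc w ℕ.≤ 2 ℕ.* d) (D-sym i j) w<

  sides : ∀ {i j k} → Far i j → Far j k → Far i k → Sides w (D i j) (D i k) (D j k)
  sides {i} {j} {k} (i≢j , ij) (j≢k , jk) (i≢k , ik) = record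
    { parity = triangle-parity 1 (i≢j , j≢k , i≢k) (sym (ℕ.*-identityˡ _)) (sym (ℕ.*-identityˡ _)) (sym (ℕ.*-identityˡ _))
    ; a< = ℕ.≤-<-trans (ℕ.m≤n+∣m-n∣ a b) (ℕ.+-monoʳ-< b ab<c)
    ; b< = ℕ.≤-<-trans (ℕ.m≤n+∣n-m∣ b a) (ℕ.+-monoʳ-< a ab<c)
    ; c< = ℕ.≤-<-trans (ℕ.m≤n+∣n-m∣ c a) (ℕ.+-monoʳ-< a ac<b)
    ; w<a = ij ; w<b = ik ; w<c = jk }
    where
    a b c : ℕ
    a = D i j
    b = D i k
    c = D j k
    0<heron : + 0 < heron (+ a) (+ b) (+ c)
    0<heron = ∼⇒0< (heron≢0 i≢j j≢k i≢k) (heron-commensurable i j k)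
    ab<c : ℕ.∣ a - b ∣ ℕ.< c
    ab<c = ∣a-b∣<c a b c 0<heron
    ac<b : ℕ.∣ a - c ∣ ℕ.< b
    ac<b = ∣a-b∣<c a c b (subst (+ 0 <_) (heron-swap′ (+ a) (+ b) (+ c)) 0<heron)

  0≤N : + 0 ≤ N
  0≤N = ℤ.<⇒≤ 0<N

  Y²≤ : ∀ i j {y} → D i j ℕ.≤ y → (Y i - Y j) * (Y i - Y j) ≤ κ * (+ y * + y)
  Y²≤ i j {y} ≤y = begin
    (Y i - Y j) * (Y i - Y j)  ≡⟨ ℤ.+-identityˡ ((Y i - Y j) * (Y i - Y j)) ⟨
    + 0 + (Y i - Y j) * (Y i - Y j)  ≤⟨ ℤ.+-monoˡ-≤ ((Y i - Y j) * (Y i - Y j)) (*-nonNegℤ 0≤N (i*i-nonNeg (X i - X j))) ⟩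
    N * ((X i - X j) * (X i - X j)) + (Y i - Y j) * (Y i - Y j) ≡⟨ metric i j ⟩
    κ * (+ D i j * + D i j)  ≤⟨ ℤ.*-monoˡ-≤-nonNeg κ {{ℤ.nonNegative (ℤ.<⇒≤ 0<κ)}} (+-square-mono ≤y) ⟩
    κ * (+ y * + y)  ∎

  X²≤ : ∀ i j → N * ((X i - X j) * (X i - X j)) ≤ κ * (+ D i j * + D i j)
  X²≤ i j = begin
    N * ((X i - X j) * (X i - X j))  ≡⟨ ℤ.+-identityʳ (N * ((X i - X j) * (X i - X j))) ⟨
    N * ((X i - X j) * (X i - X j)) + + 0  ≤⟨ ℤ.+-monoʳ-≤ (N * ((X i - X j) * (X i - X j))) (i*i-nonNeg (Y i - Y j)) ⟩
    N * ((X i - X j) * (X i - X j)) + (Y i - Y j) * (Y i - Y j) ≡⟨ metric i j ⟩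
    κ * (+ D i j * + D i j)  ∎

  -- The line through the middle vertex cuts the triangle into two triangles with a common
  -- base, which is at most as long as a side from the middle vertex.
  det²≤ : ∀ {i j k} t → X i ≤ X j → X j ≤ X k → (Y i - Y j) * (Y i - Y j) ≤ t → (Y j - Y k) * (Y j - Y k) ≤ t →
    det (X i) (Y i) (X j) (Y j) (X k) (Y k) * det (X i) (Y i) (X j) (Y j) (X k) (Y k) ≤ (X k - X i) * (X k - X i) * t
  det²≤ {i} {j} {k} t Xi≤Xj Xj≤Xk h₁ h₂ = ℤ.0≤i-j⇒j≤i (subst (+ 0 ≤_) (sym (identity (X i) (X j) (X k) (Y i) (Y j) (Y k) t))
    (ℤ.+-mono-≤ (ℤ.+-mono-≤ (*-nonNegℤ (i*i-nonNeg (X k - X j)) t₁) (*-nonNegℤ (i*i-nonNeg (X j - X i)) t₂))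
      (*-nonNegℤ (*-nonNegℤ (ℤ.i≤j⇒0≤j-i Xj≤Xk) (ℤ.i≤j⇒0≤j-i Xi≤Xj))
        (ℤ.+-mono-≤ (ℤ.+-mono-≤ t₁ t₂) (i*i-nonNeg ((Y i - Y j) + (Y j - Y k)))))))
    where
    t₁ : + 0 ≤ t - (Y i - Y j) * (Y i - Y j)
    t₁ = ℤ.i≤j⇒0≤j-i h₁
    t₂ : + 0 ≤ t - (Y j - Y k) * (Y j - Y k)
    t₂ = ℤ.i≤j⇒0≤j-i h₂
    identity : ∀ x₁ x₂ x₃ y₁ y₂ y₃ t →
      (x₃ - x₁) * (x₃ - x₁) * t - det x₁ y₁ x₂ y₂ x₃ y₃ * det x₁ y₁ x₂ y₂ x₃ y₃ ≡
      (x₃ - x₂) * (x₃ - x₂) * (t - (y₁ - y₂) * (y₁ - y₂)) + (x₂ - x₁) * (x₂ - x₁) * (t - (y₂ - y₃) * (y₂ - y₃)) +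
      (x₃ - x₂) * (x₂ - x₁) * ((t - (y₁ - y₂) * (y₁ - y₂)) + (t - (y₂ - y₃) * (y₂ - y₃)) + ((y₁ - y₂) + (y₂ - y₃)) * ((y₁ - y₂) + (y₂ - y₃)))
    identity = solve 7 (λ x₁ x₂ x₃ y₁ y₂ y₃ t →
      let d = (x₂ :- x₁) :* (y₃ :- y₁) :- (x₃ :- x₁) :* (y₂ :- y₁)
          u = t :- (y₁ :- y₂) :* (y₁ :- y₂)
          v = t :- (y₂ :- y₃) :* (y₂ :- y₃)
          s = (y₁ :- y₂) :+ (y₂ :- y₃)
      in (x₃ :- x₁) :* (x₃ :- x₁) :* t :- d :* d :=
         (x₃ :- x₂) :* (x₃ :- x₂) :* u :+ (x₂ :- x₁) :* (x₂ :- x₁) :* v :+ (x₃ :- x₂) :* (x₂ :- x₁) :* (u :+ v :+ s :* s)) refl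

  -- Let `y` be the longer side at the middle vertex. The chord through this vertex perpendicular to
  -- the projection axis has length at most `y`, so the extent along the axis is at least the height
  -- on a side of length `y`. In formulas, `tall-y`, `det-heron` and `det²≤` are combined, and the
  -- factor `4 κ y²` cancels.
  width : ∀ {i j k} → Far i j → Far j k → Far i k → X i ≤ X j → X j ≤ X k → κ * + w ≤ N * ((X k - X i) * (X k - X i))
  width {i} {j} {k} ij jk ik Xi≤Xj Xj≤Xk = ℤ.*-cancelˡ-≤-pos (κ * + w) (N * ((X k - X i) * (X k - X i))) m {{ℤ.positive 0<m}} (begin
      m * (κ * + w)
        ≡⟨ solve 3 (λ κ M w → con (+ 4) :* κ :* M :* (κ :* w) := κ :* κ :* (con (+ 4) :* M :* w)) refl κ (+ y * + y) (+ w) ⟩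
      κ * κ * (+ 4 * (+ y * + y) * + w)
        ≤⟨ ℤ.*-monoˡ-≤-nonNeg (κ * κ) {{ℤ.nonNegative (i*i-nonNeg κ)}} tall-y ⟩
      κ * κ * heron (+ D i j) (+ D i k) (+ D j k)
        ≡⟨ det-heron i j k ⟨
      + 4 * N * (d * d)
        ≤⟨ ℤ.*-monoˡ-≤-nonNeg (+ 4 * N) {{ℤ.nonNegative (*-nonNegℤ {+ 4} (ℤ.+≤+ ℕ.z≤n) 0≤N)}}
             (det²≤ {i} {j} {k} (κ * (+ y * + y)) Xi≤Xj Xj≤Xk (Y²≤ i j (ℕ.m≤m⊔n (D i j) (D j k))) (Y²≤ j k (ℕ.m≤n⊔m (D i j) (D j k)))) ⟩
      + 4 * N * ((X k - X i) * (X k - X i) * (κ * (+ y * + y)))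
        ≡⟨ solve 4 (λ N x κ M → con (+ 4) :* N :* (x :* (κ :* M)) := con (+ 4) :* κ :* M :* (N :* x)) refl N ((X k - X i) * (X k - X i)) κ (+ y * + y) ⟩
      m * (N * ((X k - X i) * (X k - X i))) ∎)
    where
    d : ℤ
    d = det (X i) (Y i) (X j) (Y j) (X k) (Y k)
    y : ℕ
    -- `det²≤` needs one bound for both sides at the middle vertex, and `Tall` needs the length of
    -- an actual side; the maximum is both.
    y = D i j ℕ.⊔ D j k
    m : ℤ
    m = + 4 * κ * (+ y * + y)
    0<y : + 0 < + y
    0<y = ℤ.+<+ (ℕ.<-≤-trans (D-pos (proj₁ ij)) (ℕ.m≤m⊔n (D i j) (D j k)))
    0<m : + 0 < m
    0<m = 0<i*j (0<i*j {+ 4} (ℤ.+<+ (ℕ.s≤s ℕ.z≤n)) 0<κ) (0<i*j 0<y 0<y)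
    tall-y : + 4 * (+ y * + y) * + w ≤ heron (+ D i j) (+ D i k) (+ D j k)
    tall-y with ℕ.⊔-sel (D i j) (D j k)
    ... | inj₁ eq = subst (λ y → + 4 * (+ y * + y) * + w ≤ heron (+ D i j) (+ D i k) (+ D j k)) (sym eq) (Tall.tall-≤heron (proj₁ (tall (sides ij jk ik))))
    ... | inj₂ eq = subst (λ y → + 4 * (+ y * + y) * + w ≤ heron (+ D i j) (+ D i k) (+ D j k)) (sym eq) (Tall.tall-≤heron (proj₂ (tall (sides ij jk ik))))

  -- A step from `p` to `b` over the intermediate point `a` gains one width. Successive triples
  -- share an end point, so each gain costs two further points.
  climb : ∀ k p xs → AllPairs Far (p ∷ xs) → Linked (λ i j → X i ≤ X j) (p ∷ xs) → k ℕ.* 2 ℕ.≤ length xs →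
          ∃[ r ] X p ≤ X r × + k * + k * (κ * + w) ≤ N * ((X r - X p) * (X r - X p))
  climb zero p xs _ _ _ = p , ℤ.≤-refl , *-nonNegℤ 0≤N (i*i-nonNeg (X p - X p))
  climb (suc k) p (a ∷ b ∷ xs) ((pa ∷ pb ∷ _) ∷ (ab ∷ _) ∷ far) (p≤a ∷ a≤b ∷ sorted) (ℕ.s≤s (ℕ.s≤s size)) =
    let r , b≤r , h = climb k b xs far sorted size
        p≤b = ℤ.≤-trans p≤a a≤b
    in r , ℤ.≤-trans p≤b b≤r , subst (λ t → + suc k * + suc k * (κ * + w) ≤ N * (t * t))
         (solve 3 (λ p b r → (b :- p) :+ (r :- b) := r :- p) refl (X p) (X b) (X r))
         (minkowski N (κ * + w) (X b - X p) (X r - X b) (+ k) 0≤N (*-nonNegℤ (ℤ.<⇒≤ 0<κ) (ℤ.+≤+ ℕ.z≤n))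
           (ℤ.i≤j⇒0≤j-i p≤b) (ℤ.i≤j⇒0≤j-i b≤r) (ℤ.+≤+ ℕ.z≤n) (width pa ab pb p≤a a≤b) h)
  climb (suc k) p []       _ _ ()
  climb (suc k) p (_ ∷ []) _ _ (ℕ.s≤s ())

  module S = Sort (On.decTotalOrder ℤ.≤-decTotalOrder X)

  spread : ∀ {d} → (∀ i j → D i j ℕ.≤ d) → ∀ k xs → AllPairs Far xs → suc (k ℕ.* 2) ℕ.≤ length xs → k ℕ.* k ℕ.* w ℕ.≤ d ℕ.* d
  spread {d} D≤d k xs far size = go (S.sort xs) (S.sort-↗ xs)
      (Permutation.AllPairs-resp-↭ (setoid (Fin n)) Far-sym (resp₂ Far) (↭⇒↭ₛ (↭-sym (S.sort-↭ xs))) far)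
      (ℕ.≤-trans size (ℕ.≤-reflexive (sym (↭-length (S.sort-↭ xs)))))
    where
    go : ∀ ys → Linked (λ i j → X i ≤ X j) ys → AllPairs Far ys → suc (k ℕ.* 2) ℕ.≤ length ys → k ℕ.* k ℕ.* w ℕ.≤ d ℕ.* d
    go (p ∷ ys) sorted far (ℕ.s≤s size) with climb k p ys far sorted size
    ... | r , _ , h = ℤ.drop‿+≤+ (ℤ.*-cancelˡ-≤-pos (+ (k ℕ.* k ℕ.* w)) (+ (d ℕ.* d)) κ {{ℤ.positive 0<κ}} (begin
      κ * + (k ℕ.* k ℕ.* w)  ≡⟨ cong (κ *_) (trans (ℤ.pos-* (k ℕ.* k) w) (cong (_* + w) (ℤ.pos-* k k))) ⟩
      κ * (+ k * + k * + w)  ≡⟨ solve 3 (λ κ k w → κ :* (k :* k :* w) := k :* k :* (κ :* w)) refl κ (+ k) (+ w) ⟩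
      + k * + k * (κ * + w)  ≤⟨ h ⟩
      N * ((X r - X p) * (X r - X p))  ≤⟨ X²≤ r p ⟩
      κ * (+ D r p * + D r p)  ≤⟨ ℤ.*-monoˡ-≤-nonNeg κ {{ℤ.nonNegative (ℤ.<⇒≤ 0<κ)}} (+-square-mono (D≤d r p)) ⟩
      κ * (+ d * + d)  ≡⟨ cong (κ *_) (ℤ.pos-* d d) ⟨
      κ * + (d ℕ.* d)  ∎))

unique⇒all-pairs : ∀ {A : Set} {P : A → Set} {R : A → A → Set} → (∀ {x y} → P x → P y → x ≢ y → R x y) →
                   ∀ {xs} → Unique xs → All P xs → AllPairs R xs
unique⇒all-pairs h []       []       = []
unique⇒all-pairs h (x∉ ∷ u) (px ∷ p) = All.zipWith (λ { (x≢y , py) → h px py x≢y }) (x∉ , p) ∷ unique⇒all-pairs h u p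

-- Bounds for the diameter in the separate ranges of `n`

module Diameter {n q} {D : Fin n → Fin n → ℕ} (isD : IsDistanceMatrix q D) (q≢0 : q % 4 ≢ 0) (q≢3 : q % 4 ≢ 3)
  {d : ℕ} (D≤d : ∀ i j → D i j ℕ.≤ d) where
  open Scales isD q≢0 q≢3
  open Bounds d D≤d

  class-bound⇒ : ∀ {k f} → k ℕ.≤ n → Bound k f → f ℕ.≤ d
  class-bound⇒ {k} {f} k≤n bound = subst (ℕ._≤ d) (ℕ.*-identityʳ f)
    (bound 1 (allFin n , subst (k ℕ.≤_) (sym (length-tabulate id)) k≤n , Unique.allFin⁺ n , λ _ _ → 1∣ _))

  module _ (coords : Coordinates D) where
    open Hyperbolic isD q≢0 q≢3 coords using (two-short-edges)

    long-edge : ∀ τ i j → ¬ D i j ℕ.≤ suc (suc (τ ℕ.* 2)) → suc (4 ℕ.* τ ℕ.+ 5) ℕ.≤ 2 ℕ.* D i j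
    long-edge τ i j long = ℕ.≤-trans
      (ℕ.≤-reflexive (solve 1 (λ τ → con 1 :+ (con 4 :* τ :+ con 5) := con 2 :* (con 3 :+ τ :* con 2)) refl τ))
      (ℕ.*-monoʳ-≤ 2 (ℕ.≰⇒> long))
      where open ℕS

    -- By `two-short-edges` there is at most one short edge, so removing one of its ends leaves
    -- none.
    far-points : ∀ τ → 8 ℕ.+ τ ℕ.* (τ ℕ.* 4) ℕ.< n → let open Strips isD q≢0 q≢3 coords (4 ℕ.* τ ℕ.+ 5) in
                 ∃[ xs ] AllPairs Far xs × n ℕ.≤ suc (length xs)
    far-points τ τ<n with Fin.any? (λ A → Fin.any? (λ B → short? A B))
      where
      short? : ∀ A B → _
      short? A B = ¬? (A Fin.≟ B) ×-dec (D A B ℕ.≤? suc (suc (τ ℕ.* 2)))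
    -- No point has to be excluded; `λ _ → Fin n` serves as a predicate that every point satisfies.
    ... | no none = allFin n , unique⇒all-pairs {P = λ _ → Fin n} (λ {i} {j} _ _ i≢j → i≢j , long-edge τ i j λ short → none (i , j , i≢j , short))
            (Unique.allFin⁺ n) (All.universal (λ i → i) (allFin n)) , ℕ.m≤n⇒m≤1+n (ℕ.≤-reflexive (sym (length-tabulate id)))
    ... | yes (A , B , A≢B , AB≤) = remove A (allFin n) , unique⇒all-pairs {P = _≢ A}
            (λ {i} {j} i≢A j≢A i≢j → i≢j , long-edge τ i j λ short → ℕ.<⇒≱ τ<n
              (two-short-edges A≢B i≢j (λ { (inj₁ (refl , _)) → i≢A refl ; (inj₂ (refl , _)) → j≢A refl }) τ AB≤ short))
            (remove-unique A (Unique.allFin⁺ n)) (All.all-filter (λ i → ¬? (i Fin.≟ A)) (allFin n)) ,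
          ℕ.≤-trans (ℕ.≤-reflexive (sym (length-tabulate id))) (length-remove A (Unique.allFin⁺ n))

    many-points : ∀ τ k → 8 ℕ.+ τ ℕ.* (τ ℕ.* 4) ℕ.< n → suc (suc (k ℕ.* 2)) ℕ.≤ n → k ℕ.* k ℕ.* (4 ℕ.* τ ℕ.+ 5) ℕ.≤ d ℕ.* d
    many-points τ k τ<n k≤n = let xs , far , size = far-points τ τ<n in
      Strips.spread isD q≢0 q≢3 coords (4 ℕ.* τ ℕ.+ 5) D≤d k xs far (ℕ.≤-pred (ℕ.≤-trans k≤n size))

  -- b = 25 and c = 36⁵ are kept abstract, so that products by them are never unfolded.
  module _ (b c : ℕ) where

    Conclusion : Set
    Conclusion = (b ℕ.* n) ℕ.^ 5 ℕ.≤ c ℕ.* d ℕ.^ 4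

    -- The left side of the conclusion grows with `n`, so a whole range of `n` is settled by the
    -- numerical inequality at its upper end `m`.
    at-least : ∀ m f → n ℕ.≤ m → (b ℕ.* m) ℕ.^ 5 ℕ.≤ c ℕ.* f ℕ.^ 4 → f ℕ.≤ d → Conclusion
    at-least m f n≤m h f≤d = ℕ.≤-trans (ℕ.^-monoˡ-≤ 5 (ℕ.*-monoʳ-≤ b n≤m))
      (ℕ.≤-trans h (ℕ.*-monoʳ-≤ c (ℕ.^-monoˡ-≤ 4 f≤d)))

    square-bound : ∀ s → s ℕ.≤ d ℕ.* d → (b ℕ.* n) ℕ.^ 5 ℕ.≤ c ℕ.* (s ℕ.* s) → Conclusion
    square-bound s s≤ h = ℕ.≤-trans h (ℕ.*-monoʳ-≤ c (ℕ.≤-trans (ℕ.*-mono-≤ s≤ s≤)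
      (ℕ.≤-reflexive (ℕS.solve 1 (λ d → d :* d :* (d :* d) := d :^ 4) refl d))))
      where open ℕS

-- The largest `τ` with `8 + 4 τ² < n`, found by induction on `n`. The start 45 is the first `n`
-- that admits `τ = 3`, because `8 + 4 · 9 = 44`.
threshold : ∀ m → ∃[ τ ] 3 ℕ.≤ τ × 8 ℕ.+ τ ℕ.* (τ ℕ.* 4) ℕ.< 45 ℕ.+ m × 45 ℕ.+ m ℕ.≤ 8 ℕ.+ suc τ ℕ.* (suc τ ℕ.* 4)
threshold zero = 3 , ℕ.≤-refl , ℕ.≤-refl , from-yes (45 ℕ.≤? 72)
threshold (suc m) with threshold m
... | τ , 3≤τ , lo , hi with 45 ℕ.+ suc m ℕ.≤? 8 ℕ.+ suc τ ℕ.* (suc τ ℕ.* 4)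
...   | yes hi′ = τ , 3≤τ , ℕ.≤-trans lo (ℕ.≤-trans (ℕ.n≤1+n (45 ℕ.+ m)) (ℕ.≤-reflexive (sym (ℕ.+-suc 45 m)))) , hi′
...   | no ≰ = suc τ , ℕ.m≤n⇒m≤1+n 3≤τ , ℕ.≰⇒> ≰ ,
        ℕ.≤-trans (ℕ.≤-reflexive (ℕ.+-suc 45 m)) (ℕ.≤-trans (ℕ.s≤s hi)
          (ℕ.≤-trans (ℕ.m≤m+n (suc (8 ℕ.+ suc τ ℕ.* (suc τ ℕ.* 4))) (11 ℕ.+ 8 ℕ.* τ))
            (ℕ.≤-reflexive (solve 1 (λ τ → con 9 :+ (con 1 :+ τ) :* ((con 1 :+ τ) :* con 4) :+ (con 11 :+ con 8 :* τ) :=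
              con 8 :+ (con 2 :+ τ) :* ((con 2 :+ τ) :* con 4)) refl τ))))
  where open ℕS

halves : ∀ m → ∃[ k ] suc (suc (k ℕ.* 2)) ℕ.≤ suc (suc m) × suc (suc m) ℕ.≤ suc (suc (suc (k ℕ.* 2)))
halves m with half m
... | inj₁ (k , refl , _) = k , ℕ.≤-refl , ℕ.n≤1+n _
... | inj₂ (k , refl , _) = k , ℕ.n≤1+n _ , ℕ.≤-refl

-- From `k ≥ (r / p) n` and `w² ≥ 4 n` it follows that `k⁴ w² ≥ 4 (r / p)⁴ n⁵`. Both sides now have
-- the same power of `n`, and a single inequality between constants remains.
power-estimate : ∀ b c p r .{{_ : NonZero r}} {n k w} → b ℕ.^ 5 ℕ.* p ℕ.^ 4 ℕ.≤ c ℕ.* (4 ℕ.* r ℕ.^ 4) →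
  r ℕ.* n ℕ.≤ p ℕ.* k → 4 ℕ.* n ℕ.≤ w ℕ.* w → (b ℕ.* n) ℕ.^ 5 ℕ.≤ c ℕ.* (k ℕ.* k ℕ.* w ℕ.* (k ℕ.* k ℕ.* w))
power-estimate b c p r {n} {k} {w} h rn≤pk 4n≤ww = ℕ.*-cancelʳ-≤ _ _ (r ℕ.^ 4) {{ℕ.m^n≢0 r 4}} (begin
  (b ℕ.* n) ℕ.^ 5 ℕ.* r ℕ.^ 4  ≡⟨ solve 3 (λ b n r → (b :* n) :^ 5 :* r :^ 4 := b :^ 5 :* n :* (r :* n) :^ 4) refl b n r ⟩
  b ℕ.^ 5 ℕ.* n ℕ.* (r ℕ.* n) ℕ.^ 4  ≤⟨ ℕ.*-monoʳ-≤ (b ℕ.^ 5 ℕ.* n) (ℕ.^-monoˡ-≤ 4 rn≤pk) ⟩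
  b ℕ.^ 5 ℕ.* n ℕ.* (p ℕ.* k) ℕ.^ 4  ≡⟨ solve 4 (λ b n p k → b :^ 5 :* n :* (p :* k) :^ 4 := b :^ 5 :* p :^ 4 :* (n :* k :^ 4)) refl b n p k ⟩
  b ℕ.^ 5 ℕ.* p ℕ.^ 4 ℕ.* (n ℕ.* k ℕ.^ 4)  ≤⟨ ℕ.*-monoˡ-≤ (n ℕ.* k ℕ.^ 4) h ⟩
  c ℕ.* (4 ℕ.* r ℕ.^ 4) ℕ.* (n ℕ.* k ℕ.^ 4)  ≡⟨ solve 4 (λ c r n k → c :* (con 4 :* r :^ 4) :* (n :* k :^ 4) := c :* (k :^ 4 :* r :^ 4) :* (con 4 :* n)) refl c r n k ⟩
  c ℕ.* (k ℕ.^ 4 ℕ.* r ℕ.^ 4) ℕ.* (4 ℕ.* n)  ≤⟨ ℕ.*-monoʳ-≤ (c ℕ.* (k ℕ.^ 4 ℕ.* r ℕ.^ 4)) 4n≤ww ⟩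
  c ℕ.* (k ℕ.^ 4 ℕ.* r ℕ.^ 4) ℕ.* (w ℕ.* w)  ≡⟨ solve 4 (λ c r k w → c :* (k :^ 4 :* r :^ 4) :* (w :* w) := c :* (k :* k :* w :* (k :* k :* w)) :* r :^ 4) refl c r k w ⟩
  c ℕ.* (k ℕ.* k ℕ.* w ℕ.* (k ℕ.* k ℕ.* w)) ℕ.* r ℕ.^ 4 ∎)
  where
  open ℕ.≤-Reasoning
  open ℕS

-- For `24 < n ≤ 44` the largest possible `τ` is 2, whence the factor `13 = 4 · 2 + 5`; `k` is the
-- largest value with `2 k + 2 ≤ n`. Here `n = 24 + i`.
mediumCheck : ℕ → ℕ → ℕ → Bool
mediumCheck b c i = (2 ℕ.+ k ℕ.* 2 ℕ.≤ᵇ 24 ℕ.+ i) ∧ ((b ℕ.* (24 ℕ.+ i)) ℕ.^ 5 ℕ.≤ᵇ c ℕ.* (k ℕ.* k ℕ.* 13 ℕ.* (k ℕ.* k ℕ.* 13)))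
  where k = ⌊ 22 ℕ.+ i /2⌋

record Numerals (b c : ℕ) : Set where
  field
    at₃    : (b ℕ.* 3) ℕ.^ 5 ℕ.≤ c ℕ.* 3 ℕ.^ 4
    at₄    : (b ℕ.* 4) ℕ.^ 5 ℕ.≤ c ℕ.* 5 ℕ.^ 4
    at₆    : (b ℕ.* 6) ℕ.^ 5 ℕ.≤ c ℕ.* 9 ℕ.^ 4
    at₈    : (b ℕ.* 8) ℕ.^ 5 ℕ.≤ c ℕ.* 10 ℕ.^ 4
    at₁₂   : (b ℕ.* 12) ℕ.^ 5 ℕ.≤ c ℕ.* 18 ℕ.^ 4
    at₁₅   : (b ℕ.* 15) ℕ.^ 5 ℕ.≤ c ℕ.* 20 ℕ.^ 4
    at₁₆   : (b ℕ.* 16) ℕ.^ 5 ℕ.≤ c ℕ.* 21 ℕ.^ 4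
    at₂₄   : (b ℕ.* 24) ℕ.^ 5 ℕ.≤ c ℕ.* 36 ℕ.^ 4
    medium : all≤ 20 (mediumCheck b c) ≡ true
    large  : b ℕ.^ 5 ℕ.* 15 ℕ.^ 4 ℕ.≤ c ℕ.* (4 ℕ.* 7 ℕ.^ 4)

numerals : Numerals 25 (36 ℕ.^ 5)
numerals = record
  { at₃    = from-yes ((25 ℕ.* 3) ℕ.^ 5 ℕ.≤? 36 ℕ.^ 5 ℕ.* 3 ℕ.^ 4)
  ; at₄    = from-yes ((25 ℕ.* 4) ℕ.^ 5 ℕ.≤? 36 ℕ.^ 5 ℕ.* 5 ℕ.^ 4)
  ; at₆    = from-yes ((25 ℕ.* 6) ℕ.^ 5 ℕ.≤? 36 ℕ.^ 5 ℕ.* 9 ℕ.^ 4)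
  ; at₈    = from-yes ((25 ℕ.* 8) ℕ.^ 5 ℕ.≤? 36 ℕ.^ 5 ℕ.* 10 ℕ.^ 4)
  ; at₁₂   = from-yes ((25 ℕ.* 12) ℕ.^ 5 ℕ.≤? 36 ℕ.^ 5 ℕ.* 18 ℕ.^ 4)
  ; at₁₅   = from-yes ((25 ℕ.* 15) ℕ.^ 5 ℕ.≤? 36 ℕ.^ 5 ℕ.* 20 ℕ.^ 4)
  ; at₁₆   = from-yes ((25 ℕ.* 16) ℕ.^ 5 ℕ.≤? 36 ℕ.^ 5 ℕ.* 21 ℕ.^ 4)
  ; at₂₄   = from-yes ((25 ℕ.* 24) ℕ.^ 5 ℕ.≤? 36 ℕ.^ 5 ℕ.* 36 ℕ.^ 4)
  ; medium = refl
  ; large  = from-yes (25 ℕ.^ 5 ℕ.* 15 ℕ.^ 4 ℕ.≤? 36 ℕ.^ 5 ℕ.* (4 ℕ.* 7 ℕ.^ 4))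
  }

∧-elim : ∀ {x y} → x ∧ y ≡ true → x ≡ true × y ≡ true
∧-elim {true} h = refl , h

≡true⇒≤ : ∀ {m n} → (m ℕ.≤ᵇ n) ≡ true → m ℕ.≤ n
≡true⇒≤ {m} {n} h = ℕ.≤ᵇ⇒≤ m n (subst T (sym h) _)

module Core {b c} (numerals : Numerals b c) {q} (q≢0 : q % 4 ≢ 0) (q≢3 : q % 4 ≢ 3) where
  open Numerals numerals

  module _ {m} {D : Fin (3 ℕ.+ m) → Fin (3 ℕ.+ m) → ℕ} (isD : IsDistanceMatrix q D) {d : ℕ} (D≤d : ∀ i j → D i j ℕ.≤ d) where
    open Diameter isD q≢0 q≢3 D≤d
    open Scales.Bounds isD q≢0 q≢3 d D≤d

    n : ℕ
    n = 3 ℕ.+ m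

    coords : Coordinates D
    coords = coordinates isD Fin.zero (Fin.suc Fin.zero) (Fin.suc (Fin.suc Fin.zero)) (λ ()) (λ ()) (λ ())

    -- The exceptional value between the ranges of the halving argument: `bound₁₃` gives only
    -- `d ≥ 20`, while `(25 · 16 / 36)^(5/4)` is about 20.28. Projection with `τ = 1` and `k = 7`
    -- just reaches `d² ≥ 49 · 9 = 21²`.
    sixteen : 16 ℕ.≤ n → n ℕ.≤ 16 → Conclusion b c
    sixteen 16≤n n≤16 = at-least b c 16 21 n≤16 at₁₆ (ℕ.≮⇒≥ λ d<21 → ℕ.<⇒≱ {400} {441} (from-yes (401 ℕ.≤? 441))
      (ℕ.≤-trans (many-points coords 1 7 (ℕ.≤-trans (from-yes (13 ℕ.≤? 16)) 16≤n) 16≤n)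
        (ℕ.*-mono-≤ (ℕ.≤-pred d<21) (ℕ.≤-pred d<21))))

    medium-case : ∀ i → n ≡ 24 ℕ.+ i → 0 ℕ.< i → i ℕ.≤ 20 → Conclusion b c
    medium-case i n≡ 0<i i≤20 with ∧-elim (all≤-sound 20 (mediumCheck b c) medium 0<i i≤20)
    ... | size , bound = square-bound b c (k ℕ.* k ℕ.* 13)
          (many-points coords 2 k (subst (24 ℕ.<_) (sym n≡) (ℕ.m<m+n 24 0<i)) (subst (2 ℕ.+ k ℕ.* 2 ℕ.≤_) (sym n≡) (≡true⇒≤ size)))
          (subst (λ n → (b ℕ.* n) ℕ.^ 5 ℕ.≤ c ℕ.* (k ℕ.* k ℕ.* 13 ℕ.* (k ℕ.* k ℕ.* 13))) (sym n≡) (≡true⇒≤ bound))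
      where
      k : ℕ
      k = ⌊ 22 ℕ.+ i /2⌋

    large-case : ∀ i → n ≡ 45 ℕ.+ i → Conclusion b c
    large-case i n≡ with threshold i | halves (suc m)
    ... | τ , 3≤τ , lo , hi | k , size , n≤ = square-bound b c (k ℕ.* k ℕ.* (4 ℕ.* τ ℕ.+ 5))
          (many-points coords τ k (subst (8 ℕ.+ τ ℕ.* (τ ℕ.* 4) ℕ.<_) (sym n≡) lo) size)
          (power-estimate b c 15 7 {n} {k} {4 ℕ.* τ ℕ.+ 5} large 7n≤15k (4n≤ τ 3≤τ (ℕ.≤-trans (ℕ.≤-reflexive n≡) hi)))
      where
      open ℕ.≤-Reasoning
      open ℕS
      -- The origin of 7 and 15: from `45 ≤ n ≤ 2 k + 3` comes `k ≥ 21`, so `3 ≤ k / 7` and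
      -- `n ≤ (15 / 7) k`.
      21≤k : 21 ℕ.≤ k
      21≤k = ℕ.*-cancelʳ-≤ 21 k 2 (ℕ.≤-pred (ℕ.≤-pred (ℕ.≤-pred (ℕ.≤-trans (ℕ.m≤m+n 45 i) (ℕ.≤-trans (ℕ.≤-reflexive (sym n≡)) n≤)))))
      7n≤15k : 7 ℕ.* n ℕ.≤ 15 ℕ.* k
      7n≤15k = begin
        7 ℕ.* n  ≤⟨ ℕ.*-monoʳ-≤ 7 n≤ ⟩
        7 ℕ.* suc (suc (suc (k ℕ.* 2)))  ≡⟨ solve 1 (λ k → con 7 :* (con 3 :+ k :* con 2) := con 14 :* k :+ con 21) refl k ⟩
        14 ℕ.* k ℕ.+ 21  ≤⟨ ℕ.+-monoʳ-≤ (14 ℕ.* k) 21≤k ⟩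
        14 ℕ.* k ℕ.+ k  ≡⟨ solve 1 (λ k → con 14 :* k :+ k := con 15 :* k) refl k ⟩
        15 ℕ.* k  ∎
      -- The square of `4 (τ + 1) + 1` exceeds `16 (τ + 1)²` by `8 (τ + 1) + 1`, which has to absorb
      -- `4 · 8 = 32`; this requires `τ ≥ 3`.
      4n≤ : ∀ {n} τ → 3 ℕ.≤ τ → n ℕ.≤ 8 ℕ.+ suc τ ℕ.* (suc τ ℕ.* 4) → 4 ℕ.* n ℕ.≤ (4 ℕ.* τ ℕ.+ 5) ℕ.* (4 ℕ.* τ ℕ.+ 5)
      4n≤ {n} (suc (suc (suc t))) _ n≤ = begin
        4 ℕ.* n  ≤⟨ ℕ.*-monoʳ-≤ 4 n≤ ⟩
        4 ℕ.* (8 ℕ.+ (4 ℕ.+ t) ℕ.* ((4 ℕ.+ t) ℕ.* 4))  ≤⟨ ℕ.m≤m+n _ (1 ℕ.+ 8 ℕ.* t) ⟩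
        4 ℕ.* (8 ℕ.+ (4 ℕ.+ t) ℕ.* ((4 ℕ.+ t) ℕ.* 4)) ℕ.+ (1 ℕ.+ 8 ℕ.* t)
          ≡⟨ solve 1 (λ t → con 4 :* (con 8 :+ (con 4 :+ t) :* ((con 4 :+ t) :* con 4)) :+ (con 1 :+ con 8 :* t) :=
               (con 4 :* (con 3 :+ t) :+ con 5) :* (con 4 :* (con 3 :+ t) :+ con 5)) refl t ⟩
        (4 ℕ.* (3 ℕ.+ t) ℕ.+ 5) ℕ.* (4 ℕ.* (3 ℕ.+ t) ℕ.+ 5)  ∎
      4n≤ (suc (suc zero)) (ℕ.s≤s (ℕ.s≤s ())) _
      4n≤ (suc zero) (ℕ.s≤s ()) _

    conclusion : Conclusion b c
    conclusion with n ℕ.≤? 3 | n ℕ.≤? 4 | n ℕ.≤? 6 | n ℕ.≤? 8 | n ℕ.≤? 12 | n ℕ.≤? 15 | n ℕ.≤? 16 | n ℕ.≤? 24 | n ℕ.≤? 44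
    ... | yes n≤ | _ | _ | _ | _ | _ | _ | _ | _ = at-least b c 3 3 n≤ at₃ (class-bound⇒ (ℕ.m≤m+n 3 m) bound₃)
    ... | no n≰ | yes n≤ | _ | _ | _ | _ | _ | _ | _ = at-least b c 4 5 n≤ at₄ (class-bound⇒ (ℕ.≰⇒> n≰) bound₄)
    ... | _ | no n≰ | yes n≤ | _ | _ | _ | _ | _ | _ = at-least b c 6 9 n≤ at₆ (class-bound⇒ (ℕ.≰⇒> n≰) bound₅)
    ... | _ | _ | no n≰ | yes n≤ | _ | _ | _ | _ | _ = at-least b c 8 10 n≤ at₈ (class-bound⇒ (ℕ.≰⇒> n≰) bound₇)
    ... | _ | _ | _ | no n≰ | yes n≤ | _ | _ | _ | _ = at-least b c 12 18 n≤ at₁₂ (class-bound⇒ (ℕ.≰⇒> n≰) bound₉)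
    ... | _ | _ | _ | _ | no n≰ | yes n≤ | _ | _ | _ = at-least b c 15 20 n≤ at₁₅ (class-bound⇒ (ℕ.≰⇒> n≰) bound₁₃)
    ... | _ | _ | _ | _ | _ | no n≰ | yes n≤ | _ | _ = sixteen (ℕ.≰⇒> n≰) n≤
    ... | _ | _ | _ | _ | _ | _ | no n≰ | yes n≤ | _ = at-least b c 24 36 n≤ at₂₄ (class-bound⇒ (ℕ.≰⇒> n≰) bound₁₇)
    ... | _ | _ | _ | _ | _ | _ | _ | no n≰ | yes n≤ = medium-case (n ℕ.∸ 24) (sym (ℕ.m+[n∸m]≡n (ℕ.<⇒≤ (ℕ.≰⇒> n≰))))
            (ℕ.m<n⇒0<n∸m (ℕ.≰⇒> n≰)) (ℕ.∸-monoˡ-≤ 24 n≤)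
    ... | _ | _ | _ | _ | _ | _ | _ | _ | no n≰ = large-case (n ℕ.∸ 45) (sym (ℕ.m+[n∸m]≡n (ℕ.≰⇒> n≰)))

diameter-bound : ∀ {n q} {D : Fin n → Fin n → ℕ} → IsDistanceMatrix q D → q % 4 ≢ 0 → q % 4 ≢ 3 → 3 ℕ.≤ n →
  ∀ d → (∀ i j → D i j ℕ.≤ d) → (25 ℕ.* n) ℕ.^ 5 ℕ.≤ 36 ℕ.^ 5 ℕ.* d ℕ.^ 4
diameter-bound {suc (suc (suc m))} isD q≢0 q≢3 3≤n d D≤d = Core.conclusion numerals q≢0 q≢3 isD D≤d
diameter-bound {suc (suc zero)} _ _ _ (ℕ.s≤s (ℕ.s≤s ()))
diameter-bound {suc zero} _ _ _ (ℕ.s≤s ())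

-- Real numbers

open import Defs
open Estimates
open CauchyEstimates

open import Algebra.Definitions.RawSemiring ℚ.+-*-rawSemiring using () renaming (_^_ to _^ℚ_)

≡⇒≈ : ∀ {x y} → (∀ n → seq x n ≡ seq y n) → x ≈ y
≡⇒≈ {x} {y} eq = mk≈ λ ε 0<ε → 0 , λ n _ → subst (ℚ._≤ ε)
  (sym (trans (cong (λ t → ∣ t ℚ.- seq y n ∣) (eq n)) (cong ∣_∣ (ℚ.+-inverseʳ (seq y n)))))
  (ℚ.<⇒≤ 0<ε)

≈-refl : ∀ {x} → x ≈ x
≈-refl = ≡⇒≈ λ _ → refl

≈-sym : ∀ {x y} → x ≈ y → y ≈ x
≈-sym {x} {y} h = mk≈ λ ε 0<ε → let N , near = eventually-near h ε 0<ε in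
  N , λ n ≤n → subst (ℚ._≤ ε) (∣-∣-sym (seq x n) (seq y n)) (near n ≤n)

+-cong : ∀ {x x′ y y′} → x ≈ x′ → y ≈ y′ → x + y ≈ x′ + y′
+-cong {x} {x′} {y} {y′} hx hy = mk≈ λ ε 0<ε →
  let M , dx = eventually-near hx (½ ℚ.* ε) (½-pos 0<ε)
      N , dy = eventually-near hy (½ ℚ.* ε) (½-pos 0<ε)
  in M ℕ.⊔ N , λ n ≤n → begin
    ∣ (seq x n ℚ.+ seq y n) ℚ.- (seq x′ n ℚ.+ seq y′ n) ∣
      ≡⟨ cong ∣_∣ (ℚS.solve 4 (λ a b c d → (a :+ b) :- (c :+ d) := (a :- c) :+ (b :- d))
           refl (seq x n) (seq y n) (seq x′ n) (seq y′ n)) ⟩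
    ∣ (seq x n ℚ.- seq x′ n) ℚ.+ (seq y n ℚ.- seq y′ n) ∣
      ≤⟨ ℚ.∣p+q∣≤∣p∣+∣q∣ (seq x n ℚ.- seq x′ n) (seq y n ℚ.- seq y′ n) ⟩
    ∣ seq x n ℚ.- seq x′ n ∣ ℚ.+ ∣ seq y n ℚ.- seq y′ n ∣
      ≤⟨ ℚ.+-mono-≤ (dx n (ℕ.m⊔n≤o⇒m≤o M N ≤n)) (dy n (ℕ.m⊔n≤o⇒n≤o M N ≤n)) ⟩
    ½ ℚ.* ε ℚ.+ ½ ℚ.* ε
      ≡⟨ ½+½ ε ⟩
    ε ∎
  where
  open ℚ.≤-Reasoning
  open ℚS

≈-trans : ∀ {x y z} → x ≈ y → y ≈ z → x ≈ z
≈-trans {x} {y} {z} hx hy = mk≈ λ ε 0<ε →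
  let M , dx = eventually-near hx (½ ℚ.* ε) (½-pos 0<ε)
      N , dy = eventually-near hy (½ ℚ.* ε) (½-pos 0<ε)
  in M ℕ.⊔ N , λ n ≤n → begin
    ∣ seq x n ℚ.- seq z n ∣
      ≡⟨ cong ∣_∣ (ℚS.solve 3 (λ a b c → a :- c := (a :- b) :+ (b :- c))
           refl (seq x n) (seq y n) (seq z n)) ⟩
    ∣ (seq x n ℚ.- seq y n) ℚ.+ (seq y n ℚ.- seq z n) ∣
      ≤⟨ ℚ.∣p+q∣≤∣p∣+∣q∣ (seq x n ℚ.- seq y n) (seq y n ℚ.- seq z n) ⟩
    ∣ seq x n ℚ.- seq y n ∣ ℚ.+ ∣ seq y n ℚ.- seq z n ∣
      ≤⟨ ℚ.+-mono-≤ (dx n (ℕ.m⊔n≤o⇒m≤o M N ≤n)) (dy n (ℕ.m⊔n≤o⇒n≤o M N ≤n)) ⟩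
    ½ ℚ.* ε ℚ.+ ½ ℚ.* ε
      ≡⟨ ½+½ ε ⟩
    ε ∎
  where
  open ℚ.≤-Reasoning
  open ℚS

-‿cong : ∀ {x y} → x ≈ y → - x ≈ - y
-‿cong {x} {y} h = mk≈ λ ε 0<ε → let N , near = eventually-near h ε 0<ε in
  N , λ n ≤n → subst (ℚ._≤ ε)
    (trans (∣-∣-sym (seq x n) (seq y n)) (cong ∣_∣ (ℚS.solve 2 (λ a b → b :- a := :- a :- :- b) refl (seq x n) (seq y n))))
    (near n ≤n)
  where open ℚS

*-cong : ∀ {x x′ y y′} → x ≈ x′ → y ≈ y′ → x * y ≈ x′ * y′
*-cong {x} {x′} {y} {y′} hx hy = mk≈ λ ε 0<ε →
  let A , 0≤A , M , x≤ = bounded (cauchy x)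
      B , 0≤B , N , y≤ = bounded (cauchy y′)
      α , 0<α , Aα≤    = shrink A (½ ℚ.* ε) 0≤A (½-pos 0<ε)
      β , 0<β , Bβ≤    = shrink B (½ ℚ.* ε) 0≤B (½-pos 0<ε)
      K , dx           = eventually-near hx β 0<β
      L , dy           = eventually-near hy α 0<α
  in (M ℕ.⊔ N) ℕ.⊔ (K ℕ.⊔ L) , λ n ≤n →
    let n₁ = ℕ.m⊔n≤o⇒m≤o (M ℕ.⊔ N) (K ℕ.⊔ L) ≤n
        n₂ = ℕ.m⊔n≤o⇒n≤o (M ℕ.⊔ N) (K ℕ.⊔ L) ≤n
    in *-close {A} {B} {α} {β} {ε} {seq x n} {seq y n} {seq x′ n} {seq y′ n} 0≤A 0≤B Aα≤ Bβ≤
         (x≤ n (ℕ.m⊔n≤o⇒m≤o M N n₁)) (y≤ n (ℕ.m⊔n≤o⇒n≤o M N n₁))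
         (dy n (ℕ.m⊔n≤o⇒n≤o K L n₂)) (dx n (ℕ.m⊔n≤o⇒m≤o K L n₂))

∣p∣≤ε⇒p≡0 : ∀ p → (∀ ε → 0ℚ ℚ.< ε → ∣ p ∣ ℚ.≤ ε) → p ≡ 0ℚ
∣p∣≤ε⇒p≡0 p h with ∣ p ∣ ℚ.≤? 0ℚ
... | yes ≤0 = ℚ.∣p∣≡0⇒p≡0 p (ℚ.≤-antisym ≤0 (ℚ.0≤∣p∣ p))
... | no  ≰0 with ℚ.<-dense (ℚ.≰⇒> ≰0)
...   | ε , 0<ε , ε<p = contradiction (ℚ.<-≤-trans ε<p (h ε 0<ε)) (ℚ.<-irrefl refl)

fromℚ-injective : ∀ {p q} → fromℚ p ≈ fromℚ q → p ≡ q
fromℚ-injective {p} {q} h = begin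
  p  ≡⟨ ℚS.solve 2 (λ p q → p := (p :- q) :+ q) refl p q ⟩
  (p ℚ.- q) ℚ.+ q ≡⟨ cong (ℚ._+ q) p-q≡0 ⟩
  0ℚ ℚ.+ q  ≡⟨ ℚ.+-identityˡ q ⟩
  q  ∎
  where
  open ≡-Reasoning
  open ℚS
  p-q≡0 : p ℚ.- q ≡ 0ℚ
  p-q≡0 = ∣p∣≤ε⇒p≡0 (p ℚ.- q) λ ε 0<ε →
    let N , near = eventually-near h ε 0<ε in near N ℕ.≤-refl

-- Descent of polynomial identities from the reals to the integers

infix 4 _⇝_

-- The combinators below evaluate a real polynomial expression at integral quantities. `⇝-unique`
-- then turns an identity checked in ℚ at each index into an identity of integers.
record _⇝_ (x : ℝ) (z : ℤ) : Set where
  constructor mk⇝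
  field ⇝⇒≈ : x ≈ fromℤ z

open _⇝_ public

⇝-con : ∀ z → fromℤ z ⇝ z
⇝-con z = mk⇝ (≡⇒≈ λ _ → refl)

⇝-resp-≈ : ∀ {x y z} → x ≈ y → y ⇝ z → x ⇝ z
⇝-resp-≈ x≈y (mk⇝ h) = mk⇝ (≈-trans x≈y h)

infixl 6 _⇝+_ _⇝-_
infixl 7 _⇝*_

_⇝+_ : ∀ {x y a b} → x ⇝ a → y ⇝ b → x + y ⇝ a ℤ.+ b
_⇝+_ {a = a} {b} (mk⇝ hx) (mk⇝ hy) = mk⇝ (≈-trans (+-cong hx hy) (≡⇒≈ λ _ → ι-+ a b))

_⇝*_ : ∀ {x y a b} → x ⇝ a → y ⇝ b → x * y ⇝ a ℤ.* b
_⇝*_ {a = a} {b} (mk⇝ hx) (mk⇝ hy) = mk⇝ (≈-trans (*-cong hx hy) (≡⇒≈ λ _ → ι-* a b))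

_⇝-_ : ∀ {x y a b} → x ⇝ a → y ⇝ b → x - y ⇝ a ℤ.- b
_⇝-_ {a = a} {b} hx (mk⇝ hy) = hx ⇝+ mk⇝ (≈-trans (-‿cong hy) (≡⇒≈ λ _ → ι-neg b))

⇝-unique : ∀ {x y a b} → x ≈ y → x ⇝ a → y ⇝ b → a ≡ b
⇝-unique x≈y (mk⇝ hx) (mk⇝ hy) = ι-injective (fromℚ-injective (≈-trans (≈-sym hx) (≈-trans x≈y hy)))

dist² : Point → Point → ℝ
dist² (x₁ , y₁) (x₂ , y₂) = (x₁ - x₂) ^ 2 + (y₁ - y₂) ^ 2

cross : Point → Point → Point → ℝ
cross (x₁ , y₁) (x₂ , y₂) (x₃ , y₃) = (x₂ - x₁) * (y₃ - y₁) - (x₃ - x₁) * (y₂ - y₁)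

p*p-nonNeg : ∀ p → 0ℚ ℚ.≤ p ℚ.* p
p*p-nonNeg p with ℚ.≤-total 0ℚ p
... | inj₁ 0≤p = *-nonNeg 0≤p 0≤p
... | inj₂ p≤0 = subst (0ℚ ℚ.≤_) (ℚS.solve 1 (λ p → :- p :* :- p := p :* p) refl p) (*-nonNeg 0≤-p 0≤-p)
  where
  open ℚS
  0≤-p : 0ℚ ℚ.≤ ℚ.- p
  0≤-p = ℚ.neg-antimono-≤ p≤0

p^2-nonNeg : ∀ p → 0ℚ ℚ.≤ p ℚ.* (p ℚ.* 1ℚ)
p^2-nonNeg p = subst (0ℚ ℚ.≤_) (sym (p^2≡p*p p)) (p*p-nonNeg p)

dist²-⇝ : ∀ P Q {d} → dist P Q ⇝ d → dist² P Q ⇝ d ℤ.* d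
dist²-⇝ P@(x₁ , y₁) Q@(x₂ , y₂) h = ⇝-resp-≈
  (≈-trans (≡⇒≈ λ n → sym (ℚ.p≥q⇒p⊔q≡p (+-nonNeg (p^2-nonNeg (seq x₁ n ℚ.- seq x₂ n)) (p^2-nonNeg (seq y₁ n ℚ.- seq y₂ n)))))
    (≈-trans (≈-sym (root-^ 2 (dist² P Q))) (≡⇒≈ λ n → p^2≡p*p (seq (dist P Q) n))))
  (h ⇝* h)

cross²-⇝ : ∀ P Q R {a b c} → dist P Q ⇝ a → dist P R ⇝ b → dist Q R ⇝ c →
           fromℤ (+ 4) * (cross P Q R * cross P Q R) ⇝ heron a b c
cross²-⇝ P@(x₁ , y₁) Q@(x₂ , y₂) R@(x₃ , y₃) {a} {b} {c} ha hb hc = ⇝-resp-≈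
  (≡⇒≈ {fromℤ (+ 4) * (cross P Q R * cross P Q R)}
    {fromℤ (+ 4) * (dist² P Q * dist² P R) - (dist² P Q + dist² P R - dist² Q R) * (dist² P Q + dist² P R - dist² Q R)}
    λ n → ℚS.solve 6 (λ x₁ y₁ x₂ y₂ x₃ y₃ →
      let z = (x₂ :- x₁) :* (y₃ :- y₁) :- (x₃ :- x₁) :* (y₂ :- y₁)
          sq = λ t → t :* (t :* con 1ℚ)
          d₁₂ = sq (x₁ :- x₂) :+ sq (y₁ :- y₂)
          d₁₃ = sq (x₁ :- x₃) :+ sq (y₁ :- y₃)
          d₂₃ = sq (x₂ :- x₃) :+ sq (y₂ :- y₃)
          s = d₁₂ :+ d₁₃ :- d₂₃
      in con (ι (+ 4)) :* (z :* z) := con (ι (+ 4)) :* (d₁₂ :* d₁₃) :- s :* s)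
      refl (seq x₁ n) (seq y₁ n) (seq x₂ n) (seq y₂ n) (seq x₃ n) (seq y₃ n))
  (⇝-con (+ 4) ⇝* (A ⇝* B) ⇝- (A ⇝+ B ⇝- C) ⇝* (A ⇝+ B ⇝- C))
  where
  open ℚS
  A : dist² P Q ⇝ a ℤ.* a
  A = dist²-⇝ P Q ha
  B : dist² P R ⇝ b ℤ.* b
  B = dist²-⇝ P R hb
  C : dist² Q R ⇝ c ℤ.* c
  C = dist²-⇝ Q R hc

distances-planar : ∀ {I : Set} (M : I → Point) (D : I → I → ℤ) → (∀ i j → dist (M i) (M j) ⇝ D i j) →
         IsPlanar (λ i j → D i j ℤ.* D i j)
distances-planar M D h a b c i j = ⇝-unique (≡⇒≈ λ n → planarℚ
    (seq (proj₁ (M a)) n) (seq (proj₂ (M a)) n) (seq (proj₁ (M b)) n) (seq (proj₂ (M b)) n)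
    (seq (proj₁ (M c)) n) (seq (proj₂ (M c)) n) (seq (proj₁ (M i)) n) (seq (proj₂ (M i)) n)
    (seq (proj₁ (M j)) n) (seq (proj₂ (M j)) n))
  ((⇝-con (+ 4) ⇝* (s a b ⇝* s i j) ⇝- (E i ⇝- E j) ⇝* (E i ⇝- E j)) ⇝* N)
  ((Z i ⇝- Z j) ⇝* (Z i ⇝- Z j))
  where
  s : ∀ i j → dist² (M i) (M j) ⇝ D i j ℤ.* D i j
  s i j = dist²-⇝ (M i) (M j) (h i j)
  V = s a b ⇝+ s a c ⇝- s b c
  N = ⇝-con (+ 4) ⇝* (s a b ⇝* s a c) ⇝- V ⇝* V
  E = λ i → s a b ⇝+ s a i ⇝- s b i
  W = λ i → s a c ⇝+ s a i ⇝- s c i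
  Z = λ i → ⇝-con (+ 2) ⇝* (s a b ⇝* W i) ⇝- E i ⇝* V

-- A term with `∣x∣ > ε` would push the sum of squares above `ε²`, so the hypothesis is used with
-- the tolerance `ε²`.
sum-of-squares≈0 : ∀ {x y} → x * x + y * y ≈ 0ℝ → x ≈ 0ℝ
sum-of-squares≈0 {x} {y} h = mk≈ λ ε 0<ε →
  let N , near = eventually-near h (ε ℚ.* ε) (*-pos 0<ε 0<ε)
  in N , λ n ≤n → ℚ.≮⇒≥ λ ε<∣x∣ →
    let t   = seq x n ℚ.- 0ℚ
        t≡x = ℚ.+-identityʳ (seq x n)
    in ℚ.<-irrefl refl (begin-strict
      ε ℚ.* ε  <⟨ ℚ.*-monoˡ-<-pos ε {{ℚ.positive 0<ε}} ε<∣x∣ ⟩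
      ∣ t ∣ ℚ.* ε  ≤⟨ ℚ.*-monoˡ-≤-nonNeg ∣ t ∣ {{ℚ.nonNegative (ℚ.0≤∣p∣ t)}} (ℚ.<⇒≤ ε<∣x∣) ⟩
      ∣ t ∣ ℚ.* ∣ t ∣  ≡⟨ ℚ.∣p*q∣≡∣p∣*∣q∣ t t ⟨
      ∣ t ℚ.* t ∣  ≡⟨ ℚ.0≤p⇒∣p∣≡p (p*p-nonNeg t) ⟩
      t ℚ.* t  ≡⟨ cong₂ ℚ._*_ t≡x t≡x ⟩
      seq x n ℚ.* seq x n  ≤⟨ p≤p+q (p*p-nonNeg (seq y n)) ⟩
      seq x n ℚ.* seq x n ℚ.+ seq y n ℚ.* seq y n  ≤⟨ p≤∣p∣ _ ⟩
      ∣ seq x n ℚ.* seq x n ℚ.+ seq y n ℚ.* seq y n ∣  ≡⟨ cong ∣_∣ (ℚ.+-identityʳ (seq x n ℚ.* seq x n ℚ.+ seq y n ℚ.* seq y n)) ⟨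
      ∣ seq x n ℚ.* seq x n ℚ.+ seq y n ℚ.* seq y n ℚ.- 0ℚ ∣  ≤⟨ near n ≤n ⟩
      ε ℚ.* ε  ∎)
  where open ℚ.≤-Reasoning

x-y≈0⇒x≈y : ∀ {x y} → x - y ≈ 0ℝ → x ≈ y
x-y≈0⇒x≈y {x} {y} h = ≈-trans
  (≡⇒≈ {x} {(x - y) + y} λ n → solve 2 (λ a b → a := (a :- b) :+ b) refl (seq x n) (seq y n))
  (≈-trans (+-cong h ≈-refl) (≡⇒≈ λ n → ℚ.+-identityˡ (seq y n)))
  where open ℚS

dist²≈0⇒≈ₚ : ∀ P Q → dist² P Q ⇝ + 0 → P ≈ₚ Q
dist²≈0⇒≈ₚ (x₁ , y₁) (x₂ , y₂) (mk⇝ h) =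
  x-y≈0⇒x≈y (sum-of-squares≈0 {x₁ - x₂} {y₁ - y₂} (≈-trans (≡⇒≈ λ n →
    sym (cong₂ ℚ._+_ (p^2≡p*p (seq x₁ n ℚ.- seq x₂ n)) (p^2≡p*p (seq y₁ n ℚ.- seq y₂ n)))) h)) ,
  x-y≈0⇒x≈y (sum-of-squares≈0 {y₁ - y₂} {x₁ - x₂} (≈-trans (≡⇒≈ λ n → trans (ℚ.+-comm ((seq y₁ n ℚ.- seq y₂ n) ℚ.* (seq y₁ n ℚ.- seq y₂ n)) ((seq x₁ n ℚ.- seq x₂ n) ℚ.* (seq x₁ n ℚ.- seq x₂ n)))
    (sym (cong₂ ℚ._+_ (p^2≡p*p (seq x₁ n ℚ.- seq x₂ n)) (p^2≡p*p (seq y₁ n ℚ.- seq y₂ n))))) h))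

cross≈0⇒Collinear : ∀ P Q R → ¬ P ≈ₚ Q → cross P Q R ≈ 0ℝ → Collinear (P Vector.∷ Q Vector.∷ R Vector.∷ Vector.[])
cross≈0⇒Collinear (x₁ , y₁) (x₂ , y₂) (x₃ , y₃) P≉Q h = record
  { a = y₁ - y₂
  ; b = x₂ - x₁
  ; c = x₁ * y₂ - x₂ * y₁
  ; nondegenerate = λ { (a≈0 , b≈0) → P≉Q (≈-sym (x-y≈0⇒x≈y b≈0) , x-y≈0⇒x≈y a≈0) }
  } , λ
  { Fin.zero → ≡⇒≈ λ n → solve 4 (λ x₁ y₁ x₂ y₂ →
      (y₁ :- y₂) :* x₁ :+ (x₂ :- x₁) :* y₁ :+ (x₁ :* y₂ :- x₂ :* y₁) := con 0ℚ)
      refl (seq x₁ n) (seq y₁ n) (seq x₂ n) (seq y₂ n)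
  ; (Fin.suc Fin.zero) → ≡⇒≈ λ n → solve 4 (λ x₁ y₁ x₂ y₂ →
      (y₁ :- y₂) :* x₂ :+ (x₂ :- x₁) :* y₂ :+ (x₁ :* y₂ :- x₂ :* y₁) := con 0ℚ)
      refl (seq x₁ n) (seq y₁ n) (seq x₂ n) (seq y₂ n)
  ; (Fin.suc (Fin.suc Fin.zero)) → ≈-trans (≡⇒≈ λ n → solve 6 (λ x₁ y₁ x₂ y₂ x₃ y₃ →
      (y₁ :- y₂) :* x₃ :+ (x₂ :- x₁) :* y₃ :+ (x₁ :* y₂ :- x₂ :* y₁) :=
      (x₂ :- x₁) :* (y₃ :- y₁) :- (x₃ :- x₁) :* (y₂ :- y₁))
      refl (seq x₁ n) (seq y₁ n) (seq x₂ n) (seq y₂ n) (seq x₃ n) (seq y₃ n)) h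
  }
  where open ℚS

heron≡0⇒Collinear : ∀ P Q R {a b c} → dist P Q ⇝ a → dist P R ⇝ b → dist Q R ⇝ c →
                    ¬ P ≈ₚ Q → heron a b c ≡ + 0 → Collinear (P Vector.∷ Q Vector.∷ R Vector.∷ Vector.[])
heron≡0⇒Collinear P Q R ha hb hc P≉Q H≡0 = cross≈0⇒Collinear P Q R P≉Q
  -- The second square is 0, which turns the lemma into the extraction of `z ≈ 0` from `z² ≈ 0`.
  (sum-of-squares≈0 {z} {0ℝ} (≈-trans (≡⇒≈ λ n → solve 1 (λ z →
      z :* z :+ con 0ℚ :* con 0ℚ := con (+ 1 ℚ./ 4) :* (con (ι (+ 4)) :* (z :* z))) refl (seq z n))
    (≈-trans (*-cong {fromℚ (+ 1 ℚ./ 4)} {fromℚ (+ 1 ℚ./ 4)} ≈-refl (⇝⇒≈ (cross²-⇝ P Q R ha hb hc)))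
      (≡⇒≈ λ _ → trans (cong (λ h → (+ 1 ℚ./ 4) ℚ.* ι h) H≡0) refl))))
  where
  open ℚS
  z = cross P Q R

abs*abs : ∀ p → (p ℚ.⊔ ℚ.- p) ℚ.* (p ℚ.⊔ ℚ.- p) ≡ p ℚ.* p
abs*abs p with ℚ.⊔-sel p (ℚ.- p)
... | inj₁ eq = cong₂ ℚ._*_ eq eq
... | inj₂ eq = trans (cong₂ ℚ._*_ eq eq) (ℚS.solve 1 (λ p → :- p :* :- p := p :* p) refl p)
  where open ℚS

√*√ : ∀ q → √ fromℤ (+ q) * √ fromℤ (+ q) ≈ fromℤ (+ q)
√*√ q = ≈-trans (≡⇒≈ λ n → sym (p^2≡p*p (seq (√ fromℤ (+ q)) n)))
  (≈-trans (root-^ 2 (fromℤ (+ q))) (≡⇒≈ λ _ → ℚ.p≥q⇒p⊔q≡p (RootEstimates./-nonNeg q 0)))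

*-denominator : ∀ r → r ℚ.* ι (ℚ.↧ r) ≡ ι (ℚ.↥ r)
*-denominator r@(mkℚ n d _) = ℚ.toℚᵘ-injective (begin
  ℚ.toℚᵘ (r ℚ.* ι (+ suc d))  ≈⟨ ℚ.toℚᵘ-homo-* r (ι (+ suc d)) ⟩
  ℚᵘ.mkℚᵘ n d ℚᵘ.* ℚ.toℚᵘ (ι (+ suc d))  ≈⟨ ℚᵘ.*-congˡ {ℚᵘ.mkℚᵘ n d} (toℚᵘ-ι (+ suc d)) ⟩
  ℚᵘ.mkℚᵘ n d ℚᵘ.* ℚᵘ.mkℚᵘ (+ suc d) 0  ≈⟨ ℚᵘ.*≡* (trans (ℤ.*-assoc n (+ suc d) (+ 1)) (cong (n ℤ.*_) (ℤ.pos-* (suc d) 1) )) ⟩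
  ℚᵘ.mkℚᵘ n 0  ≈⟨ ℚᵘ.≃-sym (toℚᵘ-ι n) ⟩
  ℚ.toℚᵘ (ι n)  ∎)
  where open ℚᵘ.≃-Reasoning

-- Squaring the area formula removes the absolute value and the root: `heron = 16 r² q`. Multiplying
-- by the squared denominator of `r` yields the witnesses for `_∼_`.
area²-commensurable : ∀ P Q R {a b c} q r → dist P Q ⇝ a → dist P R ⇝ b → dist Q R ⇝ c →
  triangleArea P Q R ≈ fromℚ r * √ fromℤ (+ q) →
  heron a b c ℤ.* (ℚ.↧ r ℤ.* ℚ.↧ r) ≡ + q ℤ.* (+ 4 ℤ.* ℚ.↥ r ℤ.* (+ 4 ℤ.* ℚ.↥ r))
area²-commensurable P Q R {a} {b} {c} q r ha hb hc area = ι-injective (begin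
  ι (H ℤ.* (d ℤ.* d))  ≡⟨ trans (sym (ι-* H (d ℤ.* d))) (cong (ι H ℚ.*_) (sym (ι-* d d))) ⟩
  ι H ℚ.* (ι d ℚ.* ι d)  ≡⟨ cong (ℚ._* (ι d ℚ.* ι d)) H≡ ⟩
  ι (+ 16) ℚ.* (r ℚ.* r ℚ.* ι (+ q)) ℚ.* (ι d ℚ.* ι d) ≡⟨ solve 3 (λ r q d →
      con (ι (+ 16)) :* (r :* r :* q) :* (d :* d) := q :* (con (ι (+ 4)) :* (r :* d) :* (con (ι (+ 4)) :* (r :* d)))) refl r (ι (+ q)) (ι d) ⟩
  ι (+ q) ℚ.* (ι (+ 4) ℚ.* (r ℚ.* ι d) ℚ.* (ι (+ 4) ℚ.* (r ℚ.* ι d)))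
    ≡⟨ cong (λ t → ι (+ q) ℚ.* (ι (+ 4) ℚ.* t ℚ.* (ι (+ 4) ℚ.* t))) (*-denominator r) ⟩
  ι (+ q) ℚ.* (ι (+ 4) ℚ.* ι m ℚ.* (ι (+ 4) ℚ.* ι m))
    ≡⟨ cong (λ t → ι (+ q) ℚ.* (t ℚ.* t)) (ι-* (+ 4) m) ⟩
  ι (+ q) ℚ.* (ι (+ 4 ℤ.* m) ℚ.* ι (+ 4 ℤ.* m))
    ≡⟨ trans (cong (ι (+ q) ℚ.*_) (ι-* (+ 4 ℤ.* m) (+ 4 ℤ.* m))) (ι-* (+ q) (+ 4 ℤ.* m ℤ.* (+ 4 ℤ.* m))) ⟩
  ι (+ q ℤ.* (+ 4 ℤ.* m ℤ.* (+ 4 ℤ.* m)))  ∎)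
  where
  open ≡-Reasoning
  open ℚS
  H = heron a b c
  d = ℚ.↧ r
  m = ℚ.↥ r
  S = triangleArea P Q R
  z = cross P Q R
  s = √ fromℤ (+ q)
  H≡ : ι H ≡ ι (+ 16) ℚ.* (r ℚ.* r ℚ.* ι (+ q))
  H≡ = fromℚ-injective (≈-trans (≈-sym (⇝⇒≈ (cross²-⇝ P Q R ha hb hc)))
    (≈-trans (≡⇒≈ {y = fromℤ (+ 16) * (S * S)} λ n → trans
        (cong (ι (+ 4) ℚ.*_) (sym (abs*abs (seq z n))))
        (solve 1 (λ t → con (ι (+ 4)) :* (t :* t) := con (ι (+ 16)) :* (con ½ :* t :* (con ½ :* t)))
          refl (seq z n ℚ.⊔ ℚ.- seq z n)))
    (≈-trans (*-cong {fromℤ (+ 16)} ≈-refl (*-cong area area))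
    (≈-trans (≡⇒≈ {y = fromℤ (+ 16) * (fromℚ (r ℚ.* r) * (s * s))} λ n →
        solve 2 (λ r s → con (ι (+ 16)) :* (r :* s :* (r :* s)) := con (ι (+ 16)) :* (r :* r :* (s :* s))) refl r (seq s n))
    (≈-trans (*-cong {fromℤ (+ 16)} ≈-refl
        (*-cong {fromℚ (r ℚ.* r)} ≈-refl (√*√ q)))
      (≡⇒≈ λ _ → refl))))))

-- The integer supplied by `integral` has no prescribed sign. A negative one is at most -1, and the
-- tolerance ½ already separates it from the nonnegative terms of the root.
dist-⇝-∣∣ : ∀ P Q {d} → dist P Q ≈ fromℤ d → dist P Q ⇝ + ℤ.∣ d ∣
dist-⇝-∣∣ P Q {+ d} h = mk⇝ h
dist-⇝-∣∣ P Q { -[1+ d ]} h = contradiction (ℚ.≤-<-trans 0≤ (begin-strict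
    ι -[1+ d ] ℚ.+ ½  ≤⟨ ℚ.+-monoˡ-≤ ½ (ι-mono { -[1+ d ]} {ℤ.- + 1} (ℤ.-≤- ℕ.z≤n)) ⟩
    ι (ℤ.- + 1) ℚ.+ ½  <⟨ ℚ.negative⁻¹ (ι (ℤ.- + 1) ℚ.+ ½) ⟩
    0ℚ  ∎)) (ℚ.<-irrefl refl)
  where
  open ℚ.≤-Reasoning
  0≤ : 0ℚ ℚ.≤ ι -[1+ d ] ℚ.+ ½
  0≤ = let N , near = eventually-near h ½ (ℚ.positive⁻¹ ½) in
    ℚ.≤-trans (RootEstimates.0≤rootℚ 2 N (seq (dist² P Q) N ℚ.⊔ 0ℚ))
      (∣-∣≤⁻¹ {seq (dist P Q) N} (near N ℕ.≤-refl))

dist²-sym : ∀ P Q n → seq (dist² P Q) n ≡ seq (dist² Q P) n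
dist²-sym (x₁ , y₁) (x₂ , y₂) n = solve 4 (λ a b c d →
    (a :- c) :* ((a :- c) :* con 1ℚ) :+ (b :- d) :* ((b :- d) :* con 1ℚ) :=
    (c :- a) :* ((c :- a) :* con 1ℚ) :+ (d :- b) :* ((d :- b) :* con 1ℚ))
  refl (seq x₁ n) (seq y₁ n) (seq x₂ n) (seq y₂ n)
  where open ℚS

dist-sym : ∀ P Q → dist P Q ≈ dist Q P
dist-sym P Q = ≡⇒≈ λ n → cong (λ t → rootℚ 2 n (t ℚ.⊔ 0ℚ)) (dist²-sym P Q n)

dist²-refl : ∀ P → dist² P P ≈ 0ℝ
dist²-refl (x , y) = ≡⇒≈ λ n → solve 2 (λ a b →
    (a :- a) :* ((a :- a) :* con 1ℚ) :+ (b :- b) :* ((b :- b) :* con 1ℚ) := con 0ℚ)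
  refl (seq x n) (seq y n)
  where open ℚS

module _ {n : ℕ} {M : Fin n → Point} (S : IsPlanarIntegralPointSet M) where
  open IsPlanarIntegralPointSet S

  distance : Fin n → Fin n → ℕ
  distance i j = ℤ.∣ proj₁ (integral i j) ∣

  dist-⇝-distance : ∀ i j → dist (M i) (M j) ⇝ + distance i j
  dist-⇝-distance i j = dist-⇝-∣∣ (M i) (M j) {proj₁ (integral i j)} (proj₂ (integral i j))

  isDistanceMatrix : IsInSemiGeneralPosition M → ∀ {q} → IsCharacteristic M q → IsDistanceMatrix q distance
  isDistanceMatrix general {q} char = record
    { D-refl  = λ i → ℤ.+-injective (i*i≡0⇒i≡0 (+ distance i i)
        (⇝-unique (dist²-refl (M i)) (dist²-⇝ (M i) (M i) (h i i)) (⇝-con (+ 0))))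
    ; D-sym   = λ i j → ℤ.+-injective (⇝-unique (dist-sym (M i) (M j)) (h i j) (h j i))
    ; D-pos   = λ {i} {j} i≢j → ℕ.n≢0⇒n>0 λ D≡0 → i≢j (distinct (dist²≈0⇒≈ₚ (M i) (M j)
        (subst (λ d → dist² (M i) (M j) ⇝ + d ℤ.* + d) D≡0 (dist²-⇝ (M i) (M j) (h i j)))))
    ; planar  = distances-planar M (λ i j → + distance i j) h
    ; heron≢0 = λ {i} {j} {k} i≢j j≢k i≢k H≡0 → general i j k i≢j j≢k i≢k
        (heron≡0⇒Collinear (M i) (M j) (M k) (h i j) (h i k) (h j k) (i≢j ∘ distinct) H≡0)
    ; heron-commensurable = λ i j k → let r , area = commensurable i j k in
        mk∼ (ℚ.↧ r) (+ 4 ℤ.* ℚ.↥ r) (λ ())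
          (area²-commensurable (M i) (M j) (M k) q r (h i j) (h i k) (h j k) area)
    }
    where
    open IsCharacteristic char
    h = dist-⇝-distance

-- The diameter and the power 5/4

≤-trans : ∀ {x y z} → x ≤ y → y ≤ z → x ≤ z
≤-trans {x} {y} {z} h k = mk≤ λ ε 0<ε →
  let K , x≤ = eventually-below h (½ ℚ.* ε) (½-pos 0<ε)
      L , y≤ = eventually-below k (½ ℚ.* ε) (½-pos 0<ε)
  in K ℕ.⊔ L , λ n ≤n → begin
    seq x n  ≤⟨ x≤ n (ℕ.m⊔n≤o⇒m≤o K L ≤n) ⟩
    seq y n ℚ.+ ½ ℚ.* ε  ≤⟨ ℚ.+-monoˡ-≤ (½ ℚ.* ε) (y≤ n (ℕ.m⊔n≤o⇒n≤o K L ≤n)) ⟩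
    seq z n ℚ.+ ½ ℚ.* ε ℚ.+ ½ ℚ.* ε  ≡⟨ trans (ℚ.+-assoc (seq z n) (½ ℚ.* ε) (½ ℚ.* ε)) (cong (seq z n ℚ.+_) (½+½ ε)) ⟩
    seq z n ℚ.+ ε  ∎
  where open ℚ.≤-Reasoning

≈⇒≥ : ∀ {x y} → x ≈ y → y ≤ x
≈⇒≥ {x} {y} h = mk≤ λ ε 0<ε → let N , near = eventually-near h ε 0<ε in
  N , λ n ≤n → ∣-∣≤⁻¹′ {seq x n} (near n ≤n)

x≤x⊔y : ∀ x y → x ≤ x ⊔ y
x≤x⊔y x y = mk≤ λ ε 0<ε → 0 , λ n _ → ℚ.≤-trans (ℚ.p≤p⊔q (seq x n) (seq y n)) (p≤p+q (ℚ.<⇒≤ 0<ε))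

y≤x⊔y : ∀ x y → y ≤ x ⊔ y
y≤x⊔y x y = mk≤ λ ε 0<ε → 0 , λ n _ → ℚ.≤-trans (ℚ.p≤q⊔p (seq x n) (seq y n)) (p≤p+q (ℚ.<⇒≤ 0<ε))

maximum : ∀ {n} → (Fin n → ℕ) → ℕ
maximum = Vector.foldr ℕ._⊔_ 0

≤-maximum : ∀ {n} (f : Fin n → ℕ) i → f i ℕ.≤ maximum f
≤-maximum f Fin.zero    = ℕ.m≤m⊔n (f Fin.zero) _
≤-maximum f (Fin.suc i) = ℕ.≤-trans (≤-maximum (f ∘ Fin.suc) i) (ℕ.m≤n⊔m (f Fin.zero) _)

-- Which argument attains the maximum is decided among natural numbers, where this is possible; the
-- real maximum is only bounded from below.
maximum-≤ : ∀ {n} (f : Fin n → ℕ) (g : Fin n → ℝ) → (∀ i → fromℤ (+ f i) ≤ g i) →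
            fromℤ (+ maximum f) ≤ Vector.foldr _⊔_ 0ℝ g
maximum-≤ {zero}  f g h = mk≤ λ ε 0<ε → 0 , λ n _ → p≤p+q (ℚ.<⇒≤ 0<ε)
maximum-≤ {suc n} f g h with ℕ.⊔-sel (f Fin.zero) (maximum (f ∘ Fin.suc))
... | inj₁ eq = subst (λ m → fromℤ (+ m) ≤ _) (sym eq) (≤-trans (h Fin.zero) (x≤x⊔y _ _))
... | inj₂ eq = subst (λ m → fromℤ (+ m) ≤ _) (sym eq)
  (≤-trans (maximum-≤ (f ∘ Fin.suc) (g ∘ Fin.suc) (h ∘ Fin.suc)) (y≤x⊔y (g Fin.zero) _))

ι-^ : ∀ m k → ι (+ m) ^ℚ k ≡ ι (+ (m ℕ.^ k))
ι-^ m zero    = refl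
ι-^ m (suc k) = trans (cong (ι (+ m) ℚ.*_) (ι-^ m k)) (trans (ι-* (+ m) (+ (m ℕ.^ k))) (cong ι (sym (ℤ.pos-* m (m ℕ.^ k)))))

^-distribʳ-* : ∀ p q k → (p ℚ.* q) ^ℚ k ≡ p ^ℚ k ℚ.* q ^ℚ k
^-distribʳ-* p q zero    = refl
^-distribʳ-* p q (suc k) = trans (cong (p ℚ.* q ℚ.*_) (^-distribʳ-* p q k))
  (ℚS.solve 4 (λ p q r s → p :* q :* (r :* s) := p :* r :* (q :* s)) refl p q (p ^ℚ k) (q ^ℚ k))
  where open ℚS

/-* : ∀ m d → (+ m ℚ./ suc d) ℚ.* ι (+ suc d) ≡ ι (+ m)
/-* m d = ℚ.toℚᵘ-injective (begin
  ℚ.toℚᵘ ((+ m ℚ./ suc d) ℚ.* ι (+ suc d))  ≈⟨ ℚ.toℚᵘ-homo-* (+ m ℚ./ suc d) (ι (+ suc d)) ⟩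
  ℚ.toℚᵘ (+ m ℚ./ suc d) ℚᵘ.* ℚ.toℚᵘ (ι (+ suc d))  ≈⟨ ℚᵘ.*-cong (ℚ.toℚᵘ-fromℚᵘ (ℚᵘ.mkℚᵘ (+ m) d)) (toℚᵘ-ι (+ suc d)) ⟩
  ℚᵘ.mkℚᵘ (+ m) d ℚᵘ.* ℚᵘ.mkℚᵘ (+ suc d) 0  ≈⟨ ℚᵘ.*≡* (trans (ℤ.*-assoc (+ m) (+ suc d) (+ 1)) (cong (+ m ℤ.*_) (ℤ.pos-* (suc d) 1))) ⟩
  ℚᵘ.mkℚᵘ (+ m) 0  ≈⟨ ℚᵘ.≃-sym (toℚᵘ-ι (+ m)) ⟩
  ℚ.toℚᵘ (ι (+ m))  ∎)
  where open ℚᵘ.≃-Reasoning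

-- Fourth powers are compared: that of the approximate root is at most
-- `t⁵ ≤ d⁴ < d⁴ + ε⁴ ≤ (d + ε)⁴`. The tolerance `ε` provides the strict inequality under which
-- `^-cancelˡ-<` removes the exponent.
power-bound : ∀ m e d → m ℕ.^ 5 ℕ.≤ suc e ℕ.^ 5 ℕ.* d ℕ.^ 4 →
              fromℚ (+ m ℚ./ suc e) ^[ 5 / 4 ] ≤ fromℤ (+ d)
power-bound m e d h = mk≤ λ ε 0<ε → 0 , λ n _ → ℚ.<⇒≤
  (^-cancelˡ-< (+-nonNeg 0≤d (ℚ.<⇒≤ 0<ε)) 4 (begin-strict
    rootℚ 4 n (seq x n ℚ.⊔ 0ℚ) ^ℚ 4  ≤⟨ RootEstimates.rootℚ^k≤ 4 n (seq x n ℚ.⊔ 0ℚ) (ℚ.p≤q⊔p (seq x n) 0ℚ) ⟩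
    seq x n ℚ.⊔ 0ℚ  ≡⟨ cong (ℚ._⊔ 0ℚ) (seq-^ (fromℚ t) 5 n) ⟩
    t ^ℚ 5 ℚ.⊔ 0ℚ  ≡⟨ ℚ.p≥q⇒p⊔q≡p (^-nonNeg (RootEstimates./-nonNeg m e) 5) ⟩
    t ^ℚ 5  ≤⟨ t^5≤d^4 ⟩
    ι (+ d) ^ℚ 4  ≡⟨ ℚ.+-identityʳ (ι (+ d) ^ℚ 4) ⟨
    ι (+ d) ^ℚ 4 ℚ.+ 0ℚ  <⟨ ℚ.+-monoʳ-< (ι (+ d) ^ℚ 4) (^-pos 0<ε 4) ⟩
    ι (+ d) ^ℚ 4 ℚ.+ ε ^ℚ 4  ≤⟨ ^-superadditive 0≤d (ℚ.<⇒≤ 0<ε) 4 ⟩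
    (ι (+ d) ℚ.+ ε) ^ℚ 4  ∎))
  where
  open ℚ.≤-Reasoning
  t = + m ℚ./ suc e
  x = fromℚ t ^ 5
  0≤d : 0ℚ ℚ.≤ ι (+ d)
  0≤d = RootEstimates./-nonNeg d 0
  c = ι (+ (suc e ℕ.^ 5))
  0<c : 0ℚ ℚ.< c
  0<c = ℚ.positive⁻¹ c {{ℚ.normalize-pos (suc e ℕ.^ 5) 1 {{_}} {{ℕ.m^n≢0 (suc e) 5}}}}
  t^5≤d^4 : t ^ℚ 5 ℚ.≤ ι (+ d) ^ℚ 4
  t^5≤d^4 = ℚ.*-cancelʳ-≤-pos c {{ℚ.positive 0<c}} (begin
    t ^ℚ 5 ℚ.* c  ≡⟨ cong (t ^ℚ 5 ℚ.*_) (ι-^ (suc e) 5) ⟨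
    t ^ℚ 5 ℚ.* ι (+ suc e) ^ℚ 5  ≡⟨ ^-distribʳ-* t (ι (+ suc e)) 5 ⟨
    (t ℚ.* ι (+ suc e)) ^ℚ 5  ≡⟨ cong (_^ℚ 5) (/-* m e) ⟩
    ι (+ m) ^ℚ 5  ≡⟨ ι-^ m 5 ⟩
    ι (+ (m ℕ.^ 5))  ≤⟨ ι-mono (ℤ.+≤+ h) ⟩
    ι (+ (suc e ℕ.^ 5 ℕ.* d ℕ.^ 4))  ≡⟨ cong ι (ℤ.pos-* (suc e ℕ.^ 5) (d ℕ.^ 4)) ⟩
    ι (+ (suc e ℕ.^ 5) ℤ.* + (d ℕ.^ 4))  ≡⟨ ι-* (+ (suc e ℕ.^ 5)) (+ (d ℕ.^ 4)) ⟨
    c ℚ.* ι (+ (d ℕ.^ 4))  ≡⟨ ℚ.*-comm c (ι (+ (d ℕ.^ 4))) ⟩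
    ι (+ (d ℕ.^ 4)) ℚ.* c  ≡⟨ cong (ℚ._* c) (ι-^ d 4) ⟨
    ι (+ d) ^ℚ 4 ℚ.* c  ∎)

squarefree⇒%4≢0 : ∀ {q} → Squarefree q → q % 4 ≢ 0
squarefree⇒%4≢0 {q} squarefree q%4≡0 = contradiction (squarefree 2 (m%n≡0⇒n∣m q 4 q%4≡0)) λ ()

≢4k+3⇒%4≢3 : ∀ {q} → ¬ (∃[ k ] q ≡ 4 ℕ.* k ℕ.+ 3) → q % 4 ≢ 3
≢4k+3⇒%4≢3 {q} q≢4k+3 q%4≡3 = q≢4k+3 (q ℕ./ 4 , (begin
  q  ≡⟨ m≡m%n+[m/n]*n q 4 ⟩
  q % 4 ℕ.+ q ℕ./ 4 ℕ.* 4  ≡⟨ cong (ℕ._+ q ℕ./ 4 ℕ.* 4) q%4≡3 ⟩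
  3 ℕ.+ q ℕ./ 4 ℕ.* 4  ≡⟨ ℕ.+-comm 3 (q ℕ./ 4 ℕ.* 4) ⟩
  q ℕ./ 4 ℕ.* 4 ℕ.+ 3  ≡⟨ cong (ℕ._+ 3) (ℕ.*-comm (q ℕ./ 4) 4) ⟩
  4 ℕ.* (q ℕ./ 4) ℕ.+ 3  ∎))
  where open ≡-Reasoning

theorem6p2 : (n : ℕ) → 3 ℕ.≤ n →
    (M : Fin n → Point) →
    IsPlanarIntegralPointSet M →
    IsInSemiGeneralPosition M →
    (q : ℕ) → IsCharacteristic M q →
    ¬ (∃[ k ] q ≡ 4 ℕ.* k ℕ.+ 3) →
    fromℚ (+ (25 ℕ.* n) ℚ./ 36) ^[ 5 / 4 ] ≤ diam M
theorem6p2 n 3≤n M S general q char q≢4k+3 = ≤-trans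
  (power-bound (25 ℕ.* n) 35 d (diameter-bound {n} {q} {D} (isDistanceMatrix S general char)
    (squarefree⇒%4≢0 (IsCharacteristic.q-squarefree char)) (≢4k+3⇒%4≢3 q≢4k+3) 3≤n d
    (λ i j → ℕ.≤-trans (≤-maximum (D i) j) (≤-maximum (λ i → maximum (D i)) i))))
  (maximum-≤ (λ i → maximum (D i)) _ λ i → maximum-≤ (D i) _ λ j → ≈⇒≥ (⇝⇒≈ (dist-⇝-distance S i j)))
  where
  D = distance S
  d = maximum (λ i → maximum (D i))
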